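{- Let $p$ be a prime number and let $H$ be a $p\times p$ circulant complex Hadamard matrix all of whose entries are $p$-th roots of unity (i.e. $H\in C^{circ}_p(p)$). Then $H$ is equivalent to the Fourier matrix $F_p=(w^{ij})_{i,j=0}^{p-1}$, $w=e^{2\pi i/p}$.
   Context: A complex Hadamard matrix of order $n$ is a matrix $H\in M_n(\mathbb C)$ with $|H_{ij}|=1$ for all $i,j$ and pairwise orthogonal rows (equivalently $H/\sqrt n$ is unitary). A matrix $H=(H_{ij})_{i,j=0}^{n-1}$ is circulant if $H_{ij}$ depends only on $j-i$ modulo $n$. $C^{circ}_n(l)$ denotes the set of $n\times n$ circulant complex Hadamard matrices whose entries are all $l$-th roots of unity. Two complex Hadamard matrices are equivalent if one can be obtained from the other by permuting rows, permuting columns, and multiplying individual rows and individual columns by complex numbers of modulus one. -}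

module Defs where

open import Algebra.Bundles.Raw using (RawRing)
import Algebra.Definitions.RawSemiring as RawSemiringDefs
open import Data.Fin.Base using (Fin; toℕ)
open import Data.Fin.Permutation using (Permutation′; _⟨$⟩ʳ_)
open import Data.Integer.Base as ℤ using (+_)
open import Data.Integer.Divisibility using () renaming (_∣_ to _∣ℤ_)
open import Data.Nat.Base as ℕ using (ℕ; _!)
import Data.Nat.Properties as ℕₚ
open import Data.Product.Base using (_×_; _,_; ∃)
open import Data.Rational.Base as ℚ using (ℚ; 0ℚ; 1ℚ; ½; ∣_∣; _/_; 1/_; Positive; positive)
import Data.Rational.Properties as ℚₚ
open import Data.Rational.Solver using (module +-*-Solver)
open import Level using (0ℓ)
open import Relation.Binary.PropositionalEquality
  using (_≡_; _≢_; refl; sym; trans; cong; subst)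
open import Relation.Nullary.Negation using (¬_)

Eventually : (ℕ → Set) → Set
Eventually P = ∃ λ N → ∀ n → N ℕ.≤ n → P n

IsCauchy : (ℕ → ℚ) → Set
IsCauchy x = ∀ ε → 0ℚ ℚ.< ε →
  ∃ λ N → ∀ m n → N ℕ.≤ m → N ℕ.≤ n → ∣ x m ℚ.- x n ∣ ℚ.< ε

abstract
  ∣p-p∣≡0 : ∀ p → ∣ p ℚ.- p ∣ ≡ 0ℚ
  ∣p-p∣≡0 p = cong ∣_∣ (ℚₚ.+-inverseʳ p)

  half+half : ∀ ε → ε ℚ.* ½ ℚ.+ ε ℚ.* ½ ≡ ε
  half+half ε = trans (sym (ℚₚ.*-distribˡ-+ ε ½ ½)) (ℚₚ.*-identityʳ ε)

  half>0 : ∀ {ε} → 0ℚ ℚ.< ε → 0ℚ ℚ.< ε ℚ.* ½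
  half>0 {ε} ε>0 = subst (ℚ._< ε ℚ.* ½) (ℚₚ.*-zeroˡ ½) (ℚₚ.*-monoˡ-<-pos ½ ε>0)

  const-cauchy : ∀ q → IsCauchy (λ _ → q)
  const-cauchy q ε ε>0 = 0 , λ _ _ _ _ → subst (ℚ._< ε) (sym (∣p-p∣≡0 q)) ε>0

  +-cauchy : ∀ {x y} → IsCauchy x → IsCauchy y → IsCauchy (λ n → x n ℚ.+ y n)
  +-cauchy {x} {y} cx cy ε ε>0
    with cx (ε ℚ.* ½) (half>0 ε>0) | cy (ε ℚ.* ½) (half>0 ε>0)
  ... | M , hM | N , hN = M ℕ.⊔ N , λ m n ≤m ≤n → begin-strict
    ∣ (x m ℚ.+ y m) ℚ.- (x n ℚ.+ y n) ∣
      ≡⟨ cong ∣_∣ (solve 4 (λ a b c d → (a :+ b) :- (c :+ d) := (a :- c) :+ (b :- d))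
                     refl (x m) (y m) (x n) (y n)) ⟩
    ∣ (x m ℚ.- x n) ℚ.+ (y m ℚ.- y n) ∣
      ≤⟨ ℚₚ.∣p+q∣≤∣p∣+∣q∣ (x m ℚ.- x n) (y m ℚ.- y n) ⟩
    ∣ x m ℚ.- x n ∣ ℚ.+ ∣ y m ℚ.- y n ∣
      <⟨ ℚₚ.+-mono-< (hM m n (ℕₚ.m⊔n≤o⇒m≤o M N ≤m) (ℕₚ.m⊔n≤o⇒m≤o M N ≤n))
                     (hN m n (ℕₚ.m⊔n≤o⇒n≤o M N ≤m) (ℕₚ.m⊔n≤o⇒n≤o M N ≤n)) ⟩
    ε ℚ.* ½ ℚ.+ ε ℚ.* ½
      ≡⟨ half+half ε ⟩
    ε ∎
    where open ℚₚ.≤-Reasoning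
          open +-*-Solver

  neg-cauchy : ∀ {x} → IsCauchy x → IsCauchy (λ n → ℚ.- x n)
  neg-cauchy {x} cx ε ε>0 with cx ε ε>0
  ... | N , hN = N , λ m n ≤m ≤n → subst (ℚ._< ε)
    (trans (sym (ℚₚ.∣-p∣≡∣p∣ (x m ℚ.- x n))) (cong ∣_∣ (ℚₚ.neg-distrib-+ (x m) (ℚ.- x n))))
    (hN m n ≤m ≤n)

  bounded : ∀ {x} → IsCauchy x →
            ∃ λ B → 0ℚ ℚ.< B × Eventually (λ n → ∣ x n ∣ ℚ.≤ B)
  bounded {x} cx with cx 1ℚ (ℚₚ.positive⁻¹ 1ℚ)
  ... | N , hN = ∣ x N ∣ ℚ.+ 1ℚ
    , ℚₚ.+-mono-≤-< (ℚₚ.0≤∣p∣ (x N)) (ℚₚ.positive⁻¹ 1ℚ)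
    , N , λ n N≤n → begin
      ∣ x n ∣
        ≡⟨ cong ∣_∣ (solve 2 (λ a b → a := b :+ (a :- b)) refl (x n) (x N)) ⟩
      ∣ x N ℚ.+ (x n ℚ.- x N) ∣
        ≤⟨ ℚₚ.∣p+q∣≤∣p∣+∣q∣ (x N) (x n ℚ.- x N) ⟩
      ∣ x N ∣ ℚ.+ ∣ x n ℚ.- x N ∣
        ≤⟨ ℚₚ.+-monoʳ-≤ ∣ x N ∣ (ℚₚ.<⇒≤ (hN n N N≤n ℕₚ.≤-refl)) ⟩
      ∣ x N ∣ ℚ.+ 1ℚ ∎
    where open ℚₚ.≤-Reasoning
          open +-*-Solver

  *-diff : ∀ a b c d → a ℚ.* b ℚ.- c ℚ.* d ≡ a ℚ.* (b ℚ.- d) ℚ.+ d ℚ.* (a ℚ.- c)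
  *-diff = solve 4 (λ a b c d → a :* b :- c :* d := a :* (b :- d) :+ d :* (a :- c)) refl
    where open +-*-Solver

  ∣p*q∣<P*δ : ∀ {P δ} p q → 0ℚ ℚ.< P → ∣ p ∣ ℚ.≤ P → ∣ q ∣ ℚ.< δ → ∣ p ℚ.* q ∣ ℚ.< P ℚ.* δ
  ∣p*q∣<P*δ {P} {δ} p q P>0 p≤P q<δ = begin-strict
    ∣ p ℚ.* q ∣       ≡⟨ ℚₚ.∣p*q∣≡∣p∣*∣q∣ p q ⟩
    ∣ p ∣ ℚ.* ∣ q ∣   ≤⟨ ℚₚ.*-monoʳ-≤-nonNeg ∣ q ∣ {{ℚₚ.∣-∣-nonNeg q}} p≤P ⟩
    P ℚ.* ∣ q ∣       <⟨ ℚₚ.*-monoʳ-<-pos P {{positive P>0}} q<δ ⟩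
    P ℚ.* δ           ∎
    where open ℚₚ.≤-Reasoning

  *-close : ∀ {A B δ} a b c d → 0ℚ ℚ.< A → 0ℚ ℚ.< B → ∣ a ∣ ℚ.≤ A → ∣ d ∣ ℚ.≤ B →
            ∣ a ℚ.- c ∣ ℚ.< δ → ∣ b ℚ.- d ∣ ℚ.< δ →
            ∣ a ℚ.* b ℚ.- c ℚ.* d ∣ ℚ.< (A ℚ.+ B) ℚ.* δ
  *-close {A} {B} {δ} a b c d A>0 B>0 a≤A d≤B ac bd = begin-strict
    ∣ a ℚ.* b ℚ.- c ℚ.* d ∣
      ≡⟨ cong ∣_∣ (*-diff a b c d) ⟩
    ∣ a ℚ.* (b ℚ.- d) ℚ.+ d ℚ.* (a ℚ.- c) ∣
      ≤⟨ ℚₚ.∣p+q∣≤∣p∣+∣q∣ (a ℚ.* (b ℚ.- d)) (d ℚ.* (a ℚ.- c)) ⟩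
    ∣ a ℚ.* (b ℚ.- d) ∣ ℚ.+ ∣ d ℚ.* (a ℚ.- c) ∣
      <⟨ ℚₚ.+-mono-< (∣p*q∣<P*δ a (b ℚ.- d) A>0 a≤A bd) (∣p*q∣<P*δ d (a ℚ.- c) B>0 d≤B ac) ⟩
    A ℚ.* δ ℚ.+ B ℚ.* δ
      ≡⟨ sym (ℚₚ.*-distribʳ-+ δ A B) ⟩
    (A ℚ.+ B) ℚ.* δ ∎
    where open ℚₚ.≤-Reasoning

  divide : ∀ S ε → 0ℚ ℚ.< S → 0ℚ ℚ.< ε → ∃ λ δ → 0ℚ ℚ.< δ × S ℚ.* δ ≡ ε
  divide S ε S>0 ε>0 = 1/ S ℚ.* ε
    , subst (ℚ._< 1/ S ℚ.* ε) (ℚₚ.*-zeroʳ (1/ S)) (ℚₚ.*-monoʳ-<-pos (1/ S) ε>0)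
    , trans (sym (ℚₚ.*-assoc S (1/ S) ε))
        (trans (cong (ℚ._* ε) (ℚₚ.*-inverseʳ S)) (ℚₚ.*-identityˡ ε))
    where
    instance
      posS : Positive S
      posS = positive S>0
      nonZeroS : ℚ.NonZero S
      nonZeroS = ℚₚ.pos⇒nonZero S
      pos1/S : Positive (1/ S)
      pos1/S = ℚₚ.1/pos⇒pos S

  *-cauchy : ∀ {x y} → IsCauchy x → IsCauchy y → IsCauchy (λ n → x n ℚ.* y n)
  *-cauchy {x} {y} cx cy ε ε>0 =
    let A , A>0 , K , hK = bounded {x} cx
        B , B>0 , L , hL = bounded {y} cy
        δ , δ>0 , Sδ≡ε = divide (A ℚ.+ B) ε (ℚₚ.+-mono-< A>0 B>0) ε>0
        M , hM = cx δ δ>0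
        N , hN = cy δ δ>0
    in (K ℕ.⊔ L) ℕ.⊔ (M ℕ.⊔ N) , λ m n ≤m ≤n →
    let KL≤m = ℕₚ.m⊔n≤o⇒m≤o (K ℕ.⊔ L) (M ℕ.⊔ N) ≤m
        MN≤m = ℕₚ.m⊔n≤o⇒n≤o (K ℕ.⊔ L) (M ℕ.⊔ N) ≤m
        KL≤n = ℕₚ.m⊔n≤o⇒m≤o (K ℕ.⊔ L) (M ℕ.⊔ N) ≤n
        MN≤n = ℕₚ.m⊔n≤o⇒n≤o (K ℕ.⊔ L) (M ℕ.⊔ N) ≤n
    in subst (∣ x m ℚ.* y m ℚ.- x n ℚ.* y n ∣ ℚ.<_) Sδ≡ε
      (*-close (x m) (y m) (x n) (y n) A>0 B>0
        (hK m (ℕₚ.m⊔n≤o⇒m≤o K L KL≤m)) (hL n (ℕₚ.m⊔n≤o⇒n≤o K L KL≤n))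
        (hM m n (ℕₚ.m⊔n≤o⇒m≤o M N MN≤m) (ℕₚ.m⊔n≤o⇒m≤o M N MN≤n))
        (hN m n (ℕₚ.m⊔n≤o⇒n≤o M N MN≤m) (ℕₚ.m⊔n≤o⇒n≤o M N MN≤n)))

-- The real numbers are Cauchy sequences of rationals; `_≈ʳ_` (the difference
-- is a null sequence) plays the role of equality.
record ℝ : Set where
  constructor mkℝ
  field
    seq    : ℕ → ℚ
    cauchy : IsCauchy seq
open ℝ public

infix  4 _≈ʳ_ _<ʳ_ _≤ʳ_
infixl 6 _+ʳ_ _-ʳ_
infixl 7 _*ʳ_
infix  8 -ʳ_

_≈ʳ_ _<ʳ_ _≤ʳ_ : ℝ → ℝ → Set
x ≈ʳ y = ∀ ε → 0ℚ ℚ.< ε → Eventually λ n → ∣ seq x n ℚ.- seq y n ∣ ℚ.< ε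
x <ʳ y = ∃ λ ε → 0ℚ ℚ.< ε × Eventually λ n → ε ℚ.< seq y n ℚ.- seq x n
x ≤ʳ y = ¬ (y <ʳ x)

fromℚ : ℚ → ℝ
fromℚ q = mkℝ (λ _ → q) (const-cauchy q)

0ʳ 1ʳ : ℝ
0ʳ = fromℚ 0ℚ
1ʳ = fromℚ 1ℚ

_+ʳ_ _*ʳ_ : ℝ → ℝ → ℝ
x +ʳ y = mkℝ (λ n → seq x n ℚ.+ seq y n) (+-cauchy {seq x} {seq y} (cauchy x) (cauchy y))
x *ʳ y = mkℝ (λ n → seq x n ℚ.* seq y n) (*-cauchy {seq x} {seq y} (cauchy x) (cauchy y))

-ʳ_ : ℝ → ℝ
-ʳ x = mkℝ (λ n → ℚ.- seq x n) (neg-cauchy {seq x} (cauchy x))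

_-ʳ_ : ℝ → ℝ → ℝ
x -ʳ y = x +ʳ (-ʳ y)

record ℂ : Set where
  constructor _+i_
  field
    re : ℝ
    im : ℝ
open ℂ public

infix  4 _≈_
infix  5 _+i_
infixl 6 _+_
infixl 7 _*_
infix  8 -_

_≈_ : ℂ → ℂ → Set
z ≈ z′ = re z ≈ʳ re z′ × im z ≈ʳ im z′

0ᶜ 1ᶜ : ℂ
0ᶜ = 0ʳ +i 0ʳ
1ᶜ = 1ʳ +i 0ʳ

_+_ _*_ : ℂ → ℂ → ℂ
(a +i b) + (c +i d) = (a +ʳ c) +i (b +ʳ d)
(a +i b) * (c +i d) = (a *ʳ c -ʳ b *ʳ d) +i (a *ʳ d +ʳ b *ʳ c)

-_ conj : ℂ → ℂ
- (a +i b) = (-ʳ a) +i (-ʳ b)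
conj (a +i b) = a +i (-ʳ b)

ℂ-rawRing : RawRing 0ℓ 0ℓ
ℂ-rawRing = record
  { Carrier = ℂ ; _≈_ = _≈_ ; _+_ = _+_ ; _*_ = _*_ ; -_ = -_ ; 0# = 0ᶜ ; 1# = 1ᶜ }

open RawSemiringDefs (RawRing.rawSemiring ℂ-rawRing) public using (sum; _^_)

-- |z| = r
HasModulus : ℂ → ℝ → Set
HasModulus z r = 0ʳ ≤ʳ r × r *ʳ r ≈ʳ re z *ʳ re z +ʳ im z *ʳ im z

Unimodular : ℂ → Set
Unimodular z = HasModulus z 1ʳ

_⟶ʳ_ : (ℕ → ℝ) → ℝ → Set
s ⟶ʳ l = ∀ ε → 0ℚ ℚ.< ε →
  Eventually λ n → l -ʳ fromℚ ε <ʳ s n × s n <ʳ l +ʳ fromℚ ε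

_⟶_ : (ℕ → ℂ) → ℂ → Set
s ⟶ l = (λ n → re (s n)) ⟶ʳ re l × (λ n → im (s n)) ⟶ʳ im l

expTerm : ℂ → ℕ → ℂ
expTerm z k = (fromℚ ((+ 1) / (k !)) +i 0ʳ) * z ^ k
  where instance _ = k ℕₚ.!≢0

-- w = e^z, by the power series
IsExp : ℂ → ℂ → Set
IsExp z w = (λ n → sum {n} (λ k → expTerm z (toℕ k))) ⟶ w

-- c = cos t = Re e^{it}
IsCos : ℝ → ℝ → Set
IsCos t c = ∃ λ s → IsExp (0ʳ +i t) (c +i s)

-- π/2 is the least positive zero of the cosine.
record IsPi (π : ℝ) : Set where
  field
    π-positive : 0ʳ <ʳ π
    cos-π/2    : IsCos (fromℚ ½ *ʳ π) 0ʳ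
    least      : ∀ t → 0ʳ <ʳ t → t <ʳ fromℚ ½ *ʳ π → ¬ IsCos t 0ʳ

2πi/_ : (n : ℕ) .{{_ : ℕ.NonZero n}} → ℝ → ℂ
(2πi/ n) π = 0ʳ +i (fromℚ ((+ 2) / n) *ʳ π)

Matrix : ℕ → Set
Matrix n = Fin n → Fin n → ℂ

record IsComplexHadamard {n : ℕ} (H : Matrix n) : Set where
  field
    unimodular : ∀ i j → Unimodular (H i j)
    orthogonal : ∀ i j → i ≢ j → sum (λ k → H i k * conj (H j k)) ≈ 0ᶜ

-- H i j depends only on j − i modulo n.
IsCirculant : {n : ℕ} → Matrix n → Set
IsCirculant {n} H = ∀ i j k l →
  (+ n) ∣ℤ ((+ toℕ j ℤ.- + toℕ i) ℤ.- (+ toℕ l ℤ.- + toℕ k)) →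
  H i j ≈ H k l

-- Membership in C^circ_n(l).
record IsCirculantHadamard (n l : ℕ) (H : Matrix n) : Set where
  field
    hadamard  : IsComplexHadamard H
    circulant : IsCirculant H
    root      : ∀ i j → H i j ^ l ≈ 1ᶜ

-- K arises from H by permuting and rescaling rows and columns.
record Equivalent {n : ℕ} (H K : Matrix n) : Set where
  field
    rowPerm colPerm   : Permutation′ n
    rowScale colScale : Fin n → ℂ
    rowUnimodular     : ∀ i → Unimodular (rowScale i)
    colUnimodular     : ∀ j → Unimodular (colScale j)
    equal             : ∀ i j →
      K i j ≈ (rowScale i * H (rowPerm ⟨$⟩ʳ i) (colPerm ⟨$⟩ʳ j)) * colScale j

fourier : (n : ℕ) → ℂ → Matrix n
fourier n w i j = w ^ (toℕ i ℕ.* toℕ j)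

{-# OPTIONS --safe #-}

-- Let w be the principal p-th root of unity. Every p-th root of unity is a power of w,
-- so H i j = w^f(j − i) for some f : 𝔽ₚ → 𝔽ₚ.
--
-- A vanishing sum Σₓ w^u(x) of p powers of w has Σₓ u(x)^k ≡ 0 (mod p) for k ≤ p − 2: with
-- π = w − 1, the integer polynomial Σₓ (1 + T)^u(x) vanishes at π, and π^(p−1) = −p (1 + π y) with
-- y in ℤ[π], so its coefficients Σₓ C(u(x), k) below T^(p−1) are divisible by p.
--
-- Orthogonality of the rows gives this for u(x) = f(x + d) − f(x), d ≠ 0, and also for
-- g = f − cx in place of f. Summing (g(y) − g(x))^2j over all x, y and expanding, induction on j
-- shows that the moments M_j(c) = Σₓ g(x)^j vanish for 2j < p − 1, and that M_j(c)² does
-- not depend on c for 2j = p − 1. So the polynomial M_j is constant for 2j ≤ p − 1, that is,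
-- Σₓ f(x)^i x^k = 0 for k ≥ 1, 2(i + k) ≤ p − 1. If f had degree n ≥ 3, write p − 1 = i n + k
-- with k < n; then 2(i + k) ≤ p − 1 and 2i < p − 1, so Σₓ f(x)^i x^k = 0, although f(x)^i x^k
-- has degree p − 1.
--
-- Hence f(x) = a x² + b x + c. Here 2a ≠ 0, since otherwise f(x + 1) − f(x) would be constant.
-- Expanding f(j − i) leaves the cross term −2a i j, which is the Fourier matrix up to
-- a permutation and a rescaling of the rows and a rescaling of the columns.

module Submission where

open import Data.Fin.Base as Fin using (Fin; zero; suc; toℕ; fromℕ<)
import Data.Fin.Properties as Fin
open import Data.Integer.Base as ℤ using (ℤ)
import Data.Integer.Properties as ℤ
open import Data.Nat.Base as ℕ using (ℕ; zero; suc; z≤n; s≤s; _!)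
import Data.Nat.Properties as ℕ
open import Data.Nat.Primality using (Prime; ¬prime[1])
open import Data.Product.Base using (∃; _×_; _,_; proj₁; proj₂)
open import Data.Rational.Base as ℚ using (ℚ; 0ℚ; 1ℚ; ½)
import Data.Rational.Properties as ℚ
open import Data.Sum.Base using (_⊎_; inj₁; inj₂; [_,_]′)
open import Function.Base using (_∘_)
open import Relation.Binary.PropositionalEquality as ≡ using (_≡_; _≢_; subst; subst₂)
open import Relation.Nullary.Decidable using (yes; no)
open import Relation.Nullary.Negation using (¬_; contradiction)

-- All that is used of ℂ as a ring is that nonzero integers cancel, 1 ≠ 0, and x² = n x forces x = 0
-- or x = n. The last property separates the roots of unity, through the idempotent Φ(x)/p with Φ(x)
-- = 1 + x + ... + x^(p-1). Divisibility by p is decidable, hence may be proved by refutation: a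
-- matrix that is triangular modulo p with nonzero diagonal has trivial kernel, yet it would
-- annihilate the powers of w - 1.
--
-- Replacing f by f - cx is harmless because each difference f(x + d) - f(x) only changes by a
-- constant, and polynomials of degree below p - 1 are stable under translation. At degree p - 1
-- only the leading term is stable, hence the weaker conclusion at 2j = p - 1.
--
-- The number w is given as exp(2πi/p), with π/2 the least positive zero of the cosine, so w^p = 1
-- and w ≠ 1 must be derived too; both rest on the addition formula for the exponential series.

-- Commutative rings with a homomorphism from ℤ.

module IntegerAlgebras where
  open import Algebra.Bundles using (CommutativeRing)
  import Algebra.Solver.Ring
  open import Algebra.Solver.Ring.AlmostCommutativeRing using (fromCommutativeRing; _-Raw-AlmostCommutative⟶_)
  open import Data.Maybe.Base using (Maybe; just; nothing)
  open import Level using (0ℓ)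

  -- Both ℂ, where `ι` gives constant sequences, and ℤ modulo p, where `ι` is the identity, are
  -- instances, so arguments about sums, binomials and polynomials are written once. As a field of
  -- the record, `ι` can be chosen conveniently in each instance.
  record ℤ-Algebra : Set₁ where
    field
      commutativeRing : CommutativeRing 0ℓ 0ℓ
    open CommutativeRing commutativeRing public hiding (zero)
    field
      ι       : ℤ → Carrier
      +-homo  : ∀ m n → ι (m ℤ.+ n) ≈ ι m + ι n
      *-homo  : ∀ m n → ι (m ℤ.* n) ≈ ι m * ι n
      -‿homo  : ∀ m → ι (ℤ.- m) ≈ - ι m
      0-homo  : ι (ℤ.+ 0) ≈ 0#
      1-homo  : ι (ℤ.+ 1) ≈ 1#

    morphism : CommutativeRing.rawRing ℤ.+-*-commutativeRing -Raw-AlmostCommutative⟶ fromCommutativeRing commutativeRing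
    morphism = record
      { ⟦_⟧ = ι ; +-homo = +-homo ; *-homo = *-homo ; -‿homo = -‿homo ; 0-homo = 0-homo ; 1-homo = 1-homo }

    -- The ring solver compares only coefficients, and these are integers; equality in the carrier
    -- may stay undecidable, as it does for ℂ.
    ι-≟ : ∀ m n → Maybe (ι m ≈ ι n)
    ι-≟ m n with m ℤ.≟ n
    ... | yes m≡n = just (reflexive (≡.cong ι m≡n))
    ... | no  _   = nothing

    module Solver = Algebra.Solver.Ring
      (CommutativeRing.rawRing ℤ.+-*-commutativeRing) (fromCommutativeRing commutativeRing) morphism ι-≟
open IntegerAlgebras

-- Finite sums and integer multiples.

module FiniteSums (A : ℤ-Algebra) where
  open ℤ-Algebra A
  open import Algebra.Properties.Semiring.Sum semiring using (sum; sum-cong-≋; sum-replicate-zero)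
  open import Relation.Binary.Reasoning.Setoid setoid

  ι-suc : ∀ k → ι (ℤ.+ suc k) ≈ 1# + ι (ℤ.+ k)
  ι-suc k = trans (+-homo (ℤ.+ 1) (ℤ.+ k)) (+-congʳ 1-homo)

  sum-constant : ∀ n x → sum {n} (λ _ → x) ≈ ι (ℤ.+ n) * x
  sum-constant zero    x = sym (trans (*-congʳ 0-homo) (zeroˡ x))
  sum-constant (suc n) x = begin
    x + sum {n} (λ _ → x)      ≈⟨ +-cong (sym (*-identityˡ x)) (sum-constant n x) ⟩
    1# * x + ι (ℤ.+ n) * x     ≈⟨ distribʳ x _ _ ⟨
    (1# + ι (ℤ.+ n)) * x       ≈⟨ *-congʳ (ι-suc n) ⟨
    ι (ℤ.+ suc n) * x          ∎

  sum-1# : ∀ n → sum {n} (λ _ → 1#) ≈ ι (ℤ.+ n)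
  sum-1# n = trans (sum-constant n 1#) (*-identityʳ _)

  sum-0# : ∀ n {t : Fin n → Carrier} → (∀ i → t i ≈ 0#) → sum t ≈ 0#
  sum-0# n h = trans (sum-cong-≋ {n} {y = λ _ → 0#} h) (sum-replicate-zero n)

  sum-snoc : ∀ n (ψ : ℕ → Carrier) → sum {suc n} (λ i → ψ (toℕ i)) ≈ sum {n} (λ i → ψ (toℕ i)) + ψ n
  sum-snoc zero    ψ = trans (+-identityʳ _) (sym (+-identityˡ _))
  sum-snoc (suc n) ψ = trans (+-congˡ (sum-snoc n (λ k → ψ (suc k)))) (sym (+-assoc _ _ _))

-- Integer polynomials as coefficient lists, constant term first.

module IntegerPolynomials where
  open import Data.List.Base using (List; []; _∷_; length)

  infixl 6 _⊕_
  infixl 7 _⊗_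

  _⊕_ _⊗_ : List ℤ → List ℤ → List ℤ
  []       ⊕ bs       = bs
  (a ∷ as) ⊕ []       = a ∷ as
  (a ∷ as) ⊕ (b ∷ bs) = a ℤ.+ b ∷ as ⊕ bs

  scale : ℤ → List ℤ → List ℤ
  scale c []       = []
  scale c (a ∷ as) = c ℤ.* a ∷ scale c as

  []       ⊗ bs = []
  (a ∷ as) ⊗ bs = scale a bs ⊕ (ℤ.+ 0 ∷ as ⊗ bs)

  coef : List ℤ → ℕ → ℤ
  coef []       k       = ℤ.+ 0
  coef (a ∷ as) zero    = a
  coef (a ∷ as) (suc k) = coef as k

  coef-⊕ : ∀ as bs k → coef (as ⊕ bs) k ≡ coef as k ℤ.+ coef bs k
  coef-⊕ []       bs       k       = ≡.sym (ℤ.+-identityˡ _)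
  coef-⊕ (a ∷ as) []       k       = ≡.sym (ℤ.+-identityʳ _)
  coef-⊕ (a ∷ as) (b ∷ bs) zero    = ≡.refl
  coef-⊕ (a ∷ as) (b ∷ bs) (suc k) = coef-⊕ as bs k

  shift : ℕ → List ℤ → List ℤ
  shift zero    as = as
  shift (suc n) as = ℤ.+ 0 ∷ shift n as

  length-shift : ∀ n as → length (shift n as) ≡ n ℕ.+ length as
  length-shift zero    as = ≡.refl
  length-shift (suc n) as = ≡.cong suc (length-shift n as)

  coef-shift : ∀ n as k → coef (shift n as) (n ℕ.+ k) ≡ coef as k
  coef-shift zero    as k = ≡.refl
  coef-shift (suc n) as k = coef-shift n as k

  coef-shift-< : ∀ n as {k} → k ℕ.< n → coef (shift n as) k ≡ ℤ.+ 0
  coef-shift-< (suc n) as {zero}  _         = ≡.refl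
  coef-shift-< (suc n) as {suc k} (s≤s k<n) = coef-shift-< n as k<n

  module Evaluation (A : ℤ-Algebra) (π : ℤ-Algebra.Carrier A) where
    open ℤ-Algebra A
    open import Algebra.Properties.Semiring.Sum semiring using (sum; sum-cong-≋; sum-replicate-zero; *-distribˡ-sum)
    open import Algebra.Properties.Semiring.Exp semiring using (_^_)
    open import Relation.Binary.Reasoning.Setoid setoid
    open Solver using (solve; con; _:+_; _:*_; _:=_)

    ev : List ℤ → Carrier
    ev []       = 0#
    ev (a ∷ as) = ι a + π * ev as

    ev-⊕ : ∀ as bs → ev (as ⊕ bs) ≈ ev as + ev bs
    ev-⊕ []       bs       = sym (+-identityˡ _)
    ev-⊕ (a ∷ as) []       = sym (+-identityʳ _)
    ev-⊕ (a ∷ as) (b ∷ bs) = begin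
      ι (a ℤ.+ b) + π * ev (as ⊕ bs)           ≈⟨ +-cong (+-homo a b) (*-congˡ (ev-⊕ as bs)) ⟩
      (ι a + ι b) + π * (ev as + ev bs)
        ≈⟨ solve 5 (λ x y t u v → (x :+ y) :+ t :* (u :+ v) := (x :+ t :* u) :+ (y :+ t :* v)) refl _ _ _ _ _ ⟩
      (ι a + π * ev as) + (ι b + π * ev bs)    ∎

    ev-scale : ∀ c as → ev (scale c as) ≈ ι c * ev as
    ev-scale c []       = sym (zeroʳ _)
    ev-scale c (a ∷ as) = begin
      ι (c ℤ.* a) + π * ev (scale c as)  ≈⟨ +-cong (*-homo c a) (*-congˡ (ev-scale c as)) ⟩
      ι c * ι a + π * (ι c * ev as)
        ≈⟨ solve 4 (λ x y t u → x :* y :+ t :* (x :* u) := x :* (y :+ t :* u)) refl _ _ _ _ ⟩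
      ι c * (ι a + π * ev as)            ∎

    ev-⊗ : ∀ as bs → ev (as ⊗ bs) ≈ ev as * ev bs
    ev-⊗ []       bs = sym (zeroˡ _)
    ev-⊗ (a ∷ as) bs = begin
      ev (scale a bs ⊕ (ℤ.+ 0 ∷ as ⊗ bs))           ≈⟨ ev-⊕ (scale a bs) _ ⟩
      ev (scale a bs) + (ι (ℤ.+ 0) + π * ev (as ⊗ bs))
        ≈⟨ +-cong (ev-scale a bs) (+-congˡ (*-congˡ (ev-⊗ as bs))) ⟩
      ι a * ev bs + (ι (ℤ.+ 0) + π * (ev as * ev bs))
        ≈⟨ solve 4 (λ x y t u → x :* y :+ (con (ℤ.+ 0) :+ t :* (u :* y)) := (x :+ t :* u) :* y) refl _ _ _ _ ⟩
      (ι a + π * ev as) * ev bs                     ∎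

    ev-shift : ∀ n {as} → ev as ≈ 0# → ev (shift n as) ≈ 0#
    ev-shift zero         h = h
    ev-shift (suc n) {as} h = begin
      ι (ℤ.+ 0) + π * ev (shift n as)  ≈⟨ +-cong 0-homo (*-congˡ (ev-shift n {as} h)) ⟩
      0# + π * 0#                     ≈⟨ +-identityˡ _ ⟩
      π * 0#                          ≈⟨ zeroʳ π ⟩
      0#                              ∎

    -- Padding with zero coefficients up to a common `K` turns relations of different degrees into
    -- rows of one square matrix acting on 1, π, ..., π^(K-1).
    ev-sum : ∀ K as → length as ℕ.≤ K → ev as ≈ sum {K} (λ k → ι (coef as (toℕ k)) * π ^ toℕ k)
    ev-sum K       []       _         = sym (trans
      (sum-cong-≋ {K} {y = λ _ → 0#} (λ k → trans (*-congʳ 0-homo) (zeroˡ _)))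
      (sum-replicate-zero K))
    ev-sum (suc K) (a ∷ as) (s≤s l)   = begin
      ι a + π * ev as                            ≈⟨ +-cong (sym (*-identityʳ _)) (*-congˡ (ev-sum K as l)) ⟩
      ι a * 1# + π * sum {K} (λ k → ι (coef as (toℕ k)) * π ^ toℕ k)
        ≈⟨ +-congˡ (*-distribˡ-sum {K} π _) ⟩
      ι a * 1# + sum {K} (λ k → π * (ι (coef as (toℕ k)) * π ^ toℕ k))
        ≈⟨ +-congˡ (sum-cong-≋ {K} (λ k → solve 3 (λ t x y → t :* (x :* y) := x :* (t :* y)) refl _ _ _)) ⟩
      ι a * 1# + sum {K} (λ k → ι (coef as (toℕ k)) * (π * π ^ toℕ k)) ∎

-- Kernels of integer matrices that are triangular modulo p.

module TriangularElimination where
  open import Data.Integer.Divisibility.Signed using (_∣_; divides; ∣m⇒∣m*n; ∣n⇒∣m*n; ∣m∣n⇒∣m-n; ∣m∣n⇒∣m+n)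
  open import Data.Integer.Tactic.RingSolver using (solve-∀)

  module _ (A : ℤ-Algebra)
           (torsion-free : ∀ n x → n ≢ ℤ.+ 0 → ℤ-Algebra._≈_ A (ℤ-Algebra._*_ A (ℤ-Algebra.ι A n) x) (ℤ-Algebra.0# A) →
                           ℤ-Algebra._≈_ A x (ℤ-Algebra.0# A))
           (p : ℤ) (euclid : ∀ a b → p ∣ a ℤ.* b → p ∣ a ⊎ p ∣ b) where
    open ℤ-Algebra A
    open import Algebra.Properties.Semiring.Sum semiring using (sum; sum-cong-≋; sum-replicate-zero; *-distribˡ-sum; ∑-distrib-+)
    open import Relation.Binary.Reasoning.Setoid setoid
    open Solver using (solve; _:+_; _:*_; :-_; _:=_)

    unit≢0 : ∀ {n} → ¬ (p ∣ n) → n ≢ ℤ.+ 0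
    unit≢0 p∤n ≡.refl = p∤n (divides (ℤ.+ 0) ≡.refl)

    -- Modulo p the determinant is a product of nonzero residues, so it is a nonzero integer, and
    -- nonzero integers cancel in `A`. The elimination is fraction-free: only integer combinations
    -- of rows are formed, and `torsion-free` is applied once per unknown, during back substitution.
    triangular-kernel : ∀ r (B : Fin r → Fin r → ℤ) (v : Fin r → Carrier) →
      (∀ i j → j Fin.< i → p ∣ B i j) → (∀ i → ¬ (p ∣ B i i)) →
      (∀ i → sum (λ j → ι (B i j) * v j) ≈ 0#) → ∀ i → v i ≈ 0#
    triangular-kernel (suc r) B v lower diagonal kernel = λ { zero → v₀≈0 ; (suc i) → tail≈0 i }
      where
      b = B zero zero

      B′ : Fin r → Fin r → ℤ
      -- The entry of b times row i + 1 minus B(i+1, 0) times row 0. The subtracted product is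
      -- divisible by p, so modulo p the smaller matrix is again triangular, with diagonal entries b
      -- B(i+1, i+1) that the prime does not divide.
      B′ i j = b ℤ.* B (suc i) (suc j) ℤ.- B (suc i) zero ℤ.* B zero (suc j)

      p∣sub : ∀ i j → p ∣ B (suc i) zero ℤ.* B zero (suc j)
      p∣sub i j = ∣m⇒∣m*n (B zero (suc j)) (lower (suc i) zero (s≤s z≤n))

      diagonal′ : ∀ i → ¬ (p ∣ B′ i i)
      diagonal′ i p∣ with euclid b (B (suc i) (suc i))
        (≡.subst (p ∣_) (cancel (b ℤ.* B (suc i) (suc i)) _) (∣m∣n⇒∣m+n p∣ (p∣sub i i)))
        where
        cancel : ∀ x y → (x ℤ.- y) ℤ.+ y ≡ x
        cancel = solve-∀
      ... | inj₁ p∣b = diagonal zero p∣b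
      ... | inj₂ p∣d = diagonal (suc i) p∣d

      T : Fin (suc r) → Carrier
      T i = sum {r} (λ j → ι (B i (suc j)) * v (suc j))

      kernel′ : ∀ i → sum (λ j → ι (B′ i j) * v (suc j)) ≈ 0#
      kernel′ i = begin
        sum (λ j → ι (B′ i j) * v (suc j))
          ≈⟨ sum-cong-≋ (λ j → trans
               (*-congʳ (trans (+-homo (b ℤ.* B (suc i) (suc j)) _) (+-cong (*-homo _ _) (trans (-‿homo _) (-‿cong (*-homo _ _))))))
               (solve 5 (λ x y s t u → (x :* y :+ :- (s :* t)) :* u := x :* (y :* u) :+ (:- s) :* (t :* u)) refl _ _ _ _ _)) ⟩
        sum (λ j → ι b * (ι (B (suc i) (suc j)) * v (suc j)) + (- ι (B (suc i) zero)) * (ι (B zero (suc j)) * v (suc j)))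
          ≈⟨ ∑-distrib-+ {r} _ _ ⟩
        sum (λ j → ι b * (ι (B (suc i) (suc j)) * v (suc j))) + sum (λ j → (- ι (B (suc i) zero)) * (ι (B zero (suc j)) * v (suc j)))
          ≈⟨ +-cong (*-distribˡ-sum {r} _ _) (*-distribˡ-sum {r} _ _) ⟨
        ι b * T (suc i) + (- ι (B (suc i) zero)) * T zero
          ≈⟨ solve 5 (λ x t s u v → x :* t :+ (:- s) :* u := x :* (s :* v :+ t) :+ (:- s) :* (x :* v :+ u)) refl _ _ _ _ _ ⟩
        ι b * (ι (B (suc i) zero) * v zero + T (suc i)) + (- ι (B (suc i) zero)) * (ι b * v zero + T zero)
          ≈⟨ +-cong (*-congˡ (kernel (suc i))) (*-congˡ (kernel zero)) ⟩
        ι b * 0# + (- ι (B (suc i) zero)) * 0#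
          ≈⟨ +-cong (zeroʳ _) (zeroʳ _) ⟩
        0# + 0#
          ≈⟨ +-identityˡ _ ⟩
        0# ∎

      tail≈0 : ∀ i → v (suc i) ≈ 0#
      tail≈0 = triangular-kernel r B′ (λ i → v (suc i))
        (λ i j j<i → ∣m∣n⇒∣m-n (∣n⇒∣m*n b (lower (suc i) (suc j) (s≤s j<i))) (p∣sub i j)) diagonal′ kernel′

      v₀≈0 : v zero ≈ 0#
      v₀≈0 = torsion-free b (v zero) (unit≢0 (diagonal zero)) (begin
        ι b * v zero                     ≈⟨ +-identityʳ _ ⟨
        ι b * v zero + 0#                ≈⟨ +-congˡ (trans (sum-cong-≋ {r} (λ j → trans (*-congˡ (tail≈0 j)) (zeroʳ _))) (sum-replicate-zero r)) ⟨
        ι b * v zero + T zero            ≈⟨ kernel zero ⟩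
        0#                               ∎)

-- Divisibility of binomial coefficients by a prime.

module BinomialDivisibility where
  open import Data.Nat.Base using (_+_; _*_; _<_)
  open import Data.Nat.Combinatorics using (_C_; nCk+nC[k+1]≡[n+1]C[k+1])
  open import Data.Nat.Divisibility using (_∣_; divides; ∣⇒≤)
  open import Data.Nat.Primality using (euclidsLemma)
  open import Data.Nat.Tactic.RingSolver using (solve-∀)
  open import Relation.Binary.PropositionalEquality
  open ≡-Reasoning

  absorption : ∀ n k → suc k * (suc n C suc k) ≡ suc n * (n C k)
  absorption zero    zero    = refl
  absorption zero    (suc k) = ℕ.*-zeroʳ (suc (suc k))
  absorption (suc n) zero    = begin
    1 * (suc (suc n) C 1)                    ≡⟨ cong (1 *_) (nCk+nC[k+1]≡[n+1]C[k+1] (suc n) 0) ⟨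
    1 * (1 + (suc n C 1))                    ≡⟨ ℕ.*-distribˡ-+ 1 1 _ ⟩
    1 + 1 * (suc n C 1)                      ≡⟨ cong (1 +_) (absorption n 0) ⟩
    suc (suc n) * 1                          ∎
  absorption (suc n) (suc k) = begin
    suc (suc k) * (suc (suc n) C suc (suc k))
      ≡⟨ cong (suc (suc k) *_) (nCk+nC[k+1]≡[n+1]C[k+1] (suc n) (suc k)) ⟨
    suc (suc k) * ((suc n C suc k) + (suc n C suc (suc k)))
      ≡⟨ expand k (suc n C suc k) (suc n C suc (suc k)) ⟩
    (suc n C suc k) + (suc k * (suc n C suc k) + suc (suc k) * (suc n C suc (suc k)))
      ≡⟨ cong₂ (λ x y → (suc n C suc k) + (x + y)) (absorption n k) (absorption n (suc k)) ⟩
    (suc n C suc k) + (suc n * (n C k) + suc n * (n C suc k))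
      ≡⟨ cong ((suc n C suc k) +_) (ℕ.*-distribˡ-+ (suc n) (n C k) (n C suc k)) ⟨
    (suc n C suc k) + suc n * ((n C k) + (n C suc k))
      ≡⟨ cong (λ x → (suc n C suc k) + suc n * x) (nCk+nC[k+1]≡[n+1]C[k+1] n k) ⟩
    suc (suc n) * (suc n C suc k)            ∎
    where
    expand : ∀ k x y → suc (suc k) * (x + y) ≡ x + (suc k * x + suc (suc k) * y)
    expand = solve-∀

  -- `absorption` shows that the prime divides (k + 1) C(suc p, k + 1), and k + 1 is too small to be
  -- divisible by it.
  prime∣binomial : ∀ {p} → Prime (suc p) → ∀ k → k < p → suc p ∣ (suc p C suc k)
  prime∣binomial {p} p-prime k k<p
    with euclidsLemma (suc k) (suc p C suc k) p-prime
           (divides (p C k) (trans (absorption p k) (ℕ.*-comm (suc p) (p C k))))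
  ... | inj₁ p∣k = contradiction (∣⇒≤ p∣k) (ℕ.<⇒≱ (s≤s k<p))
  ... | inj₂ p∣C = p∣C

-- Euclid's lemma for integers.

module IntegerEuclid where
  open import Data.Integer.Base using (+_; _*_)
  open import Data.Integer.Divisibility.Signed using (_∣_; ∣⇒∣ᵤ; ∣ᵤ⇒∣)
  import Data.Nat.Divisibility as ℕ
  open import Data.Nat.Primality using (euclidsLemma)
  open import Data.Sum.Base using (map)

  euclid : ∀ {p} → Prime p → ∀ a b → + p ∣ a * b → + p ∣ a ⊎ + p ∣ b
  euclid {p} p-prime a b p∣ab = map ∣ᵤ⇒∣ ∣ᵤ⇒∣
    (euclidsLemma _ _ p-prime (subst (p ℕ.∣_) (ℤ.abs-* a b) (∣⇒∣ᵤ p∣ab)))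

-- Powers of 1 + T and the Eisenstein polynomial.

module BinomialPolynomials where
  open import Data.Integer.Divisibility.Signed using (_∣_; divides; ∣ᵤ⇒∣)
  open import Data.List.Base using (List; []; _∷_; length; drop)
  open import Data.Nat.Combinatorics using (_C_; nCk+nC[k+1]≡[n+1]C[k+1]; nCn≡1)
  open IntegerPolynomials
  open BinomialDivisibility

  binomials : ℕ → List ℤ
  binomials zero    = ℤ.+ 1 ∷ []
  binomials (suc e) = binomials e ⊕ (ℤ.+ 0 ∷ binomials e)

  coef-binomials : ∀ e k → coef (binomials e) k ≡ ℤ.+ (e C k)
  coef-binomials zero    zero    = ≡.refl
  coef-binomials zero    (suc k) = ≡.refl
  coef-binomials (suc e) zero    = ≡.trans (coef-⊕ (binomials e) _ 0) (≡.cong (ℤ._+ ℤ.+ 0) (coef-binomials e 0))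
  coef-binomials (suc e) (suc k) = ≡.trans (coef-⊕ (binomials e) _ (suc k)) (≡.trans
    (≡.cong₂ ℤ._+_ (coef-binomials e (suc k)) (coef-binomials e k))
    (≡.cong ℤ.+_ (≡.trans (ℕ.+-comm (e C suc k) (e C k)) (nCk+nC[k+1]≡[n+1]C[k+1] e k))))

  length-⊕ : ∀ as bs {n} → length as ℕ.≤ n → length bs ℕ.≤ n → length (as ⊕ bs) ℕ.≤ n
  length-⊕ []       bs       _         l         = l
  length-⊕ (a ∷ as) []       l         _         = l
  length-⊕ (a ∷ as) (b ∷ bs) (s≤s l)   (s≤s l′)  = s≤s (length-⊕ as bs l l′)

  length-binomials : ∀ e → length (binomials e) ℕ.≤ suc e
  length-binomials zero    = ℕ.≤-refl
  length-binomials (suc e) = length-⊕ (binomials e) _ (ℕ.m≤n⇒m≤1+n (length-binomials e)) (s≤s (length-binomials e))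

  coef-drop : ∀ as k → coef (drop 1 as) k ≡ coef as (suc k)
  coef-drop []       k = ≡.refl
  coef-drop (a ∷ as) k = ≡.refl

  length-drop : ∀ (as : List ℤ) {n} → length as ℕ.≤ suc n → length (drop 1 as) ℕ.≤ n
  length-drop []       _       = z≤n
  length-drop (a ∷ as) (s≤s l) = l

  -- ((1 + T)^p - 1)/T for p = q + 1. For prime p this is the cyclotomic polynomial at 1 + T: monic
  -- of degree q, with all other coefficients divisible by p.
  eisenstein : ℕ → List ℤ
  eisenstein q = drop 1 (binomials (suc q))

  length-eisenstein : ∀ q → length (eisenstein q) ℕ.≤ suc q
  length-eisenstein q = length-drop (binomials (suc q)) (length-binomials (suc q))

  coef-eisenstein : ∀ q k → coef (eisenstein q) k ≡ ℤ.+ (suc q C suc k)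
  coef-eisenstein q k = ≡.trans (coef-drop (binomials (suc q)) k) (coef-binomials (suc q) (suc k))

  eisenstein-lower : ∀ {q} → Prime (suc q) → ∀ {k} → k ℕ.< q → ℤ.+ suc q ∣ coef (eisenstein q) k
  eisenstein-lower {q} p-prime {k} k<q =
    ≡.subst (ℤ.+ suc q ∣_) (≡.sym (coef-eisenstein q k)) (∣ᵤ⇒∣ (prime∣binomial p-prime k k<q))

  eisenstein-monic : ∀ q → coef (eisenstein q) q ≡ ℤ.+ 1
  eisenstein-monic q = ≡.trans (coef-eisenstein q q) (≡.cong ℤ.+_ (nCn≡1 (suc q)))

  module BinomialEvaluation (A : ℤ-Algebra) (π : ℤ-Algebra.Carrier A) where
    open ℤ-Algebra A
    open Evaluation A π
    open import Algebra.Properties.Semiring.Exp semiring using (_^_)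
    open import Relation.Binary.Reasoning.Setoid setoid
    open Solver using (solve; _:+_; _:*_; _:=_)

    ev-head : ∀ as → ev as ≈ ι (coef as 0) + π * ev (drop 1 as)
    ev-head []       = begin
      0#               ≈⟨ zeroʳ π ⟨
      π * 0#           ≈⟨ +-identityˡ _ ⟨
      0# + π * 0#      ≈⟨ +-congʳ 0-homo ⟨
      ι (ℤ.+ 0) + π * 0# ∎
    ev-head (a ∷ as) = refl

    ev-binomials : ∀ e → ev (binomials e) ≈ (1# + π) ^ e
    ev-binomials zero    = begin
      ι (ℤ.+ 1) + π * 0#  ≈⟨ +-cong 1-homo (zeroʳ π) ⟩
      1# + 0#             ≈⟨ +-identityʳ 1# ⟩
      1#                  ∎
    ev-binomials (suc e) = begin
      ev (binomials e ⊕ (ℤ.+ 0 ∷ binomials e))                 ≈⟨ ev-⊕ (binomials e) _ ⟩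
      ev (binomials e) + (ι (ℤ.+ 0) + π * ev (binomials e))    ≈⟨ +-congˡ (trans (+-congʳ 0-homo) (+-identityˡ _)) ⟩
      ev (binomials e) + π * ev (binomials e)                  ≈⟨ +-congʳ (*-identityˡ _) ⟨
      1# * ev (binomials e) + π * ev (binomials e)             ≈⟨ distribʳ _ 1# π ⟨
      (1# + π) * ev (binomials e)                              ≈⟨ *-congˡ (ev-binomials e) ⟩
      (1# + π) * (1# + π) ^ e                                  ∎

    ev-binomials-suc : ∀ q → (1# + π) ^ suc q ≈ 1# + π * ev (eisenstein q)
    ev-binomials-suc q = begin
      (1# + π) ^ suc q                                     ≈⟨ ev-binomials (suc q) ⟨
      ev (binomials (suc q))                               ≈⟨ ev-head (binomials (suc q)) ⟩
      ι (coef (binomials (suc q)) 0) + π * ev (eisenstein q)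
        ≈⟨ +-congʳ (trans (reflexive (≡.cong ι (coef-binomials (suc q) 0))) 1-homo) ⟩
      1# + π * ev (eisenstein q)                           ∎

    -- Applied to the Eisenstein polynomial, this serves twice: at w - 1 in ℂ it relates p to the
    -- q-th power of w - 1; over 𝔽ₚ, where the multiple of p vanishes, it gives the freshman's
    -- dream. The coefficients of `bs` are returned as well because the constant one has to be
    -- identified as 1.
    coef-quotient : ∀ p r as → length as ℕ.≤ suc r → (∀ {k} → k ℕ.< r → p ∣ coef as k) →
      ∃ λ bs → (∀ {k} → k ℕ.< r → coef as k ≡ coef bs k ℤ.* p) × ev as ≈ ι p * ev bs + ι (coef as r) * π ^ r
    coef-quotient p zero    []       _       _  = [] , (λ ()) , sym (trans (+-cong (zeroʳ _) (trans (*-congʳ 0-homo) (zeroˡ _))) (+-identityˡ _))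
    coef-quotient p zero    (a ∷ []) _       _  = [] , (λ ()) ,
      trans (+-congˡ (zeroʳ π)) (trans (+-identityʳ _) (sym (trans (+-cong (zeroʳ _) (*-identityʳ _)) (+-identityˡ _))))
    coef-quotient p zero    (_ ∷ _ ∷ _) (s≤s ()) _
    coef-quotient p (suc r) []       _       _  = [] , (λ _ → ≡.refl) , sym (trans (+-cong (zeroʳ _) (trans (*-congʳ 0-homo) (zeroˡ _))) (+-identityˡ _))
    coef-quotient p (suc r) (a ∷ as) (s≤s l) p∣ with p∣ {0} (s≤s z≤n) | coef-quotient p r as l (λ k<r → p∣ (s≤s k<r))
    ... | divides s a≡s*p | bs , coefs , evs = s ∷ bs ,
      (λ { {zero} _ → a≡s*p ; {suc k} (s≤s k<r) → coefs k<r }) , (begin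
      ι a + π * ev as
        ≈⟨ +-cong (trans (reflexive (≡.cong ι a≡s*p)) (*-homo s p)) (*-congˡ evs) ⟩
      ι s * ι p + π * (ι p * ev bs + ι (coef as r) * π ^ r)
        ≈⟨ solve 6 (λ s p π b c t → s :* p :+ π :* (p :* b :+ c :* t) := p :* (s :+ π :* b) :+ c :* (π :* t)) refl _ _ _ _ _ _ ⟩
      ι p * (ι s + π * ev bs) + ι (coef as r) * (π * π ^ r) ∎)

-- Divisibility by p from integer relations among the powers of w.

module CyclotomicRelations where
  open import Data.Integer.Divisibility.Signed using (_∣_; divides; _∣?_; ∣⇒∣ᵤ)
  open import Data.List.Base using (List; []; _∷_; length; drop)
  import Data.Nat.Divisibility as ℕ
  open import Data.Nat.Combinatorics using (_C_; nC1≡n)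
  open import Relation.Nullary.Decidable using (decidable-stable)
  open IntegerPolynomials
  open TriangularElimination
  open BinomialPolynomials
  open IntegerEuclid

  module _ (A : ℤ-Algebra)
           (torsion-free : ∀ n x → n ≢ ℤ.+ 0 → ℤ-Algebra._≈_ A (ℤ-Algebra._*_ A (ℤ-Algebra.ι A n) x) (ℤ-Algebra.0# A) →
                           ℤ-Algebra._≈_ A x (ℤ-Algebra.0# A))
           (1≉0 : ¬ ℤ-Algebra._≈_ A (ℤ-Algebra.1# A) (ℤ-Algebra.0# A))
           (q : ℕ) (p-prime : Prime (suc q)) (π : ℤ-Algebra.Carrier A)
           (cancel-π : ∀ y → ℤ-Algebra._≈_ A (ℤ-Algebra._*_ A π y) (ℤ-Algebra.0# A) →
                       ℤ-Algebra._≈_ A y (ℤ-Algebra.0# A)) where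
    open ℤ-Algebra A
    open Evaluation A π
    open BinomialEvaluation A π
    open import Algebra.Properties.Semiring.Sum semiring using (sum)
    open import Algebra.Properties.Semiring.Exp semiring using (_^_; ^-homo-*)
    open import Algebra.Properties.Ring ring using (-‿distribˡ-*)
    open import Relation.Binary.Reasoning.Setoid setoid
    open Solver using (solve; con; _:+_; _:*_; _:-_; :-_; _:=_)

    p : ℤ
    p = ℤ.+ suc q

    -- Membership comes with an explicit polynomial, about whose uniqueness nothing is claimed. Its
    -- coefficients enter the rows of the matrix in `p∣constant`.
    ℤ[π] : Carrier → Set
    ℤ[π] y = ∃ λ as → ev as ≈ y

    ℤ[π]-ι : ∀ n → ℤ[π] (ι n)
    ℤ[π]-ι n = n ∷ [] , trans (+-congˡ (zeroʳ π)) (+-identityʳ _)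

    ℤ[π]-π* : ∀ {y} → ℤ[π] y → ℤ[π] (π * y)
    ℤ[π]-π* (as , h) = ℤ.+ 0 ∷ as , trans (+-congʳ 0-homo) (trans (+-identityˡ _) (*-congˡ h))

    ℤ[π]-+ : ∀ {x y} → ℤ[π] x → ℤ[π] y → ℤ[π] (x + y)
    ℤ[π]-+ (as , h) (bs , g) = as ⊕ bs , trans (ev-⊕ as bs) (+-cong h g)

    ℤ[π]-* : ∀ {x y} → ℤ[π] x → ℤ[π] y → ℤ[π] (x * y)
    ℤ[π]-* (as , h) (bs , g) = as ⊗ bs , trans (ev-⊗ as bs) (*-cong h g)

    ℤ[π]-neg : ∀ {y} → ℤ[π] y → ℤ[π] (- y)
    ℤ[π]-neg {y} (as , h) = scale (ℤ.- ℤ.+ 1) as , (begin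
      ev (scale (ℤ.- ℤ.+ 1) as)  ≈⟨ ev-scale (ℤ.- ℤ.+ 1) as ⟩
      ι (ℤ.- ℤ.+ 1) * ev as      ≈⟨ *-cong (trans (-‿homo (ℤ.+ 1)) (-‿cong 1-homo)) h ⟩
      - 1# * y                   ≈⟨ -‿distribˡ-* 1# y ⟨
      - (1# * y)                 ≈⟨ -‿cong (*-identityˡ y) ⟩
      - y                        ∎)

    ℤ[π]-π^ : ∀ n → ℤ[π] (π ^ n)
    ℤ[π]-π^ zero    = ℤ.+ 1 ∷ [] , ev-binomials 0
    ℤ[π]-π^ (suc n) = ℤ[π]-π* (ℤ[π]-π^ n)

    module _ (unity : (1# + π) ^ suc q ≈ 1#) where

      eisenstein≈0 : ev (eisenstein q) ≈ 0#
      eisenstein≈0 = cancel-π _ (begin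
        π * ev (eisenstein q)                  ≈⟨ solve 2 (λ x y → y := (x :+ y) :- x) refl 1# _ ⟩
        (1# + π * ev (eisenstein q)) - 1#      ≈⟨ +-congʳ (trans (sym (ev-binomials-suc q)) unity) ⟩
        1# - 1#                                ≈⟨ -‿inverseʳ 1# ⟩
        0#                                     ∎)

      p∤1 : ¬ (p ∣ ℤ.+ 1)
      p∤1 p∣1 = contradiction (ℕ.∣1⇒≡1 (∣⇒∣ᵤ p∣1)) λ { ≡.refl → ¬prime[1] p-prime }

      -- One linear relation among 1, π, ..., π^(K-1), in the shape that `triangular-kernel` expects
      -- of row i: zero modulo p left of the diagonal and nonzero on it.
      record Row (K i : ℕ) : Set where
        field
          row      : List ℤ
          bound    : length row ℕ.≤ K
          vanish   : ev row ≈ 0#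
          lower    : ∀ {j} → j ℕ.< i → p ∣ coef row j
          diagonal : ¬ (p ∣ coef row i)

      -- The rows of the Sylvester matrix of n + T Y(T) and the Eisenstein polynomial
      -- are upper triangular modulo p, and annihilate the vector of powers of π.
      p∣constant : ∀ n y → ℤ[π] y → ι n + π * y ≈ 0# → p ∣ n
      p∣constant n y (Y , evY) relation = decidable-stable (p ∣? n) λ p∤n → 1≉0 (powers≈0 p∤n Fin.zero)
        where
        -- There are q shifts of n + T Y(T), which has `suc (length Y)` coefficients, and
        -- `suc (length Y)` shifts of the Eisenstein polynomial, which has degree q.
        K = suc (length Y) ℕ.+ q
        module _ (p∤n : ¬ (p ∣ n)) where
          rows : ∀ i → i ℕ.< K → Row K i
          rows i i<K with i ℕ.<? q
          ... | yes i<q = record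
            { row      = shift i (n ∷ Y)
            ; bound    = ℕ.≤-trans (ℕ.≤-reflexive (≡.trans (length-shift i (n ∷ Y)) (ℕ.+-comm i _))) (ℕ.+-monoʳ-≤ (suc (length Y)) (ℕ.<⇒≤ i<q))
            ; vanish   = ev-shift i {n ∷ Y} (trans (+-congˡ (*-congˡ evY)) relation)
            ; lower    = λ j<i → ≡.subst (p ∣_) (≡.sym (coef-shift-< i (n ∷ Y) j<i)) (divides (ℤ.+ 0) ≡.refl)
            ; diagonal = λ p∣c → p∤n (≡.subst (p ∣_) (≡.trans (≡.cong (coef (shift i (n ∷ Y))) (≡.sym (ℕ.+-identityʳ i))) (coef-shift i (n ∷ Y) 0)) p∣c)
            }
          ... | no i≮q = record
            { row      = shift d (eisenstein q)
            ; bound    = ℕ.≤-trans (ℕ.≤-reflexive (length-shift d (eisenstein q))) (ℕ.≤-trans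
                           (ℕ.+-monoʳ-≤ d (length-eisenstein q))
                           (ℕ.≤-trans (ℕ.≤-reflexive (≡.trans (ℕ.+-suc d q) (≡.cong suc d+q≡i))) i<K))
            ; vanish   = ev-shift d {eisenstein q} eisenstein≈0
            ; lower    = λ {j} j<i → lower-row j j<i (j ℕ.<? d)
            ; diagonal = λ p∣c → p∤1 (≡.subst (p ∣_) (≡.trans
                           (≡.cong (coef (shift d (eisenstein q))) (≡.sym d+q≡i)) (≡.trans (coef-shift d (eisenstein q) q) (eisenstein-monic q))) p∣c)
            }
            where
            d = i ℕ.∸ q
            d+q≡i : d ℕ.+ q ≡ i
            d+q≡i = ℕ.m∸n+n≡m (ℕ.≮⇒≥ i≮q)
            lower-row : ∀ j → j ℕ.< i → _ → p ∣ coef (shift d (eisenstein q)) j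
            lower-row j j<i (yes j<d) = ≡.subst (p ∣_) (≡.sym (coef-shift-< d (eisenstein q) j<d)) (divides (ℤ.+ 0) ≡.refl)
            lower-row j j<i (no j≮d)  = ≡.subst (p ∣_)
              (≡.trans (≡.sym (coef-shift d (eisenstein q) (j ℕ.∸ d))) (≡.cong (coef (shift d (eisenstein q))) (ℕ.m+[n∸m]≡n (ℕ.≮⇒≥ j≮d))))
              (eisenstein-lower p-prime (ℕ.+-cancelˡ-< d _ _ (≡.subst₂ ℕ._<_ (≡.sym (ℕ.m+[n∸m]≡n (ℕ.≮⇒≥ j≮d))) (≡.sym d+q≡i) j<i)))

          open Row
          powers≈0 : ∀ (i : Fin K) → π ^ toℕ i ≈ 0#
          powers≈0 = triangular-kernel A torsion-free p (euclid p-prime) K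
            (λ i j → coef (row (rows (toℕ i) (Fin.toℕ<n i))) (toℕ j)) (λ i → π ^ toℕ i)
            (λ i j j<i → lower (rows (toℕ i) (Fin.toℕ<n i)) j<i)
            (λ i → diagonal (rows (toℕ i) (Fin.toℕ<n i)))
            (λ i → trans (sym (ev-sum K (row (rows (toℕ i) (Fin.toℕ<n i))) (bound (rows (toℕ i) (Fin.toℕ<n i))))) (vanish (rows (toℕ i) (Fin.toℕ<n i))))

      p-associate : 1 ℕ.≤ q → ∃ λ y → ℤ[π] y × (1# + π * y) * ι p ≈ - π ^ q
      p-associate 1≤q with coef-quotient p q (eisenstein q) (length-eisenstein q) (eisenstein-lower p-prime)
      ... | bs , coefs , evs = ev (drop 1 bs) , (drop 1 bs , refl) , (begin
        (1# + π * ev (drop 1 bs)) * ι p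
          ≈⟨ *-congʳ (+-congʳ (trans (reflexive (≡.cong ι head≡1)) 1-homo)) ⟨
        (ι (coef bs 0) + π * ev (drop 1 bs)) * ι p
          ≈⟨ *-congʳ (ev-head bs) ⟨
        ev bs * ι p
          ≈⟨ solve 3 (λ b p t → b :* p := (p :* b :+ con (ℤ.+ 1) :* t) :- t) refl _ _ _ ⟩
        (ι p * ev bs + ι (ℤ.+ 1) * π ^ q) - π ^ q
          ≈⟨ +-congʳ (+-congˡ (*-congʳ (reflexive (≡.cong ι (eisenstein-monic q))))) ⟨
        (ι p * ev bs + ι (coef (eisenstein q) q) * π ^ q) - π ^ q
          ≈⟨ +-congʳ (trans (sym evs) eisenstein≈0) ⟩
        0# - π ^ q
          ≈⟨ +-identityˡ _ ⟩
        - π ^ q ∎)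
        where
        -- The constant coefficient of the Eisenstein polynomial is C(p, 1) = p itself, hence 1
        -- after division by p; `1≤q` keeps it apart from the leading coefficient.
        head≡1 : coef bs 0 ≡ ℤ.+ 1
        head≡1 = ℤ.*-cancelʳ-≡ (coef bs 0) (ℤ.+ 1) p (≡.trans (≡.sym (coefs 1≤q))
          (≡.trans (coef-eisenstein q 0) (≡.trans (≡.cong ℤ.+_ (nC1≡n (suc q))) (≡.sym (ℤ.*-identityˡ p)))))

      -- The factor 1 + πu and the remainder π^r y are what makes the induction go through.
      -- `p∣constant` gives s p for the constant coefficient; multiplying the relation by the factor
      -- 1 + πv of `p-associate` turns s p into -s π^q, which the remainder absorbs, and cancelling
      -- one π leaves a relation for `drop 1 as` with r lowered by one.
      p∣coefs : ∀ r → r ℕ.≤ q → ∀ as u y → ℤ[π] u → ℤ[π] y → (1# + π * u) * ev as + π ^ r * y ≈ 0# →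
                ∀ {k} → k ℕ.< r → p ∣ coef as k
      p∣coefs (suc r) r<q as u y ℤu ℤy relation = all
        where
        a = coef as 0
        e = ev (drop 1 as)

        expanded : (1# + π * u) * (ι a + π * e) + (π * π ^ r) * y ≈ 0#
        expanded = trans (+-congʳ (*-congˡ (sym (ev-head as)))) relation

        p∣a : p ∣ a
        p∣a = p∣constant a (u * ι a + (1# + π * u) * e + π ^ r * y)
          (ℤ[π]-+ (ℤ[π]-+ (ℤ[π]-* ℤu (ℤ[π]-ι a)) (ℤ[π]-* (ℤ[π]-+ (ℤ[π]-π^ 0) (ℤ[π]-π* ℤu)) (drop 1 as , refl))) (ℤ[π]-* (ℤ[π]-π^ r) ℤy))
          (trans (trans (+-congʳ (sym (*-identityˡ _)))
            (solve 7 (λ o π u a e t y → o :* a :+ π :* (u :* a :+ (o :+ π :* u) :* e :+ t :* y) := (o :+ π :* u) :* (a :+ π :* e) :+ (π :* t) :* y :+ (o :- o) :* con (ℤ.+ 0))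
              refl 1# π u (ι a) e (π ^ r) y))
            (trans (+-cong expanded (trans (*-congˡ 0-homo) (zeroʳ _))) (+-identityˡ _)))

        s = _∣_.quotient p∣a
        v = proj₁ (p-associate (ℕ.≤-trans (s≤s z≤n) r<q))
        ℤv = proj₁ (proj₂ (p-associate (ℕ.≤-trans (s≤s z≤n) r<q)))
        -- What is left of π^q after one factor π is cancelled and π^r is pulled out.
        d = q ℕ.∸ suc r

        π^q : π ^ q ≈ π * (π ^ r * π ^ d)
        π^q = trans (reflexive (≡.cong (π ^_) (≡.sym (ℕ.m+[n∸m]≡n r<q)))) (*-congˡ (^-homo-* π r d))

        divided : (1# + π * (u + v + π * (u * v))) * e + π ^ r * ((1# + π * v) * y - π ^ d * ((1# + π * u) * ι s)) ≈ 0#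
        divided = cancel-π _ (begin
          π * ((1# + π * (u + v + π * (u * v))) * e + π ^ r * ((1# + π * v) * y - π ^ d * ((1# + π * u) * ι s)))
            ≈⟨ *-congˡ (+-congʳ (*-congʳ (trans (+-congʳ (sym (*-identityˡ 1#))) (+-congˡ (*-congˡ (+-congʳ (+-cong (sym (*-identityˡ u)) (sym (*-identityˡ v))))))))) ⟩
          π * ((1# * 1# + π * (1# * u + 1# * v + π * (u * v))) * e + π ^ r * ((1# + π * v) * y - π ^ d * ((1# + π * u) * ι s)))
            ≈⟨ solve 10 (λ o π u v e t y d s p →
                 π :* ((o :* o :+ π :* (o :* u :+ o :* v :+ π :* (u :* v))) :* e :+ t :* ((o :+ π :* v) :* y :- d :* ((o :+ π :* u) :* s)))
                 := (o :+ π :* v) :* ((o :+ π :* u) :* (s :* p :+ π :* e) :+ (π :* t) :* y)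
                    :+ (o :+ π :* u) :* s :* (:- (π :* (t :* d)) :- (o :+ π :* v) :* p))
                 refl 1# π u v e (π ^ r) y (π ^ d) (ι s) (ι p) ⟩
          (1# + π * v) * ((1# + π * u) * (ι s * ι p + π * e) + (π * π ^ r) * y)
            + (1# + π * u) * ι s * (- (π * (π ^ r * π ^ d)) - (1# + π * v) * ι p)
            ≈⟨ +-cong
                 (*-congˡ (trans (+-congʳ (*-congˡ (+-congʳ (trans (sym (*-homo s p)) (reflexive (≡.cong ι (≡.sym (_∣_.equality p∣a)))))))) expanded))
                 (*-congˡ (trans (+-cong (-‿cong (sym π^q)) (-‿cong (proj₂ (proj₂ (p-associate (ℕ.≤-trans (s≤s z≤n) r<q)))))) (-‿inverseʳ _))) ⟩
          (1# + π * v) * 0# + (1# + π * u) * ι s * 0#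
            ≈⟨ trans (+-cong (zeroʳ _) (zeroʳ _)) (+-identityˡ _) ⟩
          0# ∎)

        induct : ∀ {k} → k ℕ.< r → p ∣ coef (drop 1 as) k
        induct = p∣coefs r (ℕ.<⇒≤ r<q) (drop 1 as) _ _
          (ℤ[π]-+ (ℤ[π]-+ ℤu ℤv) (ℤ[π]-π* (ℤ[π]-* ℤu ℤv)))
          (ℤ[π]-+ (ℤ[π]-* (ℤ[π]-+ (ℤ[π]-π^ 0) (ℤ[π]-π* ℤv)) ℤy)
            (ℤ[π]-neg (ℤ[π]-* (ℤ[π]-π^ d) (ℤ[π]-* (ℤ[π]-+ (ℤ[π]-π^ 0) (ℤ[π]-π* ℤu)) (ℤ[π]-ι s)))))
          divided

        all : ∀ {k} → k ℕ.< suc r → p ∣ coef as k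
        all {zero}  _         = p∣a
        all {suc k} (s≤s k<r) = ≡.subst (p ∣_) (coef-drop as k) (induct k<r)

      module _ where
        open import Algebra.Properties.CommutativeMonoid.Sum ℤ.+-0-commutativeMonoid using () renaming (sum to sumℤ)

        binomial-sums : ∀ n (e : Fin n → ℕ) →
          ∃ λ as → ev as ≈ sum (λ x → (1# + π) ^ e x) × (∀ k → coef as k ≡ sumℤ (λ x → ℤ.+ (e x C k)))
        binomial-sums zero    e = [] , refl , λ k → ≡.refl
        binomial-sums (suc n) e with binomial-sums n (e ∘ suc)
        ... | as , evs , coefs = binomials (e zero) ⊕ as , trans (ev-⊕ (binomials (e zero)) as) (+-cong (ev-binomials (e zero)) evs) ,
          λ k → ≡.trans (coef-⊕ (binomials (e zero)) as k) (≡.cong₂ ℤ._+_ (coef-binomials (e zero) k) (coefs k))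

        p∣binomial-sums : ∀ {n} (e : Fin n → ℕ) → sum (λ x → (1# + π) ^ e x) ≈ 0# →
                          ∀ {k} → k ℕ.< q → p ∣ sumℤ (λ x → ℤ.+ (e x C k))
        p∣binomial-sums {n} e relation {k} k<q with binomial-sums n e
        ... | as , evs , coefs = ≡.subst (p ∣_) (coefs k)
          -- The given relation is the case u = y = 0; r = q is the largest value for which π^q
          -- still fits into the remainder.
          (p∣coefs q ℕ.≤-refl as (ι (ℤ.+ 0)) (ι (ℤ.+ 0)) (ℤ[π]-ι _) (ℤ[π]-ι _) (begin
            (1# + π * ι (ℤ.+ 0)) * ev as + π ^ q * ι (ℤ.+ 0)
              ≈⟨ +-cong (*-congʳ (+-congˡ (trans (*-congˡ 0-homo) (zeroʳ π)))) (trans (*-congˡ 0-homo) (zeroʳ _)) ⟩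
            (1# + 0#) * ev as + 0#
              ≈⟨ trans (+-identityʳ _) (trans (*-congʳ (+-identityʳ _)) (*-identityˡ _)) ⟩
            ev as
              ≈⟨ trans evs relation ⟩
            0# ∎) k<q)

-- Polynomial functions and power sums over a prime field.

module FiniteFieldPolynomials where
  open import Data.Integer.Divisibility.Signed using (_∣_; ∣⇒∣ᵤ)
  import Data.Nat.Divisibility as ℕ
  open import Relation.Nullary.Decidable using (Dec)
  open BinomialPolynomials

  -- `q` is p - 1, the exponent at which power sums over the field first fail to vanish.
  -- `surjective` reduces statements about all elements to induction over ℕ.
  record PrimeField : Set₁ where
    field
      algebra : ℤ-Algebra
      q       : ℕ
      p-prime : Prime (suc q)
    open ℤ-Algebra algebra public
    field
      _≟_        : ∀ x y → Dec (x ≈ y)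
      domain     : ∀ x y → x * y ≈ 0# → x ≈ 0# ⊎ y ≈ 0#
      char       : ∀ {n} → ι n ≈ 0# → ℤ.+ suc q ∣ n
      ι-p        : ι (ℤ.+ suc q) ≈ 0#
      surjective : ∀ x → ∃ λ k → x ≈ ι (ℤ.+ k)

  module PolynomialFunctions (F : PrimeField) where
    open PrimeField F
    open FiniteSums algebra
    open import Algebra.Properties.Semiring.Sum semiring
      using (sum; sum-cong-≋; sum-replicate-zero; *-distribˡ-sum; ∑-distrib-+; ∑-comm)
    open import Algebra.Properties.Semiring.Exp semiring using (_^_; ^-congˡ; ^-homo-*)
    open import Algebra.Properties.Ring ring using (-‿distribˡ-*; x∙y⁻¹≈ε⇒x≈y; -0#≈0#)
    open import Relation.Binary.Reasoning.Setoid setoid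
    open Solver using (solve; _:+_; _:*_; _:-_; :-_; _:=_)

    ι-nonzero : ∀ k → suc k ℕ.≤ q → ¬ ι (ℤ.+ suc k) ≈ 0#
    ι-nonzero k k<q h = ℕ.<⇒≱ (s≤s k<q) (ℕ.∣⇒≤ (∣⇒∣ᵤ (char h)))

    1≉0 : ¬ 1# ≈ 0#
    1≉0 h with q | p-prime | char (trans 1-homo h)
    ... | zero  | prime₁ | _   = Data.Nat.Primality.¬prime[1] prime₁
    ... | suc _ | _      | p∣1 = contradiction (ℕ.∣⇒≤ (∣⇒∣ᵤ p∣1)) λ { (s≤s ()) }

    1≤q : 1 ℕ.≤ q
    1≤q with q | p-prime
    ... | zero  | prime₁ = contradiction prime₁ Data.Nat.Primality.¬prime[1]
    ... | suc _ | _      = s≤s z≤n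

    ^-nonzero : ∀ n {x} → x ^ n ≈ 0# → x ≈ 0#
    ^-nonzero zero    h = contradiction h 1≉0
    ^-nonzero (suc n) {x} h with domain x _ h
    ... | inj₁ x≈0  = x≈0
    ... | inj₂ x^n≈0 = ^-nonzero n x^n≈0

    0^suc : ∀ {n} → 1 ℕ.≤ n → 0# ^ n ≈ 0#
    0^suc {suc n} _ = zeroˡ _

    Congruent : (Carrier → Carrier) → Set
    Congruent φ = ∀ {x y} → x ≈ y → φ x ≈ φ y

    el : Fin (suc q) → Carrier
    el x = ι (ℤ.+ toℕ x)

    freshman : ∀ x → (1# + x) ^ suc q ≈ 1# + x ^ suc q
    freshman x with coef-quotient (ℤ.+ suc q) q (eisenstein q) (length-eisenstein q) (eisenstein-lower p-prime)
      where open BinomialEvaluation algebra x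
    ... | bs , _ , evs = begin
      (1# + x) ^ suc q                       ≈⟨ ev-binomials-suc q ⟩
      1# + x * ev (eisenstein q)             ≈⟨ +-congˡ (*-congˡ evs) ⟩
      1# + x * (ι (ℤ.+ suc q) * ev bs + ι (coef (eisenstein q) q) * x ^ q)
        ≈⟨ +-congˡ (*-congˡ (+-cong (trans (*-congʳ ι-p) (zeroˡ _))
             (trans (*-congʳ (trans (reflexive (≡.cong ι (eisenstein-monic q))) 1-homo)) (*-identityˡ _)))) ⟩
      1# + x * (0# + x ^ q)                  ≈⟨ +-congˡ (*-congˡ (+-identityˡ _)) ⟩
      1# + x ^ suc q                         ∎
      where
      open BinomialEvaluation algebra x
      open IntegerPolynomials using (coef)
      open IntegerPolynomials.Evaluation algebra x using (ev)

    fermat : ∀ x → x ^ suc q ≈ x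
    fermat x with surjective x
    ... | k , x≈k = trans (^-congˡ (suc q) x≈k) (trans (iterate k) (sym x≈k))
      where
      iterate : ∀ k → ι (ℤ.+ k) ^ suc q ≈ ι (ℤ.+ k)
      iterate zero    = trans (^-congˡ (suc q) 0-homo) (trans (zeroˡ _) (sym 0-homo))
      iterate (suc k) = trans (^-congˡ (suc q) (ι-suc k)) (trans (freshman _) (trans (+-congˡ (iterate k)) (sym (ι-suc k))))

    fermat-unit : ∀ {x} → ¬ x ≈ 0# → x ^ q ≈ 1#
    fermat-unit {x} x≉0 with domain x (x ^ q - 1#) (begin
        x * (x ^ q - 1#)     ≈⟨ trans (distribˡ x _ _) (+-congˡ (trans (*-comm x _) (trans (sym (-‿distribˡ-* 1# x)) (-‿cong (*-identityˡ x))))) ⟩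
        x ^ suc q - x        ≈⟨ +-congʳ (fermat x) ⟩
        x - x                ≈⟨ -‿inverseʳ x ⟩
        0#                   ∎)
    ... | inj₁ x≈0 = contradiction x≈0 x≉0
    ... | inj₂ h   = x∙y⁻¹≈ε⇒x≈y _ _ h

    abstract
      L : (Carrier → Carrier) → Carrier
      L φ = sum {suc q} (λ x → φ (ι (ℤ.+ toℕ x)))

      L-sum-el : ∀ φ → L φ ≈ sum {suc q} (λ x → φ (el x))
      L-sum-el φ = refl

      L-cong : ∀ {φ ψ} → (∀ x → φ x ≈ ψ x) → L φ ≈ L ψ
      L-cong h = sum-cong-≋ {suc q} (λ x → h (ι (ℤ.+ toℕ x)))

      L-zero : ∀ {φ} → (∀ x → φ x ≈ 0#) → L φ ≈ 0#
      L-zero h = sum-0# (suc q) (λ x → h (ι (ℤ.+ toℕ x)))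

      L-+ : ∀ φ ψ → L (λ x → φ x + ψ x) ≈ L φ + L ψ
      L-+ φ ψ = ∑-distrib-+ {suc q} (λ x → φ (el x)) (λ x → ψ (el x))

      L-* : ∀ c φ → L (λ x → c * φ x) ≈ c * L φ
      L-* c φ = sym (*-distribˡ-sum {suc q} c (λ x → φ (el x)))

      L-∑ : ∀ n (φ : Fin n → Carrier → Carrier) → L (λ x → sum (λ i → φ i x)) ≈ sum (λ i → L (φ i))
      L-∑ n φ = ∑-comm {suc q} {n} (λ x i → φ i (el x))

      L-comm : ∀ (φ : Carrier → Carrier → Carrier) → L (λ x → L (λ y → φ x y)) ≈ L (λ y → L (λ x → φ x y))
      L-comm φ = ∑-comm {suc q} {suc q} (λ x y → φ (el x) (el y))

      L-1# : L (λ _ → 1#) ≈ 0#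
      L-1# = trans (sum-1# (suc q)) ι-p

      -- In the sum of φ over 0, 1, ..., p the first and the last term agree because p = 0; dropping
      -- the one or the other gives the two sides.
      L-shift-1 : ∀ {φ} → Congruent φ → L (λ x → φ (1# + x)) ≈ L φ
      L-shift-1 {φ} φ-cong = begin
        L (λ x → φ (1# + x))
          ≈⟨ sum-cong-≋ {suc q} (λ x → φ-cong (ι-suc (toℕ x))) ⟨
        sum {suc q} (λ x → φ (ι (ℤ.+ suc (toℕ x))))
          ≈⟨ solve 2 (λ s t → t := (s :+ t) :- s) refl (φ (ι (ℤ.+ 0))) _ ⟩
        sum {suc (suc q)} (λ x → φ (ι (ℤ.+ toℕ x))) - φ (ι (ℤ.+ 0))
          ≈⟨ +-cong (sum-snoc (suc q) (λ k → φ (ι (ℤ.+ k)))) (-‿cong (φ-cong (trans 0-homo (sym ι-p)))) ⟩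
        (L φ + φ (ι (ℤ.+ suc q))) - φ (ι (ℤ.+ suc q))
          ≈⟨ solve 2 (λ s t → (s :+ t) :- t := s) refl (L φ) _ ⟩
        L φ ∎

      L-point : ∀ {φ} → Congruent φ → (∀ x → ¬ x ≈ 0# → φ x ≈ 0#) → L φ ≈ φ 0#
      L-point {φ} φ-cong h = trans (+-cong (φ-cong 0-homo)
        (sum-0# q (λ x → h _ (ι-nonzero (toℕ x) (Fin.toℕ<n x))))) (+-identityʳ _)

      -- By Fermat each of the q nonzero elements contributes 1, and q = -1 in the field.
      L-x^q : L (_^ q) ≈ - 1#
      L-x^q = begin
        L (_^ q)                                              ≈⟨ +-cong (trans (^-congˡ q 0-homo) (0^suc 1≤q))
                                                                   (trans (sum-cong-≋ {q} (λ x → fermat-unit (ι-nonzero (toℕ x) (Fin.toℕ<n x)))) (sum-1# q)) ⟩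
        0# + ι (ℤ.+ q)                                        ≈⟨ trans (+-identityˡ _) (solve 2 (λ o t → t := (o :+ t) :- o) refl 1# _) ⟩
        (1# + ι (ℤ.+ q)) - 1#                                 ≈⟨ +-congʳ (trans (sym (ι-suc q)) ι-p) ⟩
        0# - 1#                                               ≈⟨ +-identityˡ _ ⟩
        - 1#                                                  ∎

    L-shift : ∀ {φ} → Congruent φ → ∀ a → L (λ x → φ (a + x)) ≈ L φ
    L-shift {φ} φ-cong a with surjective a
    ... | k , a≈k = trans (L-cong (λ x → φ-cong (+-congʳ a≈k))) (iterate k)
      where
      iterate : ∀ k → L (λ x → φ (ι (ℤ.+ k) + x)) ≈ L φ
      iterate zero    = L-cong (λ x → φ-cong (trans (+-congʳ 0-homo) (+-identityˡ x)))
      iterate (suc k) = begin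
        L (λ x → φ (ι (ℤ.+ suc k) + x))
          ≈⟨ L-cong (λ x → φ-cong (trans (+-congʳ (ι-suc k)) (trans (+-congʳ (+-comm 1# _)) (+-assoc _ _ _)))) ⟩
        L (λ x → φ (ι (ℤ.+ k) + (1# + x)))
          ≈⟨ L-shift-1 {λ x → φ (ι (ℤ.+ k) + x)} (λ h → φ-cong (+-congˡ h)) ⟩
        L (λ x → φ (ι (ℤ.+ k) + x))
          ≈⟨ iterate k ⟩
        L φ ∎

    -- A property of functions: monomials are stripped off from the top until nothing is left. No
    -- formal polynomial is involved, and the coefficients are not determined by the function once m
    -- exceeds p, as x^p = x.
    Deg< : ℕ → (Carrier → Carrier) → Set
    Deg< zero    φ = ∀ x → φ x ≈ 0#
    Deg< (suc m) φ = ∃ λ c → Deg< m (λ x → φ x - c * x ^ m)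

    -- The coefficient c may be zero, so this bounds the degree by m and names the coefficient
    -- there. By definition it is the second component of `Deg< (suc m) φ`.
    Lead : ℕ → Carrier → (Carrier → Carrier) → Set
    Lead m c φ = Deg< m (λ x → φ x - c * x ^ m)

    Deg<-≡ : ∀ {m n} φ → m ≡ n → Deg< m φ → Deg< n φ
    Deg<-≡ φ m≡n = ≡.subst (λ k → Deg< k φ) m≡n

    Deg<-resp : ∀ m {φ ψ} → (∀ x → φ x ≈ ψ x) → Deg< m φ → Deg< m ψ
    Deg<-resp zero    h d       = λ x → trans (sym (h x)) (d x)
    Deg<-resp (suc m) h (c , d) = c , Deg<-resp m (λ x → +-congʳ (h x)) d

    Deg<-cong : ∀ m {φ} → Deg< m φ → Congruent φ
    Deg<-cong zero    d       h = trans (d _) (sym (d _))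
    Deg<-cong (suc m) (c , d) {x} {y} h = trans (solve 2 (λ f t → f := (f :- t) :+ t) refl _ (c * x ^ m))
      (trans (+-cong (Deg<-cong m d h) (*-congˡ (^-congˡ m h))) (solve 2 (λ f t → (f :- t) :+ t := f) refl _ (c * y ^ m)))

    Deg<-0 : ∀ m → Deg< m (λ _ → 0#)
    Deg<-0 zero    = λ _ → refl
    Deg<-0 (suc m) = 0# , Deg<-resp m (λ x → sym (trans (+-identityˡ _) (trans (-‿cong (zeroˡ _)) -0#≈0#))) (Deg<-0 m)

    Deg<-+ : ∀ m {φ ψ} → Deg< m φ → Deg< m ψ → Deg< m (λ x → φ x + ψ x)
    Deg<-+ zero    d e = λ x → trans (+-cong (d x) (e x)) (+-identityˡ _)
    Deg<-+ (suc m) (a , d) (b , e) = a + b , Deg<-resp m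
      (λ x → solve 5 (λ f g a b t → (f :- a :* t) :+ (g :- b :* t) := (f :+ g) :- (a :+ b) :* t) refl _ _ _ _ _) (Deg<-+ m d e)

    Deg<-* : ∀ m c {φ} → Deg< m φ → Deg< m (λ x → c * φ x)
    Deg<-* zero    c d       = λ x → trans (*-congˡ (d x)) (zeroʳ c)
    Deg<-* (suc m) c (a , d) = c * a , Deg<-resp m
      (λ x → solve 4 (λ c f a t → c :* (f :- a :* t) := c :* f :- (c :* a) :* t) refl _ _ _ _) (Deg<-* m c d)

    Deg<-neg : ∀ m {φ} → Deg< m φ → Deg< m (λ x → - φ x)
    Deg<-neg m d = Deg<-resp m (λ x → trans (sym (-‿distribˡ-* 1# _)) (-‿cong (*-identityˡ _))) (Deg<-* m (- 1#) d)

    Deg<-suc : ∀ m {φ} → Deg< m φ → Deg< (suc m) φ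
    Deg<-suc m d = 0# , Deg<-resp m (λ x → sym (trans (+-congˡ (trans (-‿cong (zeroˡ _)) -0#≈0#)) (+-identityʳ _))) d

    Deg<-mono : ∀ {m n φ} → m ℕ.≤ n → Deg< m φ → Deg< n φ
    Deg<-mono {m} {n} {φ} m≤n d = ≡.subst (λ k → Deg< k φ) (ℕ.m∸n+n≡m m≤n) (extend (n ℕ.∸ m))
      where
      extend : ∀ k → Deg< (k ℕ.+ m) φ
      extend zero    = d
      extend (suc k) = Deg<-suc (k ℕ.+ m) (extend k)

    Deg<-x* : ∀ m {φ} → Deg< m φ → Deg< (suc m) (λ x → x * φ x)
    Deg<-x* zero    d       = Deg<-suc zero (λ x → trans (*-congˡ (d x)) (zeroʳ x))
    Deg<-x* (suc m) (c , d) = c , Deg<-resp (suc m)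
      (λ x → solve 4 (λ x f a t → x :* (f :- a :* t) := x :* f :- a :* (x :* t)) refl _ _ _ _) (Deg<-x* m d)

    Deg<-x^ : ∀ n {m φ} → Deg< m φ → Deg< (n ℕ.+ m) (λ x → x ^ n * φ x)
    Deg<-x^ zero    {m} d = Deg<-resp m (λ x → sym (*-identityˡ _)) d
    Deg<-x^ (suc n) {m} d = Deg<-resp (suc (n ℕ.+ m)) (λ x → sym (*-assoc _ _ _)) (Deg<-x* (n ℕ.+ m) (Deg<-x^ n d))

    Lead-suc : ∀ {m c φ} → Lead m c φ → Deg< (suc m) φ
    Lead-suc {c = c} d = c , d

    -- Induction on n, peeling off the top monomial of ψ. The coarse bound m + n is what the error
    -- terms in `Lead-·` call for.
    Deg<-·  : ∀ m n {φ ψ} → Deg< m φ → Deg< n ψ → Deg< (m ℕ.+ n) (λ x → φ x * ψ x)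
    Deg<-· m zero    d e       = Deg<-mono {0} {m ℕ.+ 0} z≤n (λ x → trans (*-congˡ (e x)) (zeroʳ _))
    Deg<-· m (suc n) {φ} {ψ} d (b , e) = Deg<-≡ (λ x → φ x * ψ x) (≡.sym (ℕ.+-suc m n)) (Deg<-resp (suc m ℕ.+ n)
      (λ x → solve 4 (λ f g b t → b :* (t :* f) :+ f :* (g :- b :* t) := f :* g) refl (φ x) (ψ x) b (x ^ n))
      (Deg<-+ (suc (m ℕ.+ n)) (Deg<-suc (m ℕ.+ n) (Deg<-* (m ℕ.+ n) b (Deg<-≡ _ (ℕ.+-comm n m) (Deg<-x^ n d))))
        (Deg<-suc (m ℕ.+ n) (Deg<-· m n d e))))

    Lead-· : ∀ m n {a b φ ψ} → Lead m a φ → Lead n b ψ → Lead (m ℕ.+ n) (a * b) (λ x → φ x * ψ x)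
    Lead-· m n {a} {b} {φ} {ψ} d e = Deg<-resp (m ℕ.+ n)
      (λ x → trans (solve 6 (λ f g a b s t → a :* (s :* (g :- b :* t)) :+ (b :* (t :* (f :- a :* s)) :+ (f :- a :* s) :* (g :- b :* t)) := f :* g :- (a :* b) :* (s :* t)) refl (φ x) (ψ x) a b (x ^ m) (x ^ n))
             (+-congˡ (-‿cong (*-congˡ (sym (^-homo-* x m n))))))
      (Deg<-+ (m ℕ.+ n) (Deg<-* (m ℕ.+ n) a (Deg<-x^ m e))
        (Deg<-+ (m ℕ.+ n) (Deg<-* (m ℕ.+ n) b (Deg<-≡ _ (ℕ.+-comm n m) (Deg<-x^ n d))) (Deg<-· m n d e)))

    Lead-resp : ∀ m {c d φ ψ} → c ≈ d → (∀ x → φ x ≈ ψ x) → Lead m c φ → Lead m d ψ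
    Lead-resp m c≈d h = Deg<-resp m (λ x → +-cong (h x) (-‿cong (*-congʳ c≈d)))

    Lead-+ : ∀ m {c φ ψ} → Lead m c φ → Deg< m ψ → Lead m c (λ x → φ x + ψ x)
    Lead-+ m d e = Deg<-resp m (λ x → solve 3 (λ f g t → (f :- t) :+ g := (f :+ g) :- t) refl _ _ _) (Deg<-+ m d e)

    Lead-++ : ∀ m {c d φ ψ} → Lead m c φ → Lead m d ψ → Lead m (c + d) (λ x → φ x + ψ x)
    Lead-++ m d e = Deg<-resp m
      (λ x → solve 5 (λ f g a b t → (f :- a :* t) :+ (g :- b :* t) := (f :+ g) :- (a :+ b) :* t) refl _ _ _ _ _) (Deg<-+ m d e)

    Lead-const : ∀ c → Lead 0 c (λ _ → c)
    Lead-const c = λ x → trans (+-congˡ (-‿cong (*-identityʳ c))) (-‿inverseʳ c)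

    Lead-x^ : ∀ n → Lead n 1# (λ x → x ^ n)
    Lead-x^ n = Deg<-resp n (λ x → sym (trans (+-congˡ (-‿cong (*-identityˡ _))) (-‿inverseʳ _))) (Deg<-0 n)

    Lead-x : Lead 1 1# (λ x → x)
    Lead-x = Lead-resp 1 refl (λ x → *-identityʳ x) (Lead-x^ 1)

    Lead-x+ : ∀ c → Lead 1 1# (λ x → x + c)
    Lead-x+ c = Lead-+ 1 Lead-x (Lead-suc {0} (Lead-const c))

    Lead-^ : ∀ n {m a φ} → Lead m a φ → Lead (n ℕ.* m) (a ^ n) (λ x → φ x ^ n)
    Lead-^ zero        d = Lead-const 1#
    Lead-^ (suc n) {m} d = Lead-· m (n ℕ.* m) d (Lead-^ n d)

    Lead-[x+c]^ : ∀ n c → Lead n 1# (λ x → (x + c) ^ n)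
    Lead-[x+c]^ n c = ≡.subst (λ k → Lead k 1# (λ x → (x + c) ^ n)) (ℕ.*-identityʳ n)
      (Lead-resp (n ℕ.* 1) (1^ n) (λ _ → refl) (Lead-^ n (Lead-x+ c)))
      where
      1^ : ∀ n → 1# ^ n ≈ 1#
      1^ zero    = refl
      1^ (suc n) = trans (*-identityˡ _) (1^ n)

    Lead-difference : ∀ m → Lead m (ι (ℤ.+ suc m)) (λ x → (x + 1#) ^ suc m - x ^ suc m)
    Lead-difference zero    = λ x → trans
      (+-congˡ (-‿cong (trans (*-identityʳ _) 1-homo)))
      (trans (+-congʳ (+-cong (*-identityʳ _) (-‿cong (*-identityʳ _))))
        (trans (+-congʳ (solve 2 (λ x o → (x :+ o) :- x := o) refl x 1#)) (-‿inverseʳ 1#)))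
    Lead-difference (suc m) = Lead-resp (suc m)
      (sym (trans (ι-suc (suc m)) (trans (+-comm 1# _) (+-congʳ (sym (*-identityˡ _))))))
      (λ x → solve 4 (λ x o s t → x :* (s :- t) :+ o :* s := (x :+ o) :* s :- x :* t) refl x 1# ((x + 1#) ^ suc m) (x ^ suc m))
      (Lead-++ (suc m) (Lead-· 1 m Lead-x (Lead-difference m))
        (Lead-resp (suc m) refl (λ x → sym (*-identityˡ _)) (Lead-[x+c]^ (suc m) 1#)))

    -- Translation invariance gives L Δ = 0 for Δ(x) = (x + 1)^(m+1) - x^(m+1), whose leading term
    -- is (m + 1) x^m. The lower terms of Δ have sum zero by induction, hence so does (m + 1) x^m,
    -- and m + 1 < p is nonzero in the field.
    L-Deg< : ∀ m {φ} → m ℕ.≤ q → Deg< m φ → L φ ≈ 0#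
    L-Deg< zero    m≤q d = L-zero d
    L-Deg< (suc m) {φ} m<q (c , d) = begin
      L φ                                            ≈⟨ L-cong (λ x → solve 2 (λ f t → f := t :+ (f :- t)) refl (φ x) _) ⟩
      L (λ x → c * x ^ m + (φ x - c * x ^ m))        ≈⟨ L-+ _ _ ⟩
      L (λ x → c * x ^ m) + L (λ x → φ x - c * x ^ m) ≈⟨ +-cong (L-* c (_^ m)) (L-Deg< m (ℕ.<⇒≤ m<q) d) ⟩
      c * L (_^ m) + 0#                              ≈⟨ +-identityʳ _ ⟩
      c * L (_^ m)                                   ≈⟨ *-congˡ L-power ⟩
      c * 0#                                         ≈⟨ zeroʳ c ⟩
      0#                                             ∎
      where
      s = ι (ℤ.+ suc m)
      Δ : Carrier → Carrier
      Δ x = (x + 1#) ^ suc m - x ^ suc m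
      L-Δ : L Δ ≈ 0#
      L-Δ = begin
        L Δ ≈⟨ L-cong (λ x → trans (+-cong (^-congˡ (suc m) (+-comm x 1#)) (trans (-‿cong (sym (*-identityˡ _))) (-‿distribˡ-* 1# _))) refl) ⟩
        L (λ x → (1# + x) ^ suc m + (- 1#) * x ^ suc m) ≈⟨ trans (L-+ _ _) (+-cong (L-shift-1 (^-congˡ (suc m))) (L-* (- 1#) (_^ suc m))) ⟩
        L (_^ suc m) + (- 1#) * L (_^ suc m) ≈⟨ +-congˡ (trans (sym (-‿distribˡ-* 1# _)) (-‿cong (*-identityˡ _))) ⟩
        L (_^ suc m) - L (_^ suc m) ≈⟨ -‿inverseʳ _ ⟩
        0# ∎
      L-power : L (_^ m) ≈ 0#
      L-power with domain s (L (_^ m)) (begin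
          s * L (_^ m)                                      ≈⟨ +-identityʳ _ ⟨
          s * L (_^ m) + 0#                                 ≈⟨ +-cong (L-* s (_^ m)) (L-Deg< m (ℕ.<⇒≤ m<q) (Lead-difference m)) ⟨
          L (λ x → s * x ^ m) + L (λ x → Δ x - s * x ^ m)   ≈⟨ L-+ _ _ ⟨
          L (λ x → s * x ^ m + (Δ x - s * x ^ m))           ≈⟨ L-cong (λ x → solve 2 (λ f t → f := t :+ (f :- t)) refl (Δ x) _) ⟨
          L Δ                                               ≈⟨ L-Δ ⟩
          0#                                                ∎)
      ... | inj₁ s≈0 = contradiction s≈0 (ι-nonzero m m<q)
      ... | inj₂ h   = h

    -- The sum of such a function is -c: the lower terms contribute nothing, and L(x^q) = -1.
    L-Lead : ∀ {c φ} → Lead q c φ → L φ ≈ 0# → c ≈ 0#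
    L-Lead {c} {φ} d h = begin
      c                                               ≈⟨ solve 2 (λ c o → c := (c :* (:- o) :+ c :* o) :- (c :* (:- o) :+ (c :* o :- c))) refl c 1# ⟩
      (c * - 1# + c * 1#) - (c * - 1# + (c * 1# - c)) ≈⟨ +-cong (trans (sym (distribˡ c _ _)) (trans (*-congˡ (-‿inverseˡ 1#)) (zeroʳ c)))
                                                           (-‿cong (trans (+-cong (*-congˡ (sym L-x^q)) (trans (+-congʳ (*-identityʳ c)) (-‿inverseʳ c))) (+-identityʳ _))) ⟩
      0# - c * L (_^ q)                               ≈⟨ +-congˡ (-‿cong (+-identityʳ _)) ⟨
      0# - (c * L (_^ q) + 0#)                        ≈⟨ +-congˡ (-‿cong (+-cong (L-* c (_^ q)) (L-Deg< q ℕ.≤-refl d))) ⟨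
      0# - (L (λ x → c * x ^ q) + L (λ x → φ x - c * x ^ q)) ≈⟨ +-congˡ (-‿cong (L-+ _ _)) ⟨
      0# - L (λ x → c * x ^ q + (φ x - c * x ^ q))    ≈⟨ +-congˡ (-‿cong (L-cong (λ x → solve 2 (λ f t → f := t :+ (f :- t)) refl (φ x) _))) ⟨
      0# - L φ                                        ≈⟨ trans (+-identityˡ _) (trans (-‿cong h) -0#≈0#) ⟩
      0#                                              ∎

    -- Multiplying by x^(q - m) lifts the leading term to degree q, where `L` detects it. This takes
    -- the place of counting roots.
    Lead-vanishing : ∀ {m c φ} → m ℕ.≤ q → Lead m c φ → (∀ x → φ x ≈ 0#) → c ≈ 0#
    Lead-vanishing {m} {c} {φ} m≤q d h = L-Lead
      (≡.subst (λ k → Lead k c (λ x → φ x * x ^ (q ℕ.∸ m))) (ℕ.m+[n∸m]≡n m≤q)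
        (Lead-resp (m ℕ.+ (q ℕ.∸ m)) (*-identityʳ c) (λ _ → refl) (Lead-· m (q ℕ.∸ m) d (Lead-x^ (q ℕ.∸ m)))))
      (L-zero (λ x → trans (*-congʳ (h x)) (zeroˡ _)))

-- Functions on 𝔽ₚ whose differences have vanishing power sums.

module PlanarFunctions where
  open import Data.Integer.Divisibility.Signed using (∣⇒∣ᵤ)
  import Data.Nat.Divisibility as ℕ
  open import Data.Nat.Combinatorics using (_C_; nCk≡n!/k![n-k]!; k![n∸k]!∣n!)
  open import Data.Nat.DivMod using (_/_; _%_; m≡m%n+[m/n]*n; m%n<n; m/n*n≡m)
  open import Data.Nat.Induction using (<-rec)
  open import Data.Nat.Primality using (euclidsLemma; prime⇒irreducible)
  open import Data.Nat.Tactic.RingSolver using (solve-∀)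
  open import Relation.Binary.Definitions using (tri<; tri≈; tri>)
  open FiniteFieldPolynomials

  prime∤factorial : ∀ {p} → Prime p → ∀ n → n ℕ.< p → ¬ p ℕ.∣ n !
  prime∤factorial p-prime zero    _   p∣1 = ¬prime[1] (≡.subst Prime (ℕ.∣1⇒≡1 p∣1) p-prime)
  prime∤factorial p-prime (suc n) n<p p∣n! with euclidsLemma (suc n) (n !) p-prime p∣n!
  ... | inj₁ p∣n = contradiction (ℕ.∣⇒≤ p∣n) (ℕ.<⇒≱ n<p)
  ... | inj₂ h   = prime∤factorial p-prime n (ℕ.<-trans (ℕ.n<1+n n) n<p) h

  prime∤binomial : ∀ {p} → Prime p → ∀ {n k} → k ℕ.≤ n → n ℕ.< p → ¬ p ℕ.∣ n C k
  prime∤binomial {p} p-prime {n} {k} k≤n n<p p∣C = prime∤factorial p-prime n n<p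
    (≡.subst (p ℕ.∣_) C*d≡n! (ℕ.∣m⇒∣m*n (k ! ℕ.* (n ℕ.∸ k) !) p∣C))
    where
    instance _ = k ℕ.!* (n ℕ.∸ k) !≢0
    C*d≡n! : (n C k) ℕ.* (k ! ℕ.* (n ℕ.∸ k) !) ≡ n !
    C*d≡n! = ≡.trans (≡.cong (ℕ._* (k ! ℕ.* (n ℕ.∸ k) !)) (nCk≡n!/k![n-k]! k≤n)) (m/n*n≡m (k![n∸k]!∣n! k≤n))

  odd-prime-pred : ∀ {m} → Prime (suc (suc (m ℕ.+ m))) → m ≡ 0
  odd-prime-pred {m} p-prime with prime⇒irreducible p-prime (ℕ.divides (suc m) (double m))
    where
    double : ∀ m → suc (suc (m ℕ.+ m)) ≡ suc m ℕ.* 2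
    double = solve-∀
  ... | inj₁ ()
  ... | inj₂ 2≡ = ℕ.m+n≡0⇒m≡0 m (≡.sym (ℕ.suc-injective (ℕ.suc-injective 2≡)))

  -- Quotient i and remainder j of q by n. As q = j + i n, the middle bound says j ≤ i (n - 2). With
  -- j ≤ n - 1 and n ≥ 3 this is clear for i ≥ 2; for i = 1 only j = n - 1 could violate it. The
  -- last bound holds because 1 ≤ i and n ≥ 3.
  exponents : ∀ {q} → Prime (suc q) → ∀ n → 3 ℕ.≤ n → n ℕ.≤ q → ∃ λ i → ∃ λ j →
    j ℕ.+ i ℕ.* n ≡ q × (i ℕ.+ j) ℕ.+ (i ℕ.+ j) ℕ.≤ q × i ℕ.+ i ℕ.< q
  exponents {q} p-prime n@(suc (suc (suc k))) (s≤s (s≤s (s≤s _))) n≤q =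
    q / n , q % n , j+in≡q , bound₁ , bound₂
    where
    j+in≡q : q % n ℕ.+ q / n ℕ.* n ≡ q
    j+in≡q = ≡.sym (m≡m%n+[m/n]*n q n)

    remainder-bound : ∀ i j → j ℕ.+ i ℕ.* n ≡ q → j ℕ.< n → 1 ℕ.≤ i × j ℕ.≤ i ℕ.* suc k
    remainder-bound zero          j eq j<n = contradiction (≡.subst (ℕ._< n) (≡.trans (≡.sym (ℕ.+-identityʳ j)) eq) j<n) (ℕ.≤⇒≯ n≤q)
    remainder-bound (suc zero)    j eq (s≤s j≤) with ℕ.m≤n⇒m<n∨m≡n j≤
    ... | inj₁ (s≤s j≤1+k) = s≤s z≤n , ≡.subst (j ℕ.≤_) (≡.sym (ℕ.*-identityˡ (suc k))) j≤1+k
    -- Here i = 1 and j = n - 1, so q = 2n - 1 and the prime p = 2n would be even and greater than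
    -- 2.
    ... | inj₂ ≡.refl = contradiction (odd-prime-pred {suc (suc k)}
            (≡.subst (λ m → Prime (suc m)) (≡.trans (≡.sym eq) (odd k)) p-prime)) λ ()
      where
      odd : ∀ k → suc (suc k) ℕ.+ 1 ℕ.* suc (suc (suc k)) ≡ suc (suc (suc k) ℕ.+ suc (suc k))
      odd = solve-∀
    remainder-bound (suc (suc i)) j eq (s≤s j≤) = s≤s z≤n , ℕ.≤-trans j≤
      (≡.subst (suc (suc k) ℕ.≤_) (expand i k) (ℕ.m≤m+n (suc (suc k)) _))
      where
      expand : ∀ i k → suc (suc k) ℕ.+ (k ℕ.+ i ℕ.* suc k) ≡ suc (suc i) ℕ.* suc k
      expand = solve-∀

    1≤i = proj₁ (remainder-bound (q / n) (q % n) j+in≡q (m%n<n q n))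
    j≤  = proj₂ (remainder-bound (q / n) (q % n) j+in≡q (m%n<n q n))

    bound₁ : (q / n ℕ.+ q % n) ℕ.+ (q / n ℕ.+ q % n) ℕ.≤ q
    bound₁ = ≡.subst₂ ℕ._≤_ (left (q / n) (q % n)) (≡.trans (right (q / n) (q % n) k) j+in≡q)
      (ℕ.+-monoʳ-≤ (q / n ℕ.+ q / n ℕ.+ q % n) j≤)
      where
      left : ∀ i j → i ℕ.+ i ℕ.+ j ℕ.+ j ≡ (i ℕ.+ j) ℕ.+ (i ℕ.+ j)
      left = solve-∀
      right : ∀ i j k → i ℕ.+ i ℕ.+ j ℕ.+ i ℕ.* suc k ≡ j ℕ.+ i ℕ.* suc (suc (suc k))
      right = solve-∀

    bound₂ : q / n ℕ.+ q / n ℕ.< q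
    bound₂ = ≡.subst (q / n ℕ.+ q / n ℕ.<_) (≡.trans (expand (q / n) (q % n) k) j+in≡q)
      (ℕ.m<m+n (q / n ℕ.+ q / n) (ℕ.<-≤-trans 1≤i (ℕ.m≤m+n (q / n) _)))
      where
      expand : ∀ i j k → i ℕ.+ i ℕ.+ (i ℕ.+ (j ℕ.+ i ℕ.* k)) ≡ j ℕ.+ i ℕ.* suc (suc (suc k))
      expand = solve-∀

  module _ (F : PrimeField) where
    open PrimeField F
    open FiniteSums algebra using (ι-suc; sum-0#; sum-snoc)
    open PolynomialFunctions F
    open import Algebra.Properties.Semiring.Sum semiring
      using (sum; sum-cong-≋; sum-remove)
    open import Algebra.Properties.Semiring.Exp semiring using (_^_; ^-congˡ)
    open import Algebra.Properties.CommutativeSemiring.Exp commutativeSemiring using (^-distrib-*)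
    open import Algebra.Properties.Semiring.Mult semiring using () renaming (_×_ to _⋆_)
    open import Algebra.Properties.Ring ring using (-‿distribˡ-*; -0#≈0#; x∙y⁻¹≈ε⇒x≈y)
    import Algebra.Properties.CommutativeSemiring.Binomial commutativeSemiring as Binomial
    open import Relation.Binary.Reasoning.Setoid setoid
    open Solver using (solve; _:+_; _:*_; _:-_; :-_; _:=_)

    sum-single : ∀ n (t : Fin n → Carrier) i → (∀ j → j ≢ i → t j ≈ 0#) → sum t ≈ t i
    sum-single (suc n) t i h = trans (sum-remove {i = i} t)
      (trans (+-congˡ (sum-0# n (λ j → h _ (Fin.punchInᵢ≢i i j)))) (+-identityʳ _))

    ⋆-ι : ∀ n x → n ⋆ x ≈ ι (ℤ.+ n) * x
    ⋆-ι zero    x = sym (trans (*-congʳ 0-homo) (zeroˡ x))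
    ⋆-ι (suc n) x = begin
      x + n ⋆ x                      ≈⟨ +-cong (sym (*-identityˡ x)) (⋆-ι n x) ⟩
      1# * x + ι (ℤ.+ n) * x         ≈⟨ distribʳ x _ _ ⟨
      (1# + ι (ℤ.+ n)) * x           ≈⟨ *-congʳ (ι-suc n) ⟨
      ι (ℤ.+ suc n) * x              ∎

    binomial-theorem : ∀ n x y →
      (x + y) ^ n ≈ sum {suc n} (λ i → ι (ℤ.+ (n C toℕ i)) * (x ^ toℕ i * y ^ (n ℕ.∸ toℕ i)))
    binomial-theorem n x y = trans (Binomial.theorem n x y) (sum-cong-≋ {suc n} (λ i → ⋆-ι (n C toℕ i) (x ^ toℕ i * y ^ (n ℕ.∸ toℕ i))))

    ι-binomial-nonzero : ∀ {n k} → k ℕ.≤ n → n ℕ.≤ q → ¬ ι (ℤ.+ (n C k)) ≈ 0#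
    ι-binomial-nonzero k≤n n≤q h = prime∤binomial p-prime k≤n (s≤s n≤q) (∣⇒∣ᵤ (char h))

    product-nonzero : ∀ {x y} → ¬ x ≈ 0# → x * y ≈ 0# → y ≈ 0#
    product-nonzero {x} {y} x≉0 h with domain x y h
    ... | inj₁ x≈0 = contradiction x≈0 x≉0
    ... | inj₂ y≈0 = y≈0

    neg-nonzero : ∀ {x} → ¬ x ≈ 0# → ¬ - x ≈ 0#
    neg-nonzero {x} x≉0 h = x≉0 (trans (solve 1 (λ x → x := :- (:- x)) refl x) (trans (-‿cong h) -0#≈0#))

    -1≉0 : ¬ - 1# ≈ 0#
    -1≉0 = neg-nonzero 1≉0

    neg-^ : ∀ n x → (- x) ^ n ≈ (- 1#) ^ n * x ^ n
    neg-^ zero    x = sym (*-identityˡ 1#)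
    neg-^ (suc n) x = begin
      - x * (- x) ^ n                          ≈⟨ *-cong (trans (-‿cong (sym (*-identityˡ x))) (-‿distribˡ-* 1# x)) (neg-^ n x) ⟩
      (- 1# * x) * ((- 1#) ^ n * x ^ n)
        ≈⟨ solve 4 (λ o x s t → (o :* x) :* (s :* t) := (o :* s) :* (x :* t)) refl _ _ _ _ ⟩
      (- 1# * (- 1#) ^ n) * (x * x ^ n)        ∎

    Deg<-sum : ∀ m n (φ : Fin n → Carrier → Carrier) → (∀ i → Deg< m (φ i)) → Deg< m (λ x → sum (λ i → φ i x))
    Deg<-sum m zero    φ d = Deg<-0 m
    Deg<-sum m (suc n) φ d = Deg<-+ m (d zero) (Deg<-sum m n (φ ∘ suc) (d ∘ suc))

    -- Lagrange interpolation: by Fermat, 1 - (x - y)^q is 1 for x = y and 0 otherwise. The sum over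
    -- y is translated by x, so that only the term at 0 survives.
    interpolation : ∀ {f} → Congruent f → Deg< (suc q) f
    interpolation {f} f-cong = Deg<-resp (suc q) value
      (Deg<-sum (suc q) (suc q) (λ y x → f (el y) * δ x (el y)) (λ y → Deg<-* (suc q) (f (el y)) (δ-deg (el y))))
      where
      δ : Carrier → Carrier → Carrier
      δ x y = 1# - (x - y) ^ q

      δ-deg : ∀ y → Deg< (suc q) (λ x → δ x y)
      δ-deg y = Deg<-+ (suc q) (Deg<-mono {1} (s≤s z≤n) (Lead-suc {0} (Lead-const 1#)))
        (Deg<-neg (suc q) (Lead-suc {q} (Lead-[x+c]^ q (- y))))

      δ-cong : ∀ {x y z} → y ≈ z → δ x y ≈ δ x z
      δ-cong y≈z = +-congˡ (-‿cong (^-congˡ q (+-congˡ (-‿cong y≈z))))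

      value : ∀ x → sum {suc q} (λ y → f (el y) * δ x (el y)) ≈ f x
      value x = begin
        sum {suc q} (λ y → f (el y) * δ x (el y))  ≈⟨ L-sum-el (λ y → f y * δ x y) ⟨
        L (λ y → f y * δ x y)                      ≈⟨ L-shift {λ y → f y * δ x y} (λ h → *-cong (f-cong h) (δ-cong h)) x ⟨
        L (λ y → f (x + y) * δ x (x + y))
          ≈⟨ L-point {λ y → f (x + y) * δ x (x + y)} (λ h → *-cong (f-cong (+-congˡ h)) (δ-cong (+-congˡ h))) off-diagonal ⟩
        f (x + 0#) * δ x (x + 0#)                  ≈⟨ *-cong (f-cong (+-identityʳ x)) diagonal ⟩
        f x * 1#                                   ≈⟨ *-identityʳ _ ⟩
        f x                                        ∎
        where
        off-diagonal : ∀ y → ¬ y ≈ 0# → f (x + y) * δ x (x + y) ≈ 0#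
        off-diagonal y y≉0 = trans (*-congˡ (trans (+-congˡ (-‿cong (trans
          (^-congˡ q (solve 2 (λ x y → x :- (x :+ y) := :- y) refl x y)) (fermat-unit (neg-nonzero y≉0))))) (-‿inverseʳ 1#))) (zeroʳ _)
        diagonal : δ x (x + 0#) ≈ 1#
        diagonal = trans (+-congˡ (trans (-‿cong (trans (^-congˡ q (trans (+-congˡ (-‿cong (+-identityʳ x))) (-‿inverseʳ x))) (0^suc 1≤q))) -0#≈0#)) (+-identityʳ 1#)

    -- `planar` is weaker than planarity in the usual sense: it also holds when the differences x ↦
    -- f(x + d) - f(x) are constant, since their power sums are then multiples of p. Affine f
    -- therefore pass, and are excluded later by orthogonality over ℂ.
    module _ {f : Carrier → Carrier} (f-cong : Congruent f)
             (planar : ∀ d → ¬ d ≈ 0# → ∀ φ → Deg< q φ → L (λ x → φ (f (x + d) - f x)) ≈ 0#) where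

      g : Carrier → Carrier → Carrier
      g c x = f x - c * x

      g-cong : ∀ c → Congruent (g c)
      g-cong c h = +-cong (f-cong h) (-‿cong (*-congˡ h))

      M : ℕ → Carrier → Carrier
      M j c = L (λ x → g c x ^ j)

      -- The double sum of (g(y) - g(x))^j, written with y = x + d and the sum over d outside, so
      -- that `planar` applies to each d separately.
      T : ℕ → Carrier → Carrier
      T j c = L (λ d → L (λ x → (g c (x + d) - g c x) ^ j))

      difference : ∀ c d x → g c (x + d) - g c x ≈ (f (x + d) - f x) + - (c * d)
      difference c d x = solve 5 (λ s t c d x → (s :- c :* (x :+ d)) :- (t :- c :* x) := (s :- t) :+ :- (c :* d)) refl (f (x + d)) (f x) c d x

      -- `planar` says nothing about d = 0. There the summand is 0^j, which is zero for j > 0, while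
      -- for j = 0 the sum of p ones vanishes.
      degenerate : ∀ j c d → d ≈ 0# → L (λ x → (g c (x + d) - g c x) ^ j) ≈ 0#
      degenerate zero    c d d≈0 = L-1#
      degenerate (suc j) c d d≈0 = L-zero (λ x → trans (^-congˡ (suc j)
        (trans (+-congʳ (g-cong c (trans (+-congˡ d≈0) (+-identityʳ x)))) (-‿inverseʳ _))) (0^suc {suc j} (s≤s z≤n)))

      -- Passing from f to g translates the base of the power by -c d, which does not raise the
      -- degree.
      T-small : ∀ {j} c → j ℕ.< q → T j c ≈ 0#
      T-small {j} c j<q = L-zero inner
        where
        inner : ∀ d → L (λ x → (g c (x + d) - g c x) ^ j) ≈ 0#
        inner d with d ≟ 0#
        ... | yes d≈0 = degenerate j c d d≈0
        ... | no d≉0  = trans (L-cong (λ x → ^-congˡ j (difference c d x)))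
          (planar d d≉0 (λ t → (t + - (c * d)) ^ j) (Deg<-mono j<q (Lead-suc {j} (Lead-[x+c]^ j _))))

      -- The exponent q lies just outside the reach of `planar`, but (t - c d)^q and t^q share their
      -- leading term, so their difference lies inside. Hence c drops out, although the value of the
      -- sum is not determined.
      T-q : ∀ c → T q c ≈ L (λ d → L (λ x → (f (x + d) - f x) ^ q))
      T-q c = L-cong inner
        where
        inner : ∀ d → L (λ x → (g c (x + d) - g c x) ^ q) ≈ L (λ x → (f (x + d) - f x) ^ q)
        inner d with d ≟ 0#
        ... | yes d≈0 = trans (degenerate q c d d≈0) (sym (L-zero (λ x → trans (^-congˡ q
                (trans (+-congʳ (f-cong (trans (+-congˡ d≈0) (+-identityʳ x)))) (-‿inverseʳ _))) (0^suc 1≤q))))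
        ... | no d≉0  = begin
          L (λ x → (g c (x + d) - g c x) ^ q)
            ≈⟨ L-cong (λ x → trans (^-congˡ q (difference c d x)) (solve 2 (λ s t → s := (s :- t) :+ t) refl _ _)) ⟩
          L (λ x → ((f (x + d) - f x + - (c * d)) ^ q - 1# * (f (x + d) - f x) ^ q) + 1# * (f (x + d) - f x) ^ q)
            ≈⟨ L-+ (λ x → (f (x + d) - f x + - (c * d)) ^ q - 1# * (f (x + d) - f x) ^ q) (λ x → 1# * (f (x + d) - f x) ^ q) ⟩
          L (λ x → (f (x + d) - f x + - (c * d)) ^ q - 1# * (f (x + d) - f x) ^ q) + L (λ x → 1# * (f (x + d) - f x) ^ q)
            ≈⟨ +-cong (planar d d≉0 (λ t → (t + - (c * d)) ^ q - 1# * t ^ q) (Lead-[x+c]^ q (- (c * d))))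
                      (L-cong (λ x → *-identityˡ _)) ⟩
          0# + L (λ x → (f (x + d) - f x) ^ q)
            ≈⟨ +-identityˡ _ ⟩
          L (λ x → (f (x + d) - f x) ^ q) ∎

      T-double : ∀ j c → T j c ≈ L (λ x → L (λ y → (g c y + - g c x) ^ j))
      T-double j c = trans (L-comm (λ d x → (g c (x + d) - g c x) ^ j))
        (L-cong (λ x → L-shift {λ y → (g c y + - g c x) ^ j} (λ h → ^-congˡ j (+-congʳ (g-cong c h))) x))

      M⁻ : ℕ → Carrier → Carrier
      M⁻ j c = L (λ x → (- g c x) ^ j)

      M⁻≈ : ∀ j c → M⁻ j c ≈ (- 1#) ^ j * M j c
      M⁻≈ j c = trans (L-cong (λ x → neg-^ j (g c x))) (L-* _ _)

      T-expand : ∀ k c → T k c ≈ sum {suc k} (λ i → ι (ℤ.+ (k C toℕ i)) * (M (toℕ i) c * M⁻ (k ℕ.∸ toℕ i) c))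
      T-expand k c = begin
        T k c
          ≈⟨ T-double k c ⟩
        L (λ x → L (λ y → (g c y + - g c x) ^ k))
          ≈⟨ L-cong (λ x → trans (L-cong (λ y → binomial-theorem k (g c y) (- g c x)))
               (L-∑ (suc k) (λ i y → ι (ℤ.+ (k C toℕ i)) * (g c y ^ toℕ i * (- g c x) ^ (k ℕ.∸ toℕ i))))) ⟩
        L (λ x → sum {suc k} (λ i → L (λ y → ι (ℤ.+ (k C toℕ i)) * (g c y ^ toℕ i * (- g c x) ^ (k ℕ.∸ toℕ i)))))
          ≈⟨ L-∑ (suc k) (λ i x → L (λ y → ι (ℤ.+ (k C toℕ i)) * (g c y ^ toℕ i * (- g c x) ^ (k ℕ.∸ toℕ i)))) ⟩
        sum {suc k} (λ i → L (λ x → L (λ y → ι (ℤ.+ (k C toℕ i)) * (g c y ^ toℕ i * (- g c x) ^ (k ℕ.∸ toℕ i)))))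
          ≈⟨ sum-cong-≋ {suc k} (λ i → trans
               (L-cong (λ x → trans (L-cong (λ y → solve 3 (λ b s t → b :* (s :* t) := (b :* t) :* s) refl _ _ _))
                 (trans (L-* (ι (ℤ.+ (k C toℕ i)) * (- g c x) ^ (k ℕ.∸ toℕ i)) (λ y → g c y ^ toℕ i))
                   (solve 3 (λ b s t → (b :* t) :* s := (b :* s) :* t) refl _ _ _))))
               (trans (L-* (ι (ℤ.+ (k C toℕ i)) * M (toℕ i) c) (λ x → (- g c x) ^ (k ℕ.∸ toℕ i))) (*-assoc _ _ _))) ⟩
        sum {suc k} (λ i → ι (ℤ.+ (k C toℕ i)) * (M (toℕ i) c * M⁻ (k ℕ.∸ toℕ i) c)) ∎

      -- Once the lower moments vanish, only the middle term of the expansion survives.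
      T-middle : ∀ j c → (∀ {i} → i ℕ.< j → M i c ≈ 0#) →
                 T (j ℕ.+ j) c ≈ (ι (ℤ.+ ((j ℕ.+ j) C j)) * (- 1#) ^ j) * (M j c * M j c)
      T-middle j c lower = begin
        T (j ℕ.+ j) c               ≈⟨ T-expand (j ℕ.+ j) c ⟩
        sum {suc (j ℕ.+ j)} term    ≈⟨ sum-single _ term middle others ⟩
        term middle                 ≈⟨ reflexive (≡.cong t toℕ-middle) ⟩
        t j                         ≈⟨ *-congˡ (*-congˡ (trans (reflexive (≡.cong (λ i → M⁻ i c) (ℕ.m+n∸n≡m j j))) (M⁻≈ j c))) ⟩
        ι (ℤ.+ ((j ℕ.+ j) C j)) * (M j c * ((- 1#) ^ j * M j c))
          ≈⟨ solve 3 (λ b m s → b :* (m :* (s :* m)) := (b :* s) :* (m :* m)) refl _ _ _ ⟩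
        (ι (ℤ.+ ((j ℕ.+ j) C j)) * (- 1#) ^ j) * (M j c * M j c) ∎
        where
        t : ℕ → Carrier
        t i = ι (ℤ.+ ((j ℕ.+ j) C i)) * (M i c * M⁻ ((j ℕ.+ j) ℕ.∸ i) c)
        term : Fin (suc (j ℕ.+ j)) → Carrier
        term i = t (toℕ i)
        middle : Fin (suc (j ℕ.+ j))
        middle = fromℕ< (s≤s (ℕ.m≤m+n j j))
        toℕ-middle : toℕ middle ≡ j
        toℕ-middle = Fin.toℕ-fromℕ< _
        others : ∀ i → i ≢ middle → term i ≈ 0#
        others i i≢ with ℕ.<-cmp (toℕ i) j
        ... | tri< i<j _ _ = trans (*-congˡ (trans (*-congʳ (lower i<j)) (zeroˡ _))) (zeroʳ _)
        ... | tri≈ _ i≡j _ = contradiction (Fin.toℕ-injective (≡.trans i≡j (≡.sym toℕ-middle))) i≢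
        ... | tri> _ _ j<i = trans (*-congˡ (trans (*-congˡ (trans (M⁻≈ ((j ℕ.+ j) ℕ.∸ toℕ i) c) (trans (*-congˡ (lower {(j ℕ.+ j) ℕ.∸ toℕ i} 2j-i<j)) (zeroʳ _)))) (zeroʳ _))) (zeroʳ _)
          where
          2j-i<j : (j ℕ.+ j) ℕ.∸ toℕ i ℕ.< j
          2j-i<j = ℕ.+-cancelʳ-< (toℕ i) _ j (≡.subst (ℕ._< j ℕ.+ toℕ i) (≡.sym (ℕ.m∸n+n≡m (ℕ.≤-pred (Fin.toℕ<n i)))) (ℕ.+-monoʳ-< j j<i))

      middle-nonzero : ∀ {j} → j ℕ.+ j ℕ.≤ q → ¬ ι (ℤ.+ ((j ℕ.+ j) C j)) * (- 1#) ^ j ≈ 0#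
      middle-nonzero {j} 2j≤q h with domain _ _ h
      ... | inj₁ C≈0 = ι-binomial-nonzero (ℕ.m≤m+n j j) 2j≤q C≈0
      ... | inj₂ s≈0 = -1≉0 (^-nonzero j s≈0)

      double-< : ∀ {i j} → i ℕ.< j → i ℕ.+ i ℕ.< j ℕ.+ j
      double-< i<j = ℕ.+-mono-< i<j i<j

      -- For 2j < q the sum `T` vanishes, and its middle coefficient C(2j, j) (-1)^j is nonzero
      -- because 2j < p. So M_j² = 0.
      M-vanish : ∀ c j → j ℕ.+ j ℕ.< q → M j c ≈ 0#
      M-vanish c = <-rec _ λ j rec 2j<q → [ (λ h → h) , (λ h → h) ]′ (domain _ _ (product-nonzero (middle-nonzero {j} (ℕ.<⇒≤ 2j<q))
        (trans (sym (T-middle j c (λ {i} i<j → rec {i} i<j (ℕ.<-trans (double-< i<j) 2j<q)))) (T-small c 2j<q))))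

      M²-constant : ∀ j → j ℕ.+ j ℕ.≤ q → ∀ c → M j c * M j c ≈ M j 0# * M j 0#
      M²-constant j 2j≤q c = x∙y⁻¹≈ε⇒x≈y _ _ (product-nonzero (middle-nonzero {j} 2j≤q) (begin
        m * (M j c * M j c - M j 0# * M j 0#)
          ≈⟨ solve 3 (λ m s t → m :* (s :- t) := m :* s :- m :* t) refl _ _ _ ⟩
        m * (M j c * M j c) - m * (M j 0# * M j 0#)
          ≈⟨ +-cong (sym (T-middle j c (λ {i} i<j → M-vanish c i (lower i<j)))) (-‿cong (sym (T-middle j 0# (λ {i} i<j → M-vanish 0# i (lower i<j))))) ⟩
        T (j ℕ.+ j) c - T (j ℕ.+ j) 0#
          ≈⟨ trans (+-congʳ T-constant) (-‿inverseʳ _) ⟩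
        0# ∎))
        where
        m = ι (ℤ.+ ((j ℕ.+ j) C j)) * (- 1#) ^ j
        lower : ∀ {i} → i ℕ.< j → i ℕ.+ i ℕ.< q
        lower i<j = ℕ.<-≤-trans (double-< i<j) 2j≤q
        T-constant : T (j ℕ.+ j) c ≈ T (j ℕ.+ j) 0#
        T-constant with ℕ.m≤n⇒m<n∨m≡n 2j≤q
        ... | inj₁ 2j<q = trans (T-small c 2j<q) (sym (T-small 0# 2j<q))
        ... | inj₂ 2j≡q = ≡.subst (λ k → T k c ≈ T k 0#) (≡.sym 2j≡q) (trans (T-q c) (sym (T-q 0#)))

      polynomial : ℕ → (ℕ → Carrier) → Carrier → Carrier
      polynomial n a c = sum {n} (λ i → a (toℕ i) * c ^ toℕ i)

      polynomial-suc : ∀ n a c → polynomial (suc n) a c ≈ polynomial n a c + a n * c ^ n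
      polynomial-suc n a c = sum-snoc n (λ i → a i * c ^ i)

      Deg<-polynomial : ∀ n a → Deg< n (polynomial n a)
      Deg<-polynomial zero    a = λ _ → refl
      Deg<-polynomial (suc n) a = a n , Deg<-resp n
        (λ c → sym (trans (+-congʳ (polynomial-suc n a c)) (solve 2 (λ s t → (s :+ t) :- t := s) refl _ _))) (Deg<-polynomial n a)

      -- The coefficient of c^(2n) in the square is the square of the top coefficient. As 2n ≤ q,
      -- `Lead-vanishing` forces it to be zero, after which the next coefficient is on top.
      square-constant : ∀ n a K → n ℕ.+ n ℕ.≤ q →
        (∀ c → polynomial (suc n) a c * polynomial (suc n) a c ≈ K) → ∀ i → 1 ℕ.≤ i → i ℕ.≤ n → a i ≈ 0#
      square-constant zero    a K _    _        (suc i) _   ()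
      square-constant (suc n) a K 2n≤q constant i       1≤i i≤n = cases (ℕ.m≤n⇒m<n∨m≡n i≤n)
        where
        φ = polynomial (suc (suc n)) a
        top² : a (suc n) * a (suc n) ≈ 0#
        top² = Lead-vanishing {suc n ℕ.+ suc n} {φ = λ c → φ c * φ c - K} 2n≤q
          (Lead-+ (suc n ℕ.+ suc n) (Lead-· (suc n) (suc n) lead lead)
            (Deg<-mono {1} {suc n ℕ.+ suc n} (s≤s z≤n) (Lead-suc {0} (Lead-const (- K)))))
          (λ c → trans (+-congʳ (constant c)) (-‿inverseʳ K))
          where
          lead : Lead (suc n) (a (suc n)) φ
          lead = proj₂ (Deg<-polynomial (suc (suc n)) a)
        top : a (suc n) ≈ 0#
        top = [ (λ h → h) , (λ h → h) ]′ (domain _ _ top²)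
        shorter : ∀ c → φ c ≈ polynomial (suc n) a c
        shorter c = trans (polynomial-suc (suc n) a c) (trans (+-congˡ (trans (*-congʳ top) (zeroˡ _))) (+-identityʳ _))
        cases : _ → a i ≈ 0#
        cases (inj₂ i≡n)       = trans (reflexive (≡.cong a i≡n)) top
        cases (inj₁ (s≤s i≤n)) = square-constant n a K (ℕ.≤-trans (ℕ.+-mono-≤ (ℕ.n≤1+n n) (ℕ.n≤1+n n)) 2n≤q)
          (λ c → trans (*-cong (sym (shorter c)) (sym (shorter c))) (constant c)) i 1≤i i≤n

      -- Up to the factor C(j, i), the coefficient of c^i in M_j(c), because g = f - c x.
      moment : ℕ → ℕ → Carrier
      moment j i = L (λ x → (- x) ^ i * f x ^ (j ℕ.∸ i))

      M-polynomial : ∀ j c → M j c ≈ polynomial (suc j) (λ i → ι (ℤ.+ (j C i)) * moment j i) c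
      M-polynomial j c = begin
        M j c
          ≈⟨ L-cong (λ x → trans (^-congˡ j (+-comm _ _)) (binomial-theorem j (- (c * x)) (f x))) ⟩
        L (λ x → sum {suc j} (λ i → ι (ℤ.+ (j C toℕ i)) * ((- (c * x)) ^ toℕ i * f x ^ (j ℕ.∸ toℕ i))))
          ≈⟨ L-∑ (suc j) (λ i x → ι (ℤ.+ (j C toℕ i)) * ((- (c * x)) ^ toℕ i * f x ^ (j ℕ.∸ toℕ i))) ⟩
        sum {suc j} (λ i → L (λ x → ι (ℤ.+ (j C toℕ i)) * ((- (c * x)) ^ toℕ i * f x ^ (j ℕ.∸ toℕ i))))
          ≈⟨ sum-cong-≋ {suc j} (λ i → trans
               (L-cong (λ x → trans (*-congˡ (*-congʳ (trans (^-congˡ (toℕ i) (solve 2 (λ c x → :- (c :* x) := c :* (:- x)) refl c x)) (^-distrib-* c (- x) (toℕ i)))))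
                 (solve 4 (λ b s t u → b :* ((s :* t) :* u) := (b :* s) :* (t :* u)) refl _ _ _ _)))
               (trans (L-* (ι (ℤ.+ (j C toℕ i)) * c ^ toℕ i) (λ x → (- x) ^ toℕ i * f x ^ (j ℕ.∸ toℕ i)))
                 (solve 3 (λ b s m → (b :* s) :* m := (b :* m) :* s) refl _ _ _))) ⟩
        polynomial (suc j) (λ i → ι (ℤ.+ (j C i)) * moment j i) c ∎

      moment-vanish : ∀ {j i} → j ℕ.+ j ℕ.≤ q → 1 ℕ.≤ i → i ℕ.≤ j → moment j i ≈ 0#
      moment-vanish {j} {i} 2j≤q 1≤i i≤j = product-nonzero (ι-binomial-nonzero i≤j (ℕ.≤-trans (ℕ.m≤m+n j j) 2j≤q))
        (square-constant j (λ i → ι (ℤ.+ (j C i)) * moment j i) _ 2j≤q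
          (λ c → trans (*-cong (sym (M-polynomial j c)) (sym (M-polynomial j c))) (M²-constant j 2j≤q c)) i 1≤i i≤j)

      power-vanish : ∀ {j} → j ℕ.+ j ℕ.< q → moment j 0 ≈ 0#
      power-vanish {j} 2j<q = trans (L-cong (λ x → trans (*-identityˡ _) (^-congˡ j
        (sym (trans (+-congˡ (trans (-‿cong (zeroˡ x)) -0#≈0#)) (+-identityʳ _)))))) (M-vanish 0# j 2j<q)

      -- For j > 0 this is a nonconstant coefficient of M_(i+j). For j = 0 it is a constant
      -- coefficient, about which constancy of the polynomial says nothing; there the strict bound
      -- 2i < q makes the moment itself vanish.
      monomial-vanish : ∀ i j → 2 ℕ.≤ q → (i ℕ.+ j) ℕ.+ (i ℕ.+ j) ℕ.≤ q → i ℕ.+ i ℕ.< q →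
                        L (λ x → (- x) ^ j * f x ^ i) ≈ 0#
      monomial-vanish i zero    2≤q h 2i<q = power-vanish {i} 2i<q
      monomial-vanish i (suc j) 2≤q h _    = ≡.subst (λ k → L (λ x → (- x) ^ suc j * f x ^ k) ≈ 0#) (ℕ.m+n∸n≡m i (suc j))
        (moment-vanish {i ℕ.+ suc j} h (s≤s z≤n) (ℕ.m≤n+m (suc j) i))

      Lead-neg : Lead 1 (- 1#) (λ x → - x)
      Lead-neg = Lead-resp 1 (*-identityʳ _) (λ x → trans (sym (-‿distribˡ-* 1# x)) (-‿cong (*-identityˡ x))) (Lead-· 0 1 (Lead-const (- 1#)) Lead-x)

      lead-vanish : ∀ n {a} → 3 ℕ.≤ n → n ℕ.≤ q → Lead n a f → a ≈ 0#
      lead-vanish n {a} 3≤n n≤q lead with exponents p-prime n 3≤n n≤q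
      ... | i , j , j+in≡q , 2[i+j]≤q , 2i<q = ^-nonzero i (product-nonzero (λ h → -1≉0 (^-nonzero j h))
        (L-Lead (≡.subst (λ k → Lead k ((- 1#) ^ j * a ^ i) (λ x → (- x) ^ j * f x ^ i)) (≡.trans (≡.cong (ℕ._+ i ℕ.* n) (ℕ.*-identityʳ j)) j+in≡q)
            (Lead-· (j ℕ.* 1) (i ℕ.* n) (Lead-^ j Lead-neg) (Lead-^ i lead)))
          (monomial-vanish i j (ℕ.≤-trans (s≤s (s≤s z≤n)) (ℕ.≤-trans 3≤n n≤q)) 2[i+j]≤q 2i<q)))

      descend : ∀ k → k ℕ.+ 3 ℕ.≤ suc q → Deg< (k ℕ.+ 3) f → Deg< 3 f
      descend zero    _ d = d
      descend (suc k) (s≤s k≤q) (a , d) = descend k (ℕ.m≤n⇒m≤1+n k≤q) (Deg<-resp (k ℕ.+ 3)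
        (λ x → trans (+-congˡ (trans (-‿cong (trans (*-congʳ a≈0) (zeroˡ _))) -0#≈0#)) (+-identityʳ _)) d)
        where
        a≈0 : a ≈ 0#
        a≈0 = lead-vanish (k ℕ.+ 3) (ℕ.m≤n+m 3 k) k≤q d

      quadratic-degree : Deg< 3 f
      quadratic-degree with 3 ℕ.≤? suc q
      ... | yes 3≤p = descend (suc q ℕ.∸ 3) (ℕ.≤-reflexive (ℕ.m∸n+n≡m 3≤p)) (Deg<-≡ f (≡.sym (ℕ.m∸n+n≡m 3≤p)) (interpolation f-cong))
      -- For p = 2 interpolation alone bounds the degree.
      ... | no 3≰p  = Deg<-mono (ℕ.<⇒≤ (ℕ.≰⇒> 3≰p)) (interpolation f-cong)

      quadratic : ∃ λ a → ∃ λ b → ∃ λ c → ∀ x → f x ≈ a * (x * x) + b * x + c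
      quadratic with quadratic-degree
      ... | a , b , c , h = a , b , c , λ x → begin
        f x
          ≈⟨ solve 4 (λ f s t u → f := ((f :- s) :- t) :- u :+ (s :+ t :+ u)) refl (f x) (a * x ^ 2) (b * x ^ 1) (c * x ^ 0) ⟩
        (((f x - a * x ^ 2) - b * x ^ 1) - c * x ^ 0) + (a * x ^ 2 + b * x ^ 1 + c * x ^ 0)
          ≈⟨ trans (+-congʳ (h x)) (+-identityˡ _) ⟩
        a * x ^ 2 + b * x ^ 1 + c * x ^ 0
          ≈⟨ +-cong (+-cong (*-congˡ (*-congˡ (*-identityʳ x))) (*-congˡ (*-identityʳ x))) (*-identityʳ c) ⟩
        a * (x * x) + b * x + c ∎

-- The integers modulo p.

module IntegersModulo where
  open import Algebra.Bundles using (CommutativeRing)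
  open import Data.Integer.Base using (+_; _+_; _*_; _-_; -_)
  open import Data.Integer.Divisibility.Signed
  open import Data.Integer.DivMod using (_%ℕ_; _/ℕ_; a≡a%ℕn+[a/ℕn]*n)
  open import Data.Integer.Tactic.RingSolver using (solve-∀)
  open import Data.Sum.Base using (map)
  open import Level using (0ℓ)
  open FiniteFieldPolynomials
  open IntegerEuclid

  module _ (p : ℕ) where
    infix 4 _≡ₚ_
    -- Residues are integers with congruence as equality, so exponents of w need no reduction and
    -- identities in ℤ carry over directly.
    _≡ₚ_ : ℤ → ℤ → Set
    x ≡ₚ y = + p ∣ x - y

    private
      via : ∀ {m n} → m ≡ n → + p ∣ m → + p ∣ n
      via = ≡.subst (+ p ∣_)

    ≡⇒≡ₚ : ∀ {x y} → x ≡ y → x ≡ₚ y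
    ≡⇒≡ₚ {x} ≡.refl = divides (+ 0) (ℤ.+-inverseʳ x)

    ≡ₚ-sym : ∀ {x y} → x ≡ₚ y → y ≡ₚ x
    ≡ₚ-sym {x} {y} h = via (lemma x y) (∣m⇒∣-m h)
      where
      lemma : ∀ x y → - (x - y) ≡ y - x
      lemma = solve-∀

    ≡ₚ-trans : ∀ {x y z} → x ≡ₚ y → y ≡ₚ z → x ≡ₚ z
    ≡ₚ-trans {x} {y} {z} h g = via (lemma x y z) (∣m∣n⇒∣m+n h g)
      where
      lemma : ∀ x y z → (x - y) + (y - z) ≡ x - z
      lemma = solve-∀

    ≡ₚ-+ : ∀ {x y u v} → x ≡ₚ y → u ≡ₚ v → x + u ≡ₚ y + v
    ≡ₚ-+ {x} {y} {u} {v} h g = via (lemma x y u v) (∣m∣n⇒∣m+n h g)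
      where
      lemma : ∀ x y u v → (x - y) + (u - v) ≡ (x + u) - (y + v)
      lemma = solve-∀

    ≡ₚ-* : ∀ {x y u v} → x ≡ₚ y → u ≡ₚ v → x * u ≡ₚ y * v
    ≡ₚ-* {x} {y} {u} {v} h g = via (lemma x y u v) (∣m∣n⇒∣m+n (∣m⇒∣m*n u h) (∣n⇒∣m*n y g))
      where
      lemma : ∀ x y u v → (x - y) * u + y * (u - v) ≡ x * u - y * v
      lemma = solve-∀

    ≡ₚ-neg : ∀ {x y} → x ≡ₚ y → - x ≡ₚ - y
    ≡ₚ-neg {x} {y} h = via (lemma x y) (∣m⇒∣-m h)
      where
      lemma : ∀ x y → - (x - y) ≡ - x - - y
      lemma = solve-∀

    commutativeRing : CommutativeRing 0ℓ 0ℓ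
    commutativeRing = record
      { _≈_ = _≡ₚ_
      ; _+_ = _+_
      ; _*_ = _*_
      ; -_  = -_
      ; 0#  = + 0
      ; 1#  = + 1
      ; isCommutativeRing = record
        { isRing = record
          { +-isAbelianGroup = record
            { isGroup = record
              { isMonoid = record
                { isSemigroup = record
                  { isMagma = record
                    { isEquivalence = record { refl = λ {x} → ≡⇒≡ₚ {x} ≡.refl ; sym = λ {x} {y} → ≡ₚ-sym {x} {y} ; trans = λ {x} {y} {z} → ≡ₚ-trans {x} {y} {z} }
                    ; ∙-cong = λ {x} {y} {u} {v} → ≡ₚ-+ {x} {y} {u} {v}
                    }
                  ; assoc = λ x y z → ≡⇒≡ₚ (ℤ.+-assoc x y z)
                  }
                ; identity = (λ x → ≡⇒≡ₚ (ℤ.+-identityˡ x)) , (λ x → ≡⇒≡ₚ (ℤ.+-identityʳ x))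
                }
              ; inverse = (λ x → ≡⇒≡ₚ (ℤ.+-inverseˡ x)) , (λ x → ≡⇒≡ₚ (ℤ.+-inverseʳ x))
              ; ⁻¹-cong = λ {x} {y} → ≡ₚ-neg {x} {y}
              }
            ; comm = λ x y → ≡⇒≡ₚ (ℤ.+-comm x y)
            }
          ; *-cong = λ {x} {y} {u} {v} → ≡ₚ-* {x} {y} {u} {v}
          ; *-assoc = λ x y z → ≡⇒≡ₚ (ℤ.*-assoc x y z)
          ; *-identity = (λ x → ≡⇒≡ₚ (ℤ.*-identityˡ x)) , (λ x → ≡⇒≡ₚ (ℤ.*-identityʳ x))
          ; distrib = (λ x y z → ≡⇒≡ₚ (ℤ.*-distribˡ-+ x y z)) , (λ x y z → ≡⇒≡ₚ (ℤ.*-distribʳ-+ x y z))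
          }
        ; *-comm = λ x y → ≡⇒≡ₚ (ℤ.*-comm x y)
        }
      }

    algebra : ℤ-Algebra
    algebra = record
      { commutativeRing = commutativeRing
      ; ι      = λ n → n
      ; +-homo = λ m n → ≡⇒≡ₚ {m + n} ≡.refl
      ; *-homo = λ m n → ≡⇒≡ₚ {m * n} ≡.refl
      ; -‿homo = λ m → ≡⇒≡ₚ { - m} ≡.refl
      ; 0-homo = ≡⇒≡ₚ {+ 0} ≡.refl
      ; 1-homo = ≡⇒≡ₚ {+ 1} ≡.refl
      }

    ≡ₚ0⇒∣ : ∀ {n} → n ≡ₚ + 0 → + p ∣ n
    ≡ₚ0⇒∣ {n} = via (ℤ.+-identityʳ n)

    ∣⇒≡ₚ0 : ∀ {n} → + p ∣ n → n ≡ₚ + 0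
    ∣⇒≡ₚ0 {n} = via (≡.sym (ℤ.+-identityʳ n))

    residue : ∀ .{{_ : ℕ.NonZero p}} z → z ≡ₚ + (z %ℕ p)
    residue z = divides (z /ℕ p) (≡.trans (≡.cong (_- + (z %ℕ p)) (a≡a%ℕn+[a/ℕn]*n z p)) (lemma (+ (z %ℕ p)) _))
      where
      lemma : ∀ r t → (r + t) - r ≡ t
      lemma = solve-∀

  primeField : ∀ q → Prime (suc q) → PrimeField
  primeField q p-prime = record
    { algebra    = algebra (suc q)
    ; q          = q
    ; p-prime    = p-prime
    ; _≟_        = λ x y → + suc q ∣? (x - y)
    ; domain     = λ x y h → map (∣⇒≡ₚ0 (suc q)) (∣⇒≡ₚ0 (suc q)) (euclid p-prime x y (≡ₚ0⇒∣ (suc q) h))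
    ; char       = ≡ₚ0⇒∣ (suc q)
    ; ι-p        = ∣⇒≡ₚ0 (suc q) ∣-refl
    ; surjective = λ x → x %ℕ suc q , residue (suc q) x
    }

-- From binomial sums to power sums.

module PowerSumsOfExponents where
  open import Data.Integer.Divisibility.Signed using (_∣_; divides)
  open import Data.Nat.Combinatorics using (_C_; nCk+nC[k+1]≡[n+1]C[k+1])
  open import Data.Nat.Tactic.RingSolver using (solve-∀)
  open FiniteFieldPolynomials
  open BinomialDivisibility
  open import Algebra.Properties.CommutativeMonoid.Sum ℤ.+-0-commutativeMonoid using () renaming (sum to sumℤ)

  -- The rule (k + 1) C(e, k + 1) = (e - k) C(e, k), freed of subtraction. It makes falling
  -- factorials follow the binomial coefficients step by step.
  pascal-step : ∀ e k → suc k ℕ.* (e C suc k) ℕ.+ k ℕ.* (e C k) ≡ e ℕ.* (e C k)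
  pascal-step zero    zero    = ≡.refl
  pascal-step zero    (suc k) = ≡.cong₂ ℕ._+_ (ℕ.*-zeroʳ (suc (suc k))) (ℕ.*-zeroʳ (suc k))
  pascal-step (suc n) zero    = ≡.trans (ℕ.+-identityʳ _) (absorption n 0)
  pascal-step (suc n) (suc k) = begin
    suc (suc k) ℕ.* (suc n C suc (suc k)) ℕ.+ suc k ℕ.* (suc n C suc k)
      ≡⟨ ≡.cong₂ ℕ._+_ (absorption n (suc k)) (absorption n k) ⟩
    suc n ℕ.* (n C suc k) ℕ.+ suc n ℕ.* (n C k)
      ≡⟨ factor (suc n) (n C suc k) (n C k) ⟩
    suc n ℕ.* ((n C k) ℕ.+ (n C suc k))
      ≡⟨ ≡.cong (suc n ℕ.*_) (nCk+nC[k+1]≡[n+1]C[k+1] n k) ⟩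
    suc n ℕ.* (suc n C suc k) ∎
    where
    open ≡.≡-Reasoning
    factor : ∀ a x y → a ℕ.* x ℕ.+ a ℕ.* y ≡ a ℕ.* (y ℕ.+ x)
    factor = solve-∀

  module _ (F : PrimeField) where
    open PrimeField F
    open FiniteSums algebra using (sum-0#)
    open PolynomialFunctions F
    open import Algebra.Properties.Semiring.Sum semiring using (sum; sum-cong-≋; ∑-distrib-+; *-distribˡ-sum)
    open import Algebra.Properties.Semiring.Exp semiring using (_^_)
    open import Relation.Binary.Reasoning.Setoid setoid
    open Solver using (solve; con; _:+_; _:*_; _:-_; :-_; _:=_)

    falling : ℕ → Carrier → Carrier
    falling zero    x = 1#
    falling (suc k) x = falling k x * (x - ι (ℤ.+ k))

    Lead-falling : ∀ k → Lead k 1# (falling k)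
    Lead-falling zero    = Lead-const 1#
    Lead-falling (suc k) = ≡.subst (λ n → Lead n 1# (falling (suc k))) (ℕ.+-comm k 1)
      (Lead-resp (k ℕ.+ 1) (*-identityˡ 1#) (λ _ → refl) (Lead-· k 1 (Lead-falling k) (Lead-x+ (- ι (ℤ.+ k)))))

    ι-* : ∀ m n → ι (ℤ.+ (m ℕ.* n)) ≈ ι (ℤ.+ m) * ι (ℤ.+ n)
    ι-* m n = trans (reflexive (≡.cong ι (ℤ.pos-* m n))) (*-homo (ℤ.+ m) (ℤ.+ n))

    falling-binomial : ∀ k e → falling k (ι (ℤ.+ e)) ≈ ι (ℤ.+ (k !)) * ι (ℤ.+ (e C k))
    falling-binomial zero    e = sym (trans (*-congˡ 1-homo) (trans (*-identityʳ _) 1-homo))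
    falling-binomial (suc k) e = begin
      falling k (ι (ℤ.+ e)) * (ι (ℤ.+ e) - ι (ℤ.+ k))
        ≈⟨ *-congʳ (falling-binomial k e) ⟩
      (ι (ℤ.+ (k !)) * c) * (ι (ℤ.+ e) - ι (ℤ.+ k))
        ≈⟨ solve 4 (λ f c e k → (f :* c) :* (e :- k) := f :* (e :* c :- k :* c)) refl _ _ _ _ ⟩
      ι (ℤ.+ (k !)) * (ι (ℤ.+ e) * c - ι (ℤ.+ k) * c)
        ≈⟨ *-congˡ (+-congʳ step) ⟨
      ι (ℤ.+ (k !)) * ((ι (ℤ.+ suc k) * c′ + ι (ℤ.+ k) * c) - ι (ℤ.+ k) * c)
        ≈⟨ solve 4 (λ f s c t → f :* ((s :* c :+ t) :- t) := (s :* f) :* c) refl _ _ _ _ ⟩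
      (ι (ℤ.+ suc k) * ι (ℤ.+ (k !))) * c′
        ≈⟨ *-congʳ (ι-* (suc k) (k !)) ⟨
      ι (ℤ.+ (suc k !)) * c′ ∎
      where
      c  = ι (ℤ.+ (e C k))
      c′ = ι (ℤ.+ (e C suc k))
      step : ι (ℤ.+ suc k) * c′ + ι (ℤ.+ k) * c ≈ ι (ℤ.+ e) * c
      step = begin
        ι (ℤ.+ suc k) * c′ + ι (ℤ.+ k) * c
          ≈⟨ +-cong (ι-* (suc k) (e C suc k)) (ι-* k (e C k)) ⟨
        ι (ℤ.+ (suc k ℕ.* (e C suc k))) + ι (ℤ.+ (k ℕ.* (e C k)))
          ≈⟨ +-homo _ _ ⟨
        ι (ℤ.+ (suc k ℕ.* (e C suc k) ℕ.+ k ℕ.* (e C k)))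
          ≈⟨ reflexive (≡.cong (λ n → ι (ℤ.+ n)) (pascal-step e k)) ⟩
        ι (ℤ.+ (e ℕ.* (e C k)))
          ≈⟨ ι-* e (e C k) ⟩
        ι (ℤ.+ e) * c ∎

    ι-sum : ∀ n (t : Fin n → ℤ) → ι (sumℤ t) ≈ sum (λ i → ι (t i))
    ι-sum zero    t = 0-homo
    ι-sum (suc n) t = trans (+-homo (t zero) _) (+-congˡ (ι-sum n (t ∘ suc)))

    ι-multiple : ∀ {n} → ℤ.+ suc q ∣ n → ι n ≈ 0#
    ι-multiple (divides s ≡.refl) = trans (*-homo s _) (trans (*-congˡ ι-p) (zeroʳ _))

    -- The leading term is removed with a falling factorial in place of a power: `falling m` at e is
    -- m! C(e, m), whose sum is a multiple of p, and it differs from t^m only in lower degree.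
    sum-Deg< : ∀ {n} (e : Fin n → ℕ) → (∀ {k} → k ℕ.< q → ℤ.+ suc q ∣ sumℤ (λ x → ℤ.+ (e x C k))) →
               ∀ m {φ} → m ℕ.≤ q → Deg< m φ → sum (λ x → φ (ι (ℤ.+ e x))) ≈ 0#
    sum-Deg< {n} e p∣ zero    m≤q d = sum-0# n (λ x → d _)
    sum-Deg< {n} e p∣ (suc m) {φ} m<q (c , d) = begin
      sum (λ x → φ (ι (ℤ.+ e x)))
        ≈⟨ sum-cong-≋ {n} (λ x → solve 2 (λ f t → f := t :+ (f :- t)) refl (φ (ι (ℤ.+ e x))) (c * falling m (ι (ℤ.+ e x)))) ⟩
      sum (λ x → c * falling m (ι (ℤ.+ e x)) + (φ (ι (ℤ.+ e x)) - c * falling m (ι (ℤ.+ e x))))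
        ≈⟨ ∑-distrib-+ {n} _ _ ⟩
      sum (λ x → c * falling m (ι (ℤ.+ e x))) + sum (λ x → φ (ι (ℤ.+ e x)) - c * falling m (ι (ℤ.+ e x)))
        ≈⟨ +-cong binomial-part (sum-Deg< e p∣ m {λ t → φ t - c * falling m t} (ℕ.<⇒≤ m<q) lower) ⟩
      0# + 0#
        ≈⟨ +-identityˡ _ ⟩
      0# ∎
      where
      lower : Deg< m (λ t → φ t - c * falling m t)
      lower = Deg<-resp m (λ t → solve 4 (λ f c x g → (f :- c :* x) :+ (:- (c :* (g :- con (ℤ.+ 1) :* x))) := f :- c :* g) refl (φ t) c (t ^ m) (falling m t))
        (Deg<-+ m d (Deg<-neg m (Deg<-* m c (Deg<-resp m (λ t → +-congˡ (-‿cong (*-congʳ (sym 1-homo)))) (Lead-falling m)))))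
      binomial-part : sum (λ x → c * falling m (ι (ℤ.+ e x))) ≈ 0#
      binomial-part = begin
        sum (λ x → c * falling m (ι (ℤ.+ e x)))
          ≈⟨ sum-cong-≋ {n} (λ x → trans (*-congˡ (falling-binomial m (e x))) (sym (*-assoc _ _ _))) ⟩
        sum (λ x → (c * ι (ℤ.+ (m !))) * ι (ℤ.+ (e x C m)))
          ≈⟨ *-distribˡ-sum {n} _ _ ⟨
        (c * ι (ℤ.+ (m !))) * sum (λ x → ι (ℤ.+ (e x C m)))
          ≈⟨ *-congˡ (trans (sym (ι-sum n _)) (ι-multiple (p∣ m<q))) ⟩
        (c * ι (ℤ.+ (m !))) * 0#
          ≈⟨ zeroʳ _ ⟩
        0# ∎

-- Roots of unity of prime order in characteristic zero.

module RootsOfUnity where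
  open import Data.Integer.Divisibility.Signed using (_∣_; divides; ∣⇒∣ᵤ)
  open import Data.Integer.DivMod using (_%ℕ_)
  import Data.Nat.Divisibility as ℕ
  open import Data.Sum.Base using (fromInj₂; swap; map₂)
  open FiniteFieldPolynomials
  open IntegersModulo

  -- `dichotomy` is the amount of decidability that ℂ can offer: vanishing is undecidable in
  -- general, but the solutions 0 and n of x² = n x are kept apart. It stands in for the absence of
  -- zero divisors.
  record CharacteristicZero (A : ℤ-Algebra) : Set where
    open ℤ-Algebra A
    field
      torsion-free : ∀ n x → n ≢ ℤ.+ 0 → ι n * x ≈ 0# → x ≈ 0#
      1≉0          : ¬ 1# ≈ 0#
      dichotomy    : ∀ n x → n ≢ ℤ.+ 0 → x * x ≈ ι n * x → x ≈ 0# ⊎ x ≈ ι n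

  -- Every index yields one of the two alternatives, so the search ends although neither property by
  -- itself is assumed decidable.
  search : ∀ {n} {P Q : Fin n → Set} → (∀ i → P i ⊎ Q i) → ∃ P ⊎ (∀ i → Q i)
  search {zero}  h = inj₂ λ ()
  search {suc n} h with h zero | search (h ∘ suc)
  ... | inj₁ p | _            = inj₁ (zero , p)
  ... | inj₂ q | inj₁ (i , p) = inj₁ (suc i , p)
  ... | inj₂ q | inj₂ qs      = inj₂ λ { zero → q ; (suc i) → qs i }

  module UnityDichotomy (A : ℤ-Algebra) (char0 : CharacteristicZero A) (q : ℕ) (p-prime : Prime (suc q)) where
    open ℤ-Algebra A
    open FiniteSums A
    open CharacteristicZero char0
    open import Algebra.Properties.Semiring.Sum semiring
      using (sum; sum-cong-≋; sum-replicate-zero; *-distribˡ-sum; *-distribʳ-sum; ∑-comm)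
    open import Algebra.Properties.Semiring.Exp semiring using (_^_; ^-congˡ; ^-homo-*; ^-assocʳ)
    open import Algebra.Properties.CommutativeSemiring.Exp commutativeSemiring using (^-distrib-*)
    open import Algebra.Properties.Ring ring using (x∙y⁻¹≈ε⇒x≈y)
    open import Relation.Binary.Reasoning.Setoid setoid
    open Solver using (solve; con; _:+_; _:*_; _:-_; :-_; _:=_)

    p : ℤ
    p = ℤ.+ suc q

    p≢0 : p ≢ ℤ.+ 0
    p≢0 ()

    one-^ : ∀ n {x} → x ≈ 1# → x ^ n ≈ 1#
    one-^ zero    h = refl
    one-^ (suc n) h = trans (*-cong h (one-^ n h)) (*-identityˡ 1#)

    fixed-^ : ∀ {x y} → x * y ≈ y → ∀ n → x ^ n * y ≈ y
    fixed-^ {x} {y} h zero    = *-identityˡ y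
    fixed-^ {x} {y} h (suc n) = trans (*-assoc _ _ _) (trans (*-congˡ (fixed-^ h n)) h)

    Φ : Carrier → Carrier
    Φ x = sum {suc q} (λ i → x ^ toℕ i)

    fixed-Φ : ∀ {x y} → x * y ≈ y → Φ x * y ≈ ι p * y
    fixed-Φ {x} {y} h = begin
      Φ x * y                              ≈⟨ *-distribʳ-sum {suc q} y (λ i → x ^ toℕ i) ⟩
      sum {suc q} (λ i → x ^ toℕ i * y)    ≈⟨ sum-cong-≋ {suc q} {y = λ _ → y} (λ i → fixed-^ h (toℕ i)) ⟩
      sum {suc q} (λ _ → y)                ≈⟨ sum-constant (suc q) y ⟩
      ι p * y                              ∎

    -- Multiplication by x moves each power to the next one, and x^p = 1 closes the cycle.
    *-Φ : ∀ {x} → x ^ suc q ≈ 1# → x * Φ x ≈ Φ x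
    *-Φ {x} unity = begin
      x * Φ x                                ≈⟨ *-distribˡ-sum {suc q} x (λ i → x ^ toℕ i) ⟩
      sum {suc q} (λ i → x ^ suc (toℕ i))    ≈⟨ solve 2 (λ o t → t := (o :+ t) :- o) refl 1# _ ⟩
      sum {suc (suc q)} (λ i → x ^ toℕ i) - 1# ≈⟨ +-congʳ (sum-snoc (suc q) (x ^_)) ⟩
      (Φ x + x ^ suc q) - 1#                 ≈⟨ +-congʳ (+-congˡ unity) ⟩
      (Φ x + 1#) - 1#                        ≈⟨ solve 2 (λ o t → (t :+ o) :- o := t) refl 1# _ ⟩
      Φ x                                    ∎

    -- Φ(x)/p is idempotent, so it is 0 or 1.
    unity-dichotomy : ∀ {x} → x ^ suc q ≈ 1# → x ≈ 1# ⊎ Φ x ≈ 0#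
    unity-dichotomy {x} unity = swap (map₂ Φ≈p⇒x≈1 (dichotomy p (Φ x) p≢0 (fixed-Φ (*-Φ unity))))
      where
      Φ≈p⇒x≈1 : Φ x ≈ ι p → x ≈ 1#
      Φ≈p⇒x≈1 Φ≈p = x∙y⁻¹≈ε⇒x≈y x 1# (torsion-free p (x - 1#) p≢0 (begin
        ι p * (x - 1#)             ≈⟨ *-congˡ (+-congˡ (-‿cong 1-homo)) ⟨
        ι p * (x - ι (ℤ.+ 1))      ≈⟨ solve 2 (λ p x → p :* (x :- con (ℤ.+ 1)) := x :* p :- p) refl (ι p) x ⟩
        x * ι p - ι p              ≈⟨ +-cong (*-congˡ (sym Φ≈p)) (-‿cong (sym Φ≈p)) ⟩
        x * Φ x - Φ x              ≈⟨ +-congʳ (*-Φ unity) ⟩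
        Φ x - Φ x                  ≈⟨ -‿inverseʳ _ ⟩
        0#                         ∎))

    module NontrivialRoot (w : Carrier) (w^p≈1 : w ^ suc q ≈ 1#) (w≉1 : ¬ w ≈ 1#) where

      infix 4 _≡ₘ_
      _≡ₘ_ : ℤ → ℤ → Set
      _≡ₘ_ = _≡ₚ_ (suc q)

      F : PrimeField
      F = primeField q p-prime

      w^[p*k]≈1 : ∀ k → w ^ (suc q ℕ.* k) ≈ 1#
      w^[p*k]≈1 k = trans (sym (^-assocʳ w (suc q) k)) (one-^ k w^p≈1)

      private
        w^-mod-≤ : ∀ {m n} → m ℕ.≤ n → suc q ℕ.∣ n ℕ.∸ m → w ^ m ≈ w ^ n
        w^-mod-≤ {m} {n} m≤n (ℕ.divides k n∸m≡) = begin
          w ^ m                         ≈⟨ *-identityʳ _ ⟨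
          w ^ m * 1#                    ≈⟨ *-congˡ (w^[p*k]≈1 k) ⟨
          w ^ m * w ^ (suc q ℕ.* k)     ≈⟨ ^-homo-* w m _ ⟨
          w ^ (m ℕ.+ suc q ℕ.* k)       ≈⟨ reflexive (≡.cong (w ^_) (≡.trans (≡.cong (m ℕ.+_) (≡.trans (ℕ.*-comm (suc q) k) (≡.sym n∸m≡))) (ℕ.m+[n∸m]≡n m≤n))) ⟩
          w ^ n                         ∎

        distance : ∀ {m n} → m ℕ.≤ n → ℤ.∣ ℤ.+ m ℤ.- ℤ.+ n ∣ ≡ n ℕ.∸ m
        distance {m} {n} m≤n = ≡.trans (≡.cong ℤ.∣_∣ (ℤ.m-n≡m⊖n m n)) (ℤ.∣⊖∣-≤ m≤n)

      w^-mod : ∀ m n → ℤ.+ m ≡ₘ ℤ.+ n → w ^ m ≈ w ^ n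
      w^-mod m n h with ℕ.≤-total m n
      ... | inj₁ m≤n = w^-mod-≤ m≤n (≡.subst (suc q ℕ.∣_) (distance m≤n) (∣⇒∣ᵤ h))
      ... | inj₂ n≤m = sym (w^-mod-≤ n≤m (≡.subst (suc q ℕ.∣_) (distance n≤m) (∣⇒∣ᵤ (≡ₚ-sym (suc q) {ℤ.+ m} {ℤ.+ n} h))))

      infixr 8 w^ℤ_
      -- The exponent is reduced to a residue below p, which gives negative powers of w a meaning
      -- without inverses in the ring.
      w^ℤ_ : ℤ → Carrier
      w^ℤ z = w ^ (z %ℕ suc q)

      w^ℤ-+ℕ : ∀ n → w^ℤ (ℤ.+ n) ≈ w ^ n
      w^ℤ-+ℕ n = sym (w^-mod n (ℤ.+ n %ℕ suc q) (residue (suc q) (ℤ.+ n)))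

      w^ℤ-cong : ∀ {x y} → x ≡ₘ y → w^ℤ x ≈ w^ℤ y
      w^ℤ-cong {x} {y} x≡y = w^-mod (x %ℕ suc q) (y %ℕ suc q)
        (F.trans {ℤ.+ (x %ℕ suc q)} {x} {ℤ.+ (y %ℕ suc q)} (F.sym {x} (residue (suc q) x)) (F.trans {x} {y} x≡y (residue (suc q) y)))
        where module F = PrimeField F

      w^ℤ-+ : ∀ x y → w^ℤ (x ℤ.+ y) ≈ w^ℤ x * w^ℤ y
      w^ℤ-+ x y = trans (w^-mod ((x ℤ.+ y) %ℕ suc q) (x %ℕ suc q ℕ.+ y %ℕ suc q)
        (F.trans {ℤ.+ ((x ℤ.+ y) %ℕ suc q)} {x ℤ.+ y} (F.sym {x ℤ.+ y} (residue (suc q) (x ℤ.+ y))) (≡ₚ-+ (suc q) {x} {ℤ.+ (x %ℕ suc q)} {y} {ℤ.+ (y %ℕ suc q)} (residue (suc q) x) (residue (suc q) y))))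
        (^-homo-* w (x %ℕ suc q) (y %ℕ suc q))
        where
        module F = PrimeField F

      Φ[w]≈0 : Φ w ≈ 0#
      Φ[w]≈0 = fromInj₂ (λ w≈1 → contradiction w≈1 w≉1) (unity-dichotomy w^p≈1)

      -- No inverse of w - 1 is at hand. If (w - 1) y = 0, then w fixes y, so p y = Φ(w) y = 0.
      cancel : ∀ y → (w - 1#) * y ≈ 0# → y ≈ 0#
      cancel y h = torsion-free p y p≢0 (begin
        ι p * y    ≈⟨ fixed-Φ (x∙y⁻¹≈ε⇒x≈y _ _ (trans (solve 3 (λ w o y → w :* y :- y := (w :- o) :* y :+ (o :* y :- y)) refl w 1# y)
                        (trans (+-cong h (trans (+-congʳ (*-identityˡ y)) (-‿inverseʳ y))) (+-identityˡ _)))) ⟨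
        Φ w * y    ≈⟨ *-congʳ Φ[w]≈0 ⟩
        0# * y     ≈⟨ zeroˡ y ⟩
        0#         ∎)

      module F where
        open PrimeField F public
        open PolynomialFunctions F public
        open import Algebra.Properties.Semiring.Exp (PrimeField.semiring F) public using () renaming (_^_ to _↑_)

      ↑-pos : ∀ m n → (ℤ.+ m) F.↑ n ≡ ℤ.+ (m ℕ.^ n)
      ↑-pos m zero    = ≡.refl
      ↑-pos m (suc n) = ≡.trans (≡.cong (ℤ.+ m ℤ.*_) (↑-pos m n)) (≡.sym (ℤ.pos-* m (m ℕ.^ n)))

      q≢0 : ∃ λ r → q ≡ suc r
      q≢0 = predecessor F.1≤q
        where
        predecessor : ∀ {n} → 1 ℕ.≤ n → ∃ λ r → n ≡ suc r
        predecessor {suc r} _ = r , ≡.refl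

      -- If p does not divide m, then m^q is 1 modulo p, so w = w^(m^q) is a power of w^m and equals
      -- 1.
      w^-order : ∀ m → w ^ m ≈ 1# → p ∣ ℤ.+ m
      w^-order m w^m≈1 with (ℤ.+ m) F.≟ (ℤ.+ 0) | q≢0
      ... | yes m≡0 | _ = ≡ₚ0⇒∣ (suc q) m≡0
      ... | no m≢0  | r , q≡ = contradiction (begin
        w                      ≈⟨ *-identityʳ w ⟨
        w ^ 1                  ≈⟨ w^-mod 1 (m ℕ.^ q) (F.sym {ℤ.+ (m ℕ.^ q)} {ℤ.+ 1} (≡.subst (_≡ₘ ℤ.+ 1) (↑-pos m q) (F.fermat-unit {ℤ.+ m} m≢0))) ⟩
        w ^ (m ℕ.^ q)          ≈⟨ reflexive (≡.cong (λ k → w ^ (m ℕ.^ k)) q≡) ⟩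
        w ^ (m ℕ.* m ℕ.^ r)    ≈⟨ ^-assocʳ w m (m ℕ.^ r) ⟨
        (w ^ m) ^ (m ℕ.^ r)    ≈⟨ one-^ (m ℕ.^ r) w^m≈1 ⟩
        1#                     ∎) w≉1

      Φ[w^m]≈0 : ∀ m → ¬ p ∣ ℤ.+ m → Φ (w ^ m) ≈ 0#
      Φ[w^m]≈0 m p∤m = fromInj₂ (λ w^m≈1 → contradiction (w^-order m w^m≈1) p∤m) (unity-dichotomy {w ^ m} (trans (^-assocʳ w m (suc q)) (trans (reflexive (≡.cong (w ^_) (ℕ.*-comm m (suc q)))) (w^[p*k]≈1 m))))

      -- Otherwise Φ(h w^{-k}) = 0 for every k, but these values sum to p.
      logarithm : ∀ h → h ^ suc q ≈ 1# → ∃ λ k → h ≈ w ^ k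
      logarithm h unity = [ found , (λ vanish → contradiction (impossible vanish) 1≉0) ]′
        (search {suc q} {λ k → x k ≈ 1#} {λ k → Φ (x k) ≈ 0#} (λ k → unity-dichotomy (x^p≈1 k)))
        where
        x : Fin (suc q) → Carrier
        x k = h * (w ^ q) ^ toℕ k
        x^p≈1 : ∀ k → x k ^ suc q ≈ 1#
        x^p≈1 k = trans (^-distrib-* h _ (suc q)) (trans (*-cong unity (trans (^-assocʳ (w ^ q) (toℕ k) (suc q))
          (trans (^-assocʳ w q (toℕ k ℕ.* suc q)) (trans (reflexive (≡.cong (w ^_)
            (≡.trans (≡.sym (ℕ.*-assoc q (toℕ k) (suc q))) (ℕ.*-comm (q ℕ.* toℕ k) (suc q))))) (w^[p*k]≈1 (q ℕ.* toℕ k)))))) (*-identityˡ 1#))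
        -- The order of summation is exchanged: column 0 contributes p, and every other column is a
        -- multiple of Φ at w^(q j), which vanishes because p does not divide q j.
        column : Fin (suc q) → Carrier
        column j = sum {suc q} (λ k → h ^ toℕ j * ((w ^ q) ^ toℕ k) ^ toℕ j)
        p∤ : ∀ (j : Fin q) → ¬ p ∣ ℤ.+ (q ℕ.* suc (toℕ j))
        p∤ j p∣ with IntegerEuclid.euclid p-prime (ℤ.+ q) (ℤ.+ suc (toℕ j)) (≡.subst (p ∣_) (ℤ.pos-* q (suc (toℕ j))) p∣)
        ... | inj₂ p∣j = F.ι-nonzero (toℕ j) (Fin.toℕ<n j) (∣⇒≡ₚ0 (suc q) p∣j)
        ... | inj₁ p∣q with q≢0
        ...   | r , q≡ = F.ι-nonzero r (ℕ.≤-reflexive (≡.sym q≡)) (∣⇒≡ₚ0 (suc q) (≡.subst (λ k → p ∣ ℤ.+ k) q≡ p∣q))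
        later : ∀ (j : Fin q) → column (suc j) ≈ 0#
        later j = begin
          sum {suc q} (λ k → h ^ m * ((w ^ q) ^ toℕ k) ^ m)
            ≈⟨ *-distribˡ-sum {suc q} (h ^ m) (λ k → ((w ^ q) ^ toℕ k) ^ m) ⟨
          h ^ m * sum {suc q} (λ k → ((w ^ q) ^ toℕ k) ^ m)
            ≈⟨ *-congˡ (sum-cong-≋ {suc q} (λ k → trans (^-assocʳ (w ^ q) (toℕ k) m) (trans (reflexive (≡.cong ((w ^ q) ^_) (ℕ.*-comm (toℕ k) m)))
                 (trans (sym (^-assocʳ (w ^ q) m (toℕ k))) (^-congˡ (toℕ k) (^-assocʳ w q m)))))) ⟩
          h ^ m * Φ (w ^ (q ℕ.* m))
            ≈⟨ *-congˡ (Φ[w^m]≈0 (q ℕ.* m) (p∤ j)) ⟩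
          h ^ m * 0#
            ≈⟨ zeroʳ _ ⟩
          0# ∎
          where m = suc (toℕ j)
        found : (∃ λ k → x k ≈ 1#) → ∃ λ k → h ≈ w ^ k
        found (k , hx≈1) = toℕ k , (begin
          h                                            ≈⟨ *-identityʳ h ⟨
          h * 1#                                       ≈⟨ *-congˡ (w^[p*k]≈1 (toℕ k)) ⟨
          h * w ^ (suc q ℕ.* toℕ k)                    ≈⟨ *-congˡ (reflexive (≡.cong (w ^_) (ℕ.+-comm (toℕ k) _))) ⟩
          h * w ^ (q ℕ.* toℕ k ℕ.+ toℕ k)              ≈⟨ *-congˡ (^-homo-* w (q ℕ.* toℕ k) (toℕ k)) ⟩
          h * (w ^ (q ℕ.* toℕ k) * w ^ toℕ k)          ≈⟨ *-assoc _ _ _ ⟨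
          (h * w ^ (q ℕ.* toℕ k)) * w ^ toℕ k          ≈⟨ *-congʳ (*-congˡ (^-assocʳ w q (toℕ k))) ⟨
          (h * (w ^ q) ^ toℕ k) * w ^ toℕ k            ≈⟨ *-congʳ hx≈1 ⟩
          1# * w ^ toℕ k                               ≈⟨ *-identityˡ _ ⟩
          w ^ toℕ k                                    ∎)
        impossible : (∀ k → Φ (x k) ≈ 0#) → 1# ≈ 0#
        impossible vanish = torsion-free p 1# p≢0 (begin
          ι p * 1#
            ≈⟨ sum-constant (suc q) 1# ⟨
          sum {suc q} (λ _ → 1#)
            ≈⟨ trans (+-identityʳ _) (sum-cong-≋ {suc q} (λ k → *-identityʳ 1#)) ⟨
          column zero + 0#
            ≈⟨ +-congˡ (trans (sum-cong-≋ {q} {y = λ _ → 0#} (λ j → later j)) (sum-replicate-zero q)) ⟨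
          sum {suc q} column
            ≈⟨ ∑-comm {suc q} {suc q} (λ j k → h ^ toℕ j * ((w ^ q) ^ toℕ k) ^ toℕ j) ⟩
          sum {suc q} (λ k → sum {suc q} (λ j → h ^ toℕ j * ((w ^ q) ^ toℕ k) ^ toℕ j))
            ≈⟨ sum-cong-≋ {suc q} {y = λ _ → 0#} (λ k → trans (sum-cong-≋ {suc q} (λ j → sym (^-distrib-* h ((w ^ q) ^ toℕ k) (toℕ j)))) (vanish k)) ⟩
          sum {suc q} (λ _ → 0#)
            ≈⟨ sum-replicate-zero (suc q) ⟩
          0# ∎)

-- Exponents of w with orthogonal translates are quadratic.

module QuadraticExponents where
  open import Data.Integer.Divisibility.Signed using (_∣_; divides)
  open import Data.Integer.DivMod using (_%ℕ_)
  import Data.Integer.Tactic.RingSolver as ℤ-Solver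
  import Relation.Binary.Reasoning.Setoid
  open CyclotomicRelations using (p∣binomial-sums)
  open PowerSumsOfExponents using (sum-Deg<)
  open PlanarFunctions using (quadratic)
  open import Data.Nat.Combinatorics using (_C_)
  open import Algebra.Properties.CommutativeMonoid.Sum ℤ.+-0-commutativeMonoid using () renaming (sum to sumℤ)
  open IntegersModulo
  open RootsOfUnity

  module _ (A : ℤ-Algebra) (char0 : CharacteristicZero A) (q : ℕ) (p-prime : Prime (suc q)) where
    open ℤ-Algebra A
    open FiniteSums A using (sum-constant)
    open CharacteristicZero char0
    open import Algebra.Properties.Semiring.Sum semiring using (sum; sum-cong-≋)
    open import Algebra.Properties.Semiring.Exp semiring using (_^_; ^-congˡ; ^-homo-*)
    open Solver using (solve; _:+_; _:-_; _:=_)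
    open UnityDichotomy A char0 q p-prime
    module _ (w : Carrier) (w^p≈1 : w ^ suc q ≈ 1#) (w≉1 : ¬ w ≈ 1#) where
      open NontrivialRoot w w^p≈1 w≉1

      module _ (E : ℤ → ℕ) (E-cong : ∀ {x y} → x ≡ₘ y → E x ≡ E y)
               (orthogonal : ∀ d → ¬ d ≡ₘ ℤ.+ 0 →
                 sum {suc q} (λ x → w ^ (E (ℤ.+ toℕ x ℤ.+ d) ℕ.+ q ℕ.* E (ℤ.+ toℕ x))) ≈ 0#) where

        f : ℤ → ℤ
        f x = ℤ.+ E x

        -- q E(x) stands for -E(x) modulo p, which keeps exponents natural.
        exponent : ℤ → ℤ → ℕ
        exponent d x = E (x ℤ.+ d) ℕ.+ q ℕ.* E x

        exponent≈ : ∀ d x → ℤ.+ exponent d x ≡ₘ f (x ℤ.+ d) ℤ.- f x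
        exponent≈ d x = divides (f x) (≡.trans
          (≡.cong (ℤ._- (f (x ℤ.+ d) ℤ.- f x)) (≡.cong (λ t → f (x ℤ.+ d) ℤ.+ t) (ℤ.pos-* q (E x))))
          (lemma (f (x ℤ.+ d)) (f x) (ℤ.+ q)))
          where
          lemma : ∀ s t q → (s ℤ.+ q ℤ.* t) ℤ.- (s ℤ.- t) ≡ t ℤ.* (ℤ.+ 1 ℤ.+ q)
          lemma = ℤ-Solver.solve-∀

        planar : ∀ d → ¬ d ≡ₘ ℤ.+ 0 → ∀ φ → F.Deg< q φ → F.L (λ x → φ (f (x ℤ.+ d) ℤ.- f x)) F.≈ ℤ.+ 0
        planar d d≢0 φ deg = begin
          F.L (λ x → φ (f (x ℤ.+ d) ℤ.- f x))
            ≈⟨ F.L-cong (λ x → F.Deg<-cong q deg {ℤ.+ exponent d x} {f (x ℤ.+ d) ℤ.- f x} (exponent≈ d x)) ⟨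
          F.L (λ x → φ (ℤ.+ exponent d x))
            ≈⟨ F.L-sum-el (λ x → φ (ℤ.+ exponent d x)) ⟩
          sumF {suc q} (λ x → φ (ℤ.+ exponent d (ℤ.+ toℕ x)))
            ≈⟨ sum-Deg< F {suc q} (λ x → exponent d (ℤ.+ toℕ x)) binomial-sums q {φ} ℕ.≤-refl deg ⟩
          ℤ.+ 0 ∎
          where
          open Relation.Binary.Reasoning.Setoid F.setoid
          open import Algebra.Properties.Semiring.Sum F.semiring using () renaming (sum to sumF)
          1+π≈w : 1# + (w - 1#) ≈ w
          1+π≈w = solve 2 (λ o w → o :+ (w :- o) := w) refl 1# w
          binomial-sums : ∀ {k} → k ℕ.< q → p ∣ sumℤ {suc q} (λ x → ℤ.+ (exponent d (ℤ.+ toℕ x) C k))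
          binomial-sums = p∣binomial-sums A torsion-free 1≉0 q p-prime (w - 1#) cancel
            (trans (^-congˡ (suc q) 1+π≈w) w^p≈1) {suc q} (λ x → exponent d (ℤ.+ toℕ x))
            (trans (sum-cong-≋ {suc q} (λ x → ^-congˡ (exponent d (ℤ.+ toℕ x)) 1+π≈w)) (orthogonal d d≢0))

        -- The power sums modulo p do not see an affine f, so orthogonality over ℂ is used once
        -- more: if 2a = 0, the exponents for d = 1 are all congruent to a + b, and the vanishing
        -- sum would be p w^(a+b). For p = 2 one always has 2a = 0, so there the hypotheses
        -- contradict each other.
        add-nondegeneracy : (∃ λ a → ∃ λ b → ∃ λ c → ∀ x → f x ≡ₘ a ℤ.* (x ℤ.* x) ℤ.+ b ℤ.* x ℤ.+ c) → ∃ λ a → ∃ λ b → ∃ λ c →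
          ¬ (a ℤ.+ a) ≡ₘ ℤ.+ 0 × (∀ x → f x ≡ₘ a ℤ.* (x ℤ.* x) ℤ.+ b ℤ.* x ℤ.+ c)
        add-nondegeneracy (a , b , c , f≈) = a , b , c , (λ 2a≡0 → 1≉0 (1≈0 2a≡0)) , f≈
          where
          k = (a ℤ.+ b) %ℕ suc q
          value : ℤ → ℤ
          value x = a ℤ.* (x ℤ.* x) ℤ.+ b ℤ.* x ℤ.+ c
          lemma : ∀ a b c x → (a ℤ.* ((x ℤ.+ ℤ.+ 1) ℤ.* (x ℤ.+ ℤ.+ 1)) ℤ.+ b ℤ.* (x ℤ.+ ℤ.+ 1) ℤ.+ c) ℤ.- (a ℤ.* (x ℤ.* x) ℤ.+ b ℤ.* x ℤ.+ c)
                  ≡ (a ℤ.+ a) ℤ.* x ℤ.+ (a ℤ.+ b)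
          lemma = ℤ-Solver.solve-∀

          constant : (a ℤ.+ a) ≡ₘ ℤ.+ 0 → ∀ x → ℤ.+ exponent (ℤ.+ 1) x ≡ₘ ℤ.+ k
          constant 2a≡0 x = begin
            ℤ.+ exponent (ℤ.+ 1) x
              ≈⟨ exponent≈ (ℤ.+ 1) x ⟩
            f (x ℤ.+ ℤ.+ 1) ℤ.- f x
              ≈⟨ ≡ₚ-+ (suc q) {f (x ℤ.+ ℤ.+ 1)} {value (x ℤ.+ ℤ.+ 1)} {ℤ.- f x} {ℤ.- value x} (f≈ (x ℤ.+ ℤ.+ 1)) (≡ₚ-neg (suc q) {f x} {value x} (f≈ x)) ⟩
            value (x ℤ.+ ℤ.+ 1) ℤ.- value x
              ≡⟨ lemma a b c x ⟩
            (a ℤ.+ a) ℤ.* x ℤ.+ (a ℤ.+ b)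
              ≈⟨ ≡ₚ-+ (suc q) {(a ℤ.+ a) ℤ.* x} {ℤ.+ 0 ℤ.* x} {a ℤ.+ b} {a ℤ.+ b} (≡ₚ-* (suc q) {a ℤ.+ a} {ℤ.+ 0} {x} {x} 2a≡0 (F.refl {x})) (F.refl {a ℤ.+ b}) ⟩
            ℤ.+ 0 ℤ.* x ℤ.+ (a ℤ.+ b)
              ≡⟨ ℤ.+-identityˡ (a ℤ.+ b) ⟩
            a ℤ.+ b
              ≈⟨ residue (suc q) (a ℤ.+ b) ⟩
            ℤ.+ k ∎
            where open Relation.Binary.Reasoning.Setoid F.setoid

          1≈0 : (a ℤ.+ a) ≡ₘ ℤ.+ 0 → 1# ≈ 0#
          1≈0 2a≡0 = begin
            1#                           ≈⟨ w^[p*k]≈1 k ⟨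
            w ^ (k ℕ.+ q ℕ.* k)          ≈⟨ ^-homo-* w k (q ℕ.* k) ⟩
            w ^ k * w ^ (q ℕ.* k)        ≈⟨ *-congʳ w^k≈0 ⟩
            0# * w ^ (q ℕ.* k)           ≈⟨ zeroˡ _ ⟩
            0#                           ∎
            where
            open Relation.Binary.Reasoning.Setoid setoid
            w^k≈0 : w ^ k ≈ 0#
            w^k≈0 = torsion-free p (w ^ k) p≢0 (begin
              ι p * w ^ k                ≈⟨ sum-constant (suc q) (w ^ k) ⟨
              sum {suc q} (λ _ → w ^ k)  ≈⟨ sum-cong-≋ {suc q} (λ x → w^-mod (exponent (ℤ.+ 1) (ℤ.+ toℕ x)) k (constant 2a≡0 (ℤ.+ toℕ x))) ⟨
              sum {suc q} (λ x → w ^ exponent (ℤ.+ 1) (ℤ.+ toℕ x))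
                                         ≈⟨ orthogonal (ℤ.+ 1) F.1≉0 ⟩
              0#                         ∎)

        quadratic-exponents : ∃ λ a → ∃ λ b → ∃ λ c →
          ¬ (a ℤ.+ a) ≡ₘ ℤ.+ 0 × (∀ x → f x ≡ₘ a ℤ.* (x ℤ.* x) ℤ.+ b ℤ.* x ℤ.+ c)
        quadratic-exponents = add-nondegeneracy (quadratic F {f} (λ h → F.reflexive (≡.cong ℤ.+_ (E-cong h))) planar)

-- Integers inside ℚ and the Archimedean property.

module RationalLemmas where
  open import Data.Integer.Base using (+_; -[1+_])
  open import Data.Integer.Tactic.RingSolver using (solve-∀)
  open import Data.Rational.Base
  open import Data.Rational.Literals using (fromℤ) public
  open import Data.Rational.Properties
  import Data.Rational.Unnormalised.Base as ℚᵘ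
  import Data.Rational.Unnormalised.Properties as ℚᵘₚ
  open import Relation.Binary.PropositionalEquality

  fromℕ : ℕ → ℚ
  fromℕ n = fromℤ (+ n)

  fromℤ-+ : ∀ m n → fromℤ (m ℤ.+ n) ≡ fromℤ m + fromℤ n
  fromℤ-+ m n = toℚᵘ-injective (ℚᵘₚ.≃-sym (ℚᵘₚ.≃-trans (toℚᵘ-homo-+ (fromℤ m) (fromℤ n)) (ℚᵘ.*≡* (lemma m n))))
    where
    lemma : ∀ m n → (m ℤ.* + 1 ℤ.+ n ℤ.* + 1) ℤ.* + 1 ≡ (m ℤ.+ n) ℤ.* (+ 1 ℤ.* + 1)
    lemma = solve-∀

  fromℤ-* : ∀ m n → fromℤ (m ℤ.* n) ≡ fromℤ m * fromℤ n
  fromℤ-* m n = toℚᵘ-injective (ℚᵘₚ.≃-sym (ℚᵘₚ.≃-trans (toℚᵘ-homo-* (fromℤ m) (fromℤ n)) (ℚᵘ.*≡* (lemma m n))))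
    where
    lemma : ∀ m n → (m ℤ.* n) ℤ.* + 1 ≡ (m ℤ.* n) ℤ.* (+ 1 ℤ.* + 1)
    lemma = solve-∀

  fromℤ-neg : ∀ m → fromℤ (ℤ.- m) ≡ - fromℤ m
  fromℤ-neg m = toℚᵘ-injective (ℚᵘₚ.≃-sym (ℚᵘₚ.≃-trans (toℚᵘ-homo‿- (fromℤ m)) (ℚᵘ.*≡* refl)))

  /-*-fromℤ : ∀ z n .{{_ : ℕ.NonZero n}} → (z / n) * fromℤ (+ n) ≡ fromℤ z
  /-*-fromℤ z (suc d) = toℚᵘ-injective (ℚᵘₚ.≃-trans (toℚᵘ-homo-* (z / suc d) (fromℤ (+ suc d)))
    (ℚᵘₚ.≃-trans (ℚᵘₚ.*-congʳ {ℚᵘ.mkℚᵘ (+ suc d) 0} (toℚᵘ-fromℚᵘ (ℚᵘ.mkℚᵘ z d))) (ℚᵘ.*≡* (lemma z (+ suc d)))))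
    where
    lemma : ∀ z n → (z ℤ.* n) ℤ.* + 1 ≡ z ℤ.* (n ℤ.* + 1)
    lemma = solve-∀

  archimedean : ∀ K ε → 0ℚ < ε → ∃ λ n → K < fromℕ n * ε
  archimedean K@(mkℚ k e _) ε@(mkℚ (+ suc a) d _) _ = n , toℚᵘ-cancel-<
    (ℚᵘₚ.<-respʳ-≃ (ℚᵘₚ.≃-sym (toℚᵘ-homo-* (fromℕ n) ε)) (ℚᵘ.*<* bound))
    where
    -- For K = k/(e + 1) and ε = (a + 1)/(d + 1), n > |k| (d + 1) gives n ε ≥ n/(d + 1) > |k| ≥ K.
    n = suc (ℤ.∣ k ∣ ℕ.* suc d)
    k≤∣k∣ : ∀ k → k ℤ.≤ + ℤ.∣ k ∣
    k≤∣k∣ (+ k)    = ℤ.≤-refl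
    k≤∣k∣ -[1+ k ] = ℤ.-≤+
    bound : k ℤ.* (+ 1 ℤ.* + suc d) ℤ.< (+ n ℤ.* + suc a) ℤ.* + suc e
    bound = begin-strict
      k ℤ.* (+ 1 ℤ.* + suc d)                ≡⟨ cong (k ℤ.*_) (ℤ.*-identityˡ (+ suc d)) ⟩
      k ℤ.* + suc d                          ≤⟨ ℤ.*-monoʳ-≤-nonNeg (+ suc d) (k≤∣k∣ k) ⟩
      + ℤ.∣ k ∣ ℤ.* + suc d                  ≡⟨ ℤ.pos-* ℤ.∣ k ∣ (suc d) ⟨
      + (ℤ.∣ k ∣ ℕ.* suc d)                  <⟨ ℤ.+<+ ℕ.≤-refl ⟩
      + n                                    ≤⟨ ℤ.+≤+ (ℕ.≤-trans (ℕ.m≤m*n n (suc a)) (ℕ.m≤m*n (n ℕ.* suc a) (suc e))) ⟩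
      + (n ℕ.* suc a ℕ.* suc e)              ≡⟨ ℤ.pos-* (n ℕ.* suc a) (suc e) ⟩
      + (n ℕ.* suc a) ℤ.* + suc e            ≡⟨ cong (ℤ._* + suc e) (ℤ.pos-* n (suc a)) ⟩
      (+ n ℤ.* + suc a) ℤ.* + suc e          ∎
      where open ℤ.≤-Reasoning
  archimedean K (mkℚ (+ 0) d _)    (*<* (ℤ.+<+ ()))
  archimedean K (mkℚ -[1+ _ ] d _) (*<* ())

  fromℤ-mono-≤ : ∀ {m n} → m ℤ.≤ n → fromℤ m ≤ fromℤ n
  fromℤ-mono-≤ m≤n = *≤* (ℤ.*-monoʳ-≤-nonNeg (+ 1) m≤n)

  fromℕ-mono-≤ : ∀ {m n} → m ℕ.≤ n → fromℕ m ≤ fromℕ n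
  fromℕ-mono-≤ m≤n = fromℤ-mono-≤ (ℤ.+≤+ m≤n)

  archimedean-≥ : ∀ K ε → 0ℚ < ε → ∃ λ N → ∀ n → N ℕ.≤ n → K < fromℕ n * ε
  archimedean-≥ K ε ε>0 with archimedean K ε ε>0
  ... | N , K<Nε = N , λ n N≤n → <-≤-trans K<Nε (*-monoʳ-≤-nonNeg ε {{nonNegative (<⇒≤ ε>0)}} (fromℕ-mono-≤ N≤n))

-- Properties that hold for all large indices.

module EventualProperties where
  open import Defs using (Eventually)
  open import Data.Nat.Base using (_⊔_)
  open import Data.Nat.Properties using (m⊔n≤o⇒m≤o; m⊔n≤o⇒n≤o)

  map-eventually : ∀ {P Q : ℕ → Set} → (∀ n → P n → Q n) → Eventually P → Eventually Q
  map-eventually f (N , h) = N , λ n N≤n → f n (h n N≤n)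

  always : ∀ {P : ℕ → Set} → (∀ n → P n) → Eventually P
  always h = 0 , λ n _ → h n

  both : ∀ {P Q : ℕ → Set} → Eventually P → Eventually Q → Eventually (λ n → P n × Q n)
  both (M , h) (N , g) = M ⊔ N , λ n le → h n (m⊔n≤o⇒m≤o M N le) , g n (m⊔n≤o⇒n≤o M N le)

-- Equality of Cauchy reals is a congruence.

module RealEquality where
  open import Defs hiding (_+_; _*_; -_; _≈_)
  open import Data.Rational.Base hiding (_/_)
  open import Data.Rational.Properties
  open import Data.Rational.Solver using (module +-*-Solver)
  open import Relation.Binary.PropositionalEquality
  open +-*-Solver
  open EventualProperties

  ≈ʳ-pointwise : ∀ {x y} → (∀ n → seq x n ≡ seq y n) → x ≈ʳ y
  ≈ʳ-pointwise {x} {y} h ε ε>0 = always λ n → subst (_< ε)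
    (trans (sym (∣p-p∣≡0 (seq x n))) (cong (λ q → ∣ seq x n - q ∣) (h n))) ε>0

  ≈ʳ-sym : ∀ {x y} → x ≈ʳ y → y ≈ʳ x
  ≈ʳ-sym {x} {y} h ε ε>0 = map-eventually (λ n → subst (_< ε)
    (trans (sym (∣-p∣≡∣p∣ (seq x n - seq y n))) (cong ∣_∣ (solve 2 (λ a b → :- (a :- b) := b :- a) refl (seq x n) (seq y n))))) (h ε ε>0)

  ∣+∣< : ∀ {p q ε} → ∣ p ∣ < ε * ½ → ∣ q ∣ < ε * ½ → ∣ p + q ∣ < ε
  ∣+∣< {p} {q} {ε} hp hq = ≤-<-trans (∣p+q∣≤∣p∣+∣q∣ p q) (subst (∣ p ∣ + ∣ q ∣ <_) (half+half ε) (+-mono-< hp hq))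

  ≈ʳ-trans : ∀ {x y z} → x ≈ʳ y → y ≈ʳ z → x ≈ʳ z
  ≈ʳ-trans {x} {y} {z} h g ε ε>0 = map-eventually
    (λ { n (a , b) → subst (λ q → ∣ q ∣ < ε) (solve 3 (λ a b c → (a :- b) :+ (b :- c) := a :- c) refl (seq x n) (seq y n) (seq z n)) (∣+∣< {seq x n - seq y n} {seq y n - seq z n} a b) })
    (both (h _ (half>0 ε>0)) (g _ (half>0 ε>0)))

  +ʳ-cong : ∀ {x y u v} → x ≈ʳ y → u ≈ʳ v → (x +ʳ u) ≈ʳ (y +ʳ v)
  +ʳ-cong {x} {y} {u} {v} h g ε ε>0 = map-eventually
    (λ { n (a , b) → subst (λ q → ∣ q ∣ < ε)
      (solve 4 (λ a b c d → (a :- b) :+ (c :- d) := (a :+ c) :- (b :+ d)) refl (seq x n) (seq y n) (seq u n) (seq v n))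
      (∣+∣< {seq x n - seq y n} {seq u n - seq v n} a b) })
    (both (h _ (half>0 ε>0)) (g _ (half>0 ε>0)))

  -ʳ-cong : ∀ {x y} → x ≈ʳ y → (-ʳ x) ≈ʳ (-ʳ y)
  -ʳ-cong {x} {y} h ε ε>0 = map-eventually (λ n → subst (_< ε)
    (trans (sym (∣-p∣≡∣p∣ (seq x n - seq y n))) (cong ∣_∣ (solve 2 (λ a b → :- (a :- b) := :- a :- :- b) refl (seq x n) (seq y n))))) (h ε ε>0)

  *ʳ-cong : ∀ {x y u v} → x ≈ʳ y → u ≈ʳ v → (x *ʳ u) ≈ʳ (y *ʳ v)
  *ʳ-cong {x} {y} {u} {v} h g ε ε>0 =
    let A , A>0 , x≤A = bounded {seq x} (cauchy x)
        B , B>0 , v≤B = bounded {seq v} (cauchy v)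
        δ , δ>0 , Sδ≡ε = divide (A + B) ε (+-mono-< A>0 B>0) ε>0
    in map-eventually
      (λ { n ((a , b) , (c , d)) → subst (∣ seq x n * seq u n - seq y n * seq v n ∣ <_) Sδ≡ε
             (*-close (seq x n) (seq u n) (seq y n) (seq v n) A>0 B>0 a b c d) })
      (both (both x≤A v≤B) (both (h δ δ>0) (g δ δ>0)))

-- The ring of complex numbers.

module ComplexRing where
  open import Defs
  open import Algebra.Bundles using (CommutativeRing)
  open import Data.Rational.Solver using (module +-*-Solver)
  open import Level using (0ℓ)
  open import Relation.Binary.PropositionalEquality using (refl; trans)
  open +-*-Solver
  open RationalLemmas
  open RealEquality

  -- Ring laws hold term by term for sequences of rationals, so they follow from rational identities
  -- without estimates.
  ≈-pointwise : ∀ {z z′} → (∀ n → seq (re z) n ≡ seq (re z′) n) → (∀ n → seq (im z) n ≡ seq (im z′) n) → z ≈ z′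
  ≈-pointwise {z} {z′} h g = ≈ʳ-pointwise {re z} {re z′} h , ≈ʳ-pointwise {im z} {im z′} g

  ≈-refl : ∀ {z} → z ≈ z
  ≈-refl {z} = ≈-pointwise {z} {z} (λ _ → refl) (λ _ → refl)

  ≈-sym : ∀ {x y} → x ≈ y → y ≈ x
  ≈-sym {x} {y} (h , g) = ≈ʳ-sym {re x} {re y} h , ≈ʳ-sym {im x} {im y} g

  ≈-trans : ∀ {x y z} → x ≈ y → y ≈ z → x ≈ z
  ≈-trans {x} {y} {z} (h , g) (h′ , g′) = ≈ʳ-trans {re x} {re y} {re z} h h′ , ≈ʳ-trans {im x} {im y} {im z} g g′

  +-cong : ∀ {x y u v} → x ≈ y → u ≈ v → x + u ≈ y + v
  +-cong {x} {y} {u} {v} (h , g) (h′ , g′) =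
    +ʳ-cong {re x} {re y} {re u} {re v} h h′ , +ʳ-cong {im x} {im y} {im u} {im v} g g′

  neg-cong : ∀ {x y} → x ≈ y → - x ≈ - y
  neg-cong {x} {y} (h , g) = -ʳ-cong {re x} {re y} h , -ʳ-cong {im x} {im y} g

  *-cong : ∀ {x y u v} → x ≈ y → u ≈ v → x * u ≈ y * v
  *-cong {x} {y} {u} {v} (h , g) (h′ , g′) =
    +ʳ-cong {re x *ʳ re u} {re y *ʳ re v} { -ʳ (im x *ʳ im u)} { -ʳ (im y *ʳ im v)}
      (*ʳ-cong {re x} {re y} {re u} {re v} h h′)
      (-ʳ-cong {im x *ʳ im u} {im y *ʳ im v} (*ʳ-cong {im x} {im y} {im u} {im v} g g′)) ,
    +ʳ-cong {re x *ʳ im u} {re y *ʳ im v} {im x *ʳ re u} {im y *ʳ re v}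
      (*ʳ-cong {re x} {re y} {im u} {im v} h g′)
      (*ʳ-cong {im x} {im y} {re u} {re v} g h′)

  private
    by : ∀ z z′ → (∀ n → seq (re z) n ≡ seq (re z′) n) → (∀ n → seq (im z) n ≡ seq (im z′) n) → z ≈ z′
    by z z′ = ≈-pointwise {z} {z′}
    R I : ℂ → ℕ → ℚ
    R z = seq (re z)
    I z = seq (im z)

  +-assoc : ∀ x y z → (x + y) + z ≈ x + (y + z)
  +-assoc x y z = by ((x + y) + z) (x + (y + z)) (λ n → ℚ.+-assoc (R x n) (R y n) (R z n)) (λ n → ℚ.+-assoc (I x n) (I y n) (I z n))

  +-comm : ∀ x y → x + y ≈ y + x
  +-comm x y = by (x + y) (y + x) (λ n → ℚ.+-comm (R x n) (R y n)) (λ n → ℚ.+-comm (I x n) (I y n))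

  +-identityˡ : ∀ x → 0ᶜ + x ≈ x
  +-identityˡ x = by (0ᶜ + x) x (λ n → ℚ.+-identityˡ (R x n)) (λ n → ℚ.+-identityˡ (I x n))

  +-inverseˡ : ∀ x → - x + x ≈ 0ᶜ
  +-inverseˡ x = by (- x + x) 0ᶜ (λ n → ℚ.+-inverseˡ (R x n)) (λ n → ℚ.+-inverseˡ (I x n))

  *-assoc : ∀ x y z → (x * y) * z ≈ x * (y * z)
  *-assoc x y z = by ((x * y) * z) (x * (y * z))
    (λ n → solve 6 (λ a b c d e f → (a :* c :+ :- (b :* d)) :* e :+ :- ((a :* d :+ b :* c) :* f) := a :* (c :* e :+ :- (d :* f)) :+ :- (b :* (c :* f :+ d :* e)))
             refl (R x n) (I x n) (R y n) (I y n) (R z n) (I z n))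
    (λ n → solve 6 (λ a b c d e f → (a :* c :+ :- (b :* d)) :* f :+ (a :* d :+ b :* c) :* e := a :* (c :* f :+ d :* e) :+ b :* (c :* e :+ :- (d :* f)))
             refl (R x n) (I x n) (R y n) (I y n) (R z n) (I z n))

  *-comm : ∀ x y → x * y ≈ y * x
  *-comm x y = by (x * y) (y * x)
    (λ n → solve 4 (λ a b c d → a :* c :+ :- (b :* d) := c :* a :+ :- (d :* b)) refl (R x n) (I x n) (R y n) (I y n))
    (λ n → solve 4 (λ a b c d → a :* d :+ b :* c := c :* b :+ d :* a) refl (R x n) (I x n) (R y n) (I y n))

  *-identityˡ : ∀ x → 1ᶜ * x ≈ x
  *-identityˡ x = by (1ᶜ * x) x
    (λ n → solve 2 (λ a b → con 1ℚ :* a :+ :- (con 0ℚ :* b) := a) refl (R x n) (I x n))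
    (λ n → solve 2 (λ a b → con 1ℚ :* b :+ con 0ℚ :* a := b) refl (R x n) (I x n))

  *-distribˡ-+ : ∀ x y z → x * (y + z) ≈ x * y + x * z
  *-distribˡ-+ x y z = by (x * (y + z)) (x * y + x * z)
    (λ n → solve 6 (λ a b c d e f → a :* (c :+ e) :+ :- (b :* (d :+ f)) := (a :* c :+ :- (b :* d)) :+ (a :* e :+ :- (b :* f)))
             refl (R x n) (I x n) (R y n) (I y n) (R z n) (I z n))
    (λ n → solve 6 (λ a b c d e f → a :* (d :+ f) :+ b :* (c :+ e) := (a :* d :+ b :* c) :+ (a :* f :+ b :* e))
             refl (R x n) (I x n) (R y n) (I y n) (R z n) (I z n))

  ℂ-commutativeRing : CommutativeRing 0ℓ 0ℓ
  ℂ-commutativeRing = record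
    { Carrier = ℂ ; _≈_ = _≈_ ; _+_ = _+_ ; _*_ = _*_ ; -_ = -_ ; 0# = 0ᶜ ; 1# = 1ᶜ
    ; isCommutativeRing = record
      { isRing = record
        { +-isAbelianGroup = record
          { isGroup = record
            { isMonoid = record
              { isSemigroup = record
                { isMagma = record
                  { isEquivalence = record
                    { refl = λ {z} → ≈-refl {z} ; sym = λ {x} {y} → ≈-sym {x} {y} ; trans = λ {x} {y} {z} → ≈-trans {x} {y} {z} }
                  ; ∙-cong = λ {x} {y} {u} {v} → +-cong {x} {y} {u} {v}
                  }
                ; assoc = +-assoc
                }
              ; identity = +-identityˡ , λ x → ≈-trans {x + 0ᶜ} {0ᶜ + x} {x} (+-comm x 0ᶜ) (+-identityˡ x)
              }
            ; inverse = +-inverseˡ , λ x → ≈-trans {x + - x} { - x + x} {0ᶜ} (+-comm x (- x)) (+-inverseˡ x)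
            ; ⁻¹-cong = λ {x} {y} → neg-cong {x} {y}
            }
          ; comm = +-comm
          }
        ; *-cong = λ {x} {y} {u} {v} → *-cong {x} {y} {u} {v}
        ; *-assoc = *-assoc
        ; *-identity = *-identityˡ , λ x → ≈-trans {x * 1ᶜ} {1ᶜ * x} {x} (*-comm x 1ᶜ) (*-identityˡ x)
        ; distrib = *-distribˡ-+ , λ x y z →
            ≈-trans {(y + z) * x} {x * (y + z)} {y * x + z * x} (*-comm (y + z) x)
              (≈-trans {x * (y + z)} {x * y + x * z} {y * x + z * x} (*-distribˡ-+ x y z)
                (+-cong {x * y} {y * x} {x * z} {z * x} (*-comm x y) (*-comm x z)))
        }
      ; *-comm = *-comm
      }
    }

  ιᶜ : ℤ → ℂ
  ιᶜ n = fromℚ (fromℤ n) +i 0ʳ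

  ℂ-algebra : ℤ-Algebra
  ℂ-algebra = record
    { commutativeRing = ℂ-commutativeRing
    ; ι      = ιᶜ
    ; +-homo = λ m n → by (ιᶜ (m ℤ.+ n)) (ιᶜ m + ιᶜ n) (λ _ → fromℤ-+ m n) (λ _ → refl)
    ; *-homo = λ m n → by (ιᶜ (m ℤ.* n)) (ιᶜ m * ιᶜ n)
        (λ _ → trans (fromℤ-* m n) (solve 2 (λ a b → a :* b := a :* b :+ :- (con 0ℚ :* con 0ℚ)) refl (fromℤ m) (fromℤ n)))
        (λ _ → solve 2 (λ a b → con 0ℚ := a :* con 0ℚ :+ con 0ℚ :* b) refl (fromℤ m) (fromℤ n))
    ; -‿homo = λ m → by (ιᶜ (ℤ.- m)) (- ιᶜ m) (λ _ → fromℤ-neg m) (λ _ → refl)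
    ; 0-homo = by (ιᶜ (ℤ.+ 0)) 0ᶜ (λ _ → refl) (λ _ → refl)
    ; 1-homo = by (ιᶜ (ℤ.+ 1)) 1ᶜ (λ _ → refl) (λ _ → refl)
    }

-- Inequalities between rationals.

module RationalBounds where
  open import Data.Rational.Base
  open import Data.Rational.Properties
  open import Data.Rational.Solver using (module +-*-Solver)
  open import Relation.Binary.Definitions using (tri<; tri≈; tri>)
  open import Relation.Binary.PropositionalEquality
  open +-*-Solver

  p≤∣p∣ : ∀ p → p ≤ ∣ p ∣
  p≤∣p∣ p with ≤-total 0ℚ p
  ... | inj₁ 0≤p = ≤-reflexive (sym (0≤p⇒∣p∣≡p 0≤p))
  ... | inj₂ p≤0 = ≤-trans p≤0 (0≤∣p∣ p)

  -p≤∣p∣ : ∀ p → - p ≤ ∣ p ∣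
  -p≤∣p∣ p = subst (- p ≤_) (∣-p∣≡∣p∣ p) (p≤∣p∣ (- p))

  ∣p∣<⇒ : ∀ {p ε} → ∣ p ∣ < ε → - ε < p × p < ε
  ∣p∣<⇒ {p} {ε} h =
    subst (- ε <_) (solve 1 (λ p → :- (:- p) := p) refl p) (neg-antimono-< (≤-<-trans (-p≤∣p∣ p) h)) ,
    ≤-<-trans (p≤∣p∣ p) h

  ⇒∣p∣< : ∀ {p ε} → - ε < p → p < ε → ∣ p ∣ < ε
  ⇒∣p∣< {p} {ε} l u with ∣p∣≡p∨∣p∣≡-p p
  ... | inj₁ ∣p∣≡p  = subst (_< ε) (sym ∣p∣≡p) u
  ... | inj₂ ∣p∣≡-p = subst₂ _<_ (sym ∣p∣≡-p) (solve 1 (λ p → :- (:- p) := p) refl ε) (neg-antimono-< l)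

  <⇒0<- : ∀ {p q} → p < q → 0ℚ < q - p
  <⇒0<- {p} {q} h = subst (_< q - p) (+-inverseʳ p) (+-monoˡ-< (- p) h)

  0<-⇒< : ∀ {p q} → 0ℚ < q - p → p < q
  0<-⇒< {p} {q} h = subst₂ _<_ (+-identityˡ p) (solve 2 (λ p q → (q :- p) :+ p := q) refl p q) (+-monoˡ-< p h)

  0≤p*p : ∀ p → 0ℚ ≤ p * p
  0≤p*p p with ≤-total 0ℚ p
  ... | inj₁ 0≤p = subst (_≤ p * p) (*-zeroʳ p) (*-monoˡ-≤-nonNeg p {{nonNegative 0≤p}} 0≤p)
  ... | inj₂ p≤0 = subst (_≤ p * p) (*-zeroʳ p) (*-monoˡ-≤-nonPos p {{nonPositive p≤0}} p≤0)

  *-pos : ∀ {p q} → 0ℚ < p → 0ℚ < q → 0ℚ < p * q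
  *-pos {p} {q} 0<p 0<q = subst (_< p * q) (*-zeroʳ p) (*-monoʳ-<-pos p {{positive 0<p}} 0<q)

  *-mono-nonNeg : ∀ {a b c d} → 0ℚ ≤ b → 0ℚ ≤ c → a ≤ b → c ≤ d → a * c ≤ b * d
  *-mono-nonNeg {a} {b} {c} {d} 0≤b 0≤c a≤b c≤d =
    ≤-trans (*-monoʳ-≤-nonNeg c {{nonNegative 0≤c}} a≤b) (*-monoˡ-≤-nonNeg b {{nonNegative 0≤b}} c≤d)

  ½<√ : ∀ {a} → 0ℚ ≤ a → ½ * ½ < a * a → ½ < a
  ½<√ {a} 0≤a h with <-cmp ½ a
  ... | tri< l _ _ = l
  ... | tri≈ _ refl _ = contradiction h (<-irrefl refl)
  ... | tri> _ _ g = contradiction (<-≤-trans h (*-mono-nonNeg {a} {½} {a} {½} (<⇒≤ (positive⁻¹ ½)) 0≤a (<⇒≤ g) (<⇒≤ g))) (<-irrefl refl)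

-- Idempotents from square roots of one.

module SquareRootsOfUnity where
  open RootsOfUnity using (CharacteristicZero)

  module _ (A : ℤ-Algebra) where
    open ℤ-Algebra A
    open Solver using (solve; con; _:+_; _:*_; _:-_; :-_; _:=_)
    open import Algebra.Properties.Ring ring using (x∙y⁻¹≈ε⇒x≈y)
    open import Relation.Binary.Reasoning.Setoid setoid

    multiple≈0 : ∀ {r z z̄ y} → z * z̄ ≈ r → z * y ≈ 0# → r * y ≈ 0#
    multiple≈0 {r} {z} {z̄} {y} zz̄≈r zy≈0 = begin
      r * y            ≈⟨ *-congʳ zz̄≈r ⟨
      (z * z̄) * y      ≈⟨ solve 3 (λ a b c → (a :* b) :* c := b :* (a :* c)) refl z z̄ y ⟩
      z̄ * (z * y)      ≈⟨ *-congˡ zy≈0 ⟩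
      z̄ * 0#           ≈⟨ zeroʳ z̄ ⟩
      0#               ∎

    f-1-factor : ∀ {f} → f * f ≈ 1# → (f + 1#) * (f - 1#) ≈ 0#
    f-1-factor {f} f²≈1 = begin
      (f + 1#) * (f - 1#)     ≈⟨ solve 2 (λ f o → (f :+ o) :* (f :- o) := f :* f :- o :* o) refl f 1# ⟩
      f * f - 1# * 1#         ≈⟨ +-cong f²≈1 (-‿cong (*-identityˡ 1#)) ⟩
      1# - 1#                 ≈⟨ -‿inverseʳ 1# ⟩
      0#                      ∎

    f+1-factor : ∀ {f} → f * f ≈ 1# → (- f + 1#) * (f + 1#) ≈ 0#
    f+1-factor {f} f²≈1 = begin
      (- f + 1#) * (f + 1#)   ≈⟨ solve 2 (λ f o → (:- f :+ o) :* (f :+ o) := o :* o :- f :* f) refl f 1# ⟩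
      1# * 1# - f * f         ≈⟨ +-cong (*-identityˡ 1#) (-‿cong f²≈1) ⟩
      1# - 1#                 ≈⟨ -‿inverseʳ 1# ⟩
      0#                      ∎

    f-1≈0⇒f≈1 : ∀ {f} → f - 1# ≈ 0# → f ≈ 1#
    f-1≈0⇒f≈1 = x∙y⁻¹≈ε⇒x≈y _ _

    f+1≈0⇒f≈-1 : ∀ {f} → f + 1# ≈ 0# → f ≈ - 1#
    f+1≈0⇒f≈-1 {f} h = begin
      f                 ≈⟨ solve 2 (λ f o → f := (f :+ o) :- o) refl f 1# ⟩
      (f + 1#) - 1#     ≈⟨ +-congʳ h ⟩
      0# - 1#           ≈⟨ +-identityˡ _ ⟩
      - 1#              ∎

    characteristicZero : ¬ 1# ≈ 0# → (∀ n → n ≢ ℤ.+ 0 → ∃ λ r → r * ι n ≈ 1#) →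
                         (∀ {f} → f * f ≈ 1# → f ≈ 1# ⊎ f ≈ - 1#) → CharacteristicZero A
    characteristicZero 1≉0 inverse square-root = record { torsion-free = torsion-free ; 1≉0 = 1≉0 ; dichotomy = dichotomy }
      where
      torsion-free : ∀ n x → n ≢ ℤ.+ 0 → ι n * x ≈ 0# → x ≈ 0#
      torsion-free n x n≢0 nx≈0 = let r , rn≈1 = inverse n n≢0 in begin
        x                ≈⟨ *-identityˡ x ⟨
        1# * x           ≈⟨ *-congʳ rn≈1 ⟨
        (r * ι n) * x    ≈⟨ *-assoc r (ι n) x ⟩
        r * (ι n * x)    ≈⟨ *-congˡ nx≈0 ⟩
        r * 0#           ≈⟨ zeroʳ r ⟩
        0#               ∎

      -- If e = x/n is idempotent, then 2e − 1 is a square root of 1.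
      dichotomy : ∀ n x → n ≢ ℤ.+ 0 → x * x ≈ ι n * x → x ≈ 0# ⊎ x ≈ ι n
      dichotomy n x n≢0 x²≈nx = cases (square-root {f} f²≈1)
        where
        r = proj₁ (inverse n n≢0)
        rn≈1 : r * ι n ≈ 1#
        rn≈1 = proj₂ (inverse n n≢0)
        e = r * x
        f = (e + e) - 1#
        e²≈e : e * e ≈ e
        e²≈e = begin
          (r * x) * (r * x)      ≈⟨ solve 2 (λ r x → (r :* x) :* (r :* x) := (r :* r) :* (x :* x)) refl r x ⟩
          (r * r) * (x * x)      ≈⟨ *-congˡ x²≈nx ⟩
          (r * r) * (ι n * x)    ≈⟨ solve 3 (λ r n x → (r :* r) :* (n :* x) := (r :* n) :* (r :* x)) refl r (ι n) x ⟩
          (r * ι n) * (r * x)    ≈⟨ *-congʳ rn≈1 ⟩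
          1# * (r * x)           ≈⟨ *-identityˡ (r * x) ⟩
          r * x                  ∎
        f²≈1 : f * f ≈ 1#
        f²≈1 = begin
          f * f
            ≈⟨ solve 2 (λ e o → ((e :+ e) :- o) :* ((e :+ e) :- o) := (e :* e :+ e :* e :+ e :* e :+ e :* e) :- (e :+ e :+ e :+ e) :* o :+ o :* o) refl e 1# ⟩
          ((e * e + e * e + e * e + e * e) - ((e + e + e + e) * 1#)) + 1# * 1#
            ≈⟨ +-cong (+-cong (+-cong (+-cong (+-cong e²≈e e²≈e) e²≈e) e²≈e) (-‿cong (*-identityʳ _))) (*-identityˡ 1#) ⟩
          ((e + e + e + e) - (e + e + e + e)) + 1#
            ≈⟨ +-congʳ (-‿inverseʳ (e + e + e + e)) ⟩
          0# + 1#
            ≈⟨ +-identityˡ 1# ⟩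
          1# ∎
        ne≈x : ι n * e ≈ x
        ne≈x = begin
          ι n * (r * x)    ≈⟨ solve 3 (λ n r x → n :* (r :* x) := (r :* n) :* x) refl (ι n) r x ⟩
          (r * ι n) * x    ≈⟨ *-congʳ rn≈1 ⟩
          1# * x           ≈⟨ *-identityˡ x ⟩
          x                ∎
        halve : ∀ {y z} → y + y ≈ z + z → y ≈ z
        halve {y} {z} h = begin
          y               ≈⟨ solve 2 (λ y z → y := (y :- z) :+ z) refl y z ⟩
          (y - z) + z   ≈⟨ +-congʳ (torsion-free (ℤ.+ 2) (y - z) (λ ()) (begin
            ι (ℤ.+ 2) * (y - z)    ≈⟨ solve 2 (λ y z → con (ℤ.+ 2) :* (y :- z) := (y :+ y) :- (z :+ z)) refl y z ⟩
            (y + y) - (z + z)      ≈⟨ +-congʳ h ⟩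
            (z + z) - (z + z)      ≈⟨ -‿inverseʳ (z + z) ⟩
            0#                       ∎)) ⟩
          0# + z          ≈⟨ +-identityˡ z ⟩
          z               ∎
        2e : e + e ≈ f + 1#
        2e = solve 2 (λ e o → e :+ e := ((e :+ e) :- o) :+ o) refl e 1#
        cases : f ≈ 1# ⊎ f ≈ - 1# → x ≈ 0# ⊎ x ≈ ι n
        cases (inj₁ f≈1) = inj₂ (begin
          x            ≈⟨ ne≈x ⟨
          ι n * e      ≈⟨ *-congˡ (halve {e} {1#} (trans 2e (+-congʳ f≈1))) ⟩
          ι n * 1#     ≈⟨ *-identityʳ (ι n) ⟩
          ι n          ∎)
        cases (inj₂ f≈-1) = inj₁ (begin
          x            ≈⟨ ne≈x ⟨
          ι n * e      ≈⟨ *-congˡ (halve {e} {0#} (trans 2e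
                            (trans (+-congʳ f≈-1) (trans (-‿inverseˡ 1#) (sym (+-identityˡ 0#)))))) ⟩
          ι n * 0#     ≈⟨ zeroʳ (ι n) ⟩
          0#           ∎)

-- Complex square roots of one are ±1.

module ComplexCharacteristic where
  open import Defs
  open import Data.Rational.Base using (∣_∣)
  open import Data.Rational.Solver using (module +-*-Solver)
  open RationalLemmas
  open RationalBounds
  open EventualProperties
  open RealEquality
  open ComplexRing using (ℂ-algebra; ≈-pointwise; ≈-trans; ≈-sym)
  open RootsOfUnity using (CharacteristicZero)
  open SquareRootsOfUnity
  open ℤ-Algebra ℂ-algebra using (ι)

  real : ℝ → ℂ
  real r = r +i 0ʳ

  real-bounded-below-cancel : ∀ {y : ℝ} {s : ℝ} {c} → 0ℚ ℚ.< c → Eventually (λ n → c ℚ.≤ seq s n) →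
                              (s *ʳ y) ≈ʳ 0ʳ → y ≈ʳ 0ʳ
  real-bounded-below-cancel {y} {s} {c} 0<c c≤s sy≈0 ε ε>0 = map-eventually
    (λ { n (c≤sn , syn) → subst (ℚ._< ε) (≡.cong ∣_∣ (≡.sym (ℚ.+-identityʳ (seq y n))))
      (ℚ.*-cancelˡ-<-nonNeg c {{ℚ.nonNegative (ℚ.<⇒≤ 0<c)}} (ℚ.≤-<-trans (bound n c≤sn) (subst (ℚ._< c ℚ.* ε) (≡.cong ∣_∣ (ℚ.+-identityʳ (seq s n ℚ.* seq y n))) syn))) })
    (both c≤s (sy≈0 (c ℚ.* ε) (*-pos 0<c ε>0)))
    where
    bound : ∀ n → c ℚ.≤ seq s n → c ℚ.* ∣ seq y n ∣ ℚ.≤ ∣ seq s n ℚ.* seq y n ∣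
    bound n c≤sn = ℚ.≤-trans (ℚ.*-monoʳ-≤-nonNeg ∣ seq y n ∣ {{ℚ.∣-∣-nonNeg (seq y n)}} (ℚ.≤-trans c≤sn (p≤∣p∣ (seq s n))))
      (ℚ.≤-reflexive (≡.sym (ℚ.∣p*q∣≡∣p∣*∣q∣ (seq s n) (seq y n))))

  norm² : ℂ → ℝ
  norm² z = re z *ʳ re z +ʳ im z *ʳ im z

  *-conj : ∀ z → z * conj z ≈ real (norm² z)
  *-conj z = ≈-pointwise {z * conj z} {real (norm² z)}
    (λ n → Q.solve 2 (λ a b → a Q.:* a Q.:+ Q.:- (b Q.:* (Q.:- b)) Q.:= a Q.:* a Q.:+ b Q.:* b) ≡.refl (seq (re z) n) (seq (im z) n))
    (λ n → Q.solve 2 (λ a b → a Q.:* (Q.:- b) Q.:+ b Q.:* a Q.:= Q.con 0ℚ) ≡.refl (seq (re z) n) (seq (im z) n))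
    where module Q = +-*-Solver

  real-* : ∀ r z → real r * z ≈ (r *ʳ re z) +i (r *ʳ im z)
  real-* r z = ≈-pointwise {real r * z} {(r *ʳ re z) +i (r *ʳ im z)}
    (λ n → Q.solve 3 (λ r a b → r Q.:* a Q.:+ Q.:- (Q.con 0ℚ Q.:* b) Q.:= r Q.:* a) ≡.refl (seq r n) (seq (re z) n) (seq (im z) n))
    (λ n → Q.solve 3 (λ r a b → r Q.:* b Q.:+ Q.con 0ℚ Q.:* a Q.:= r Q.:* b) ≡.refl (seq r n) (seq (re z) n) (seq (im z) n))
    where module Q = +-*-Solver

  -- Multiplying by the conjugate replaces z by its real squared modulus, which is at least c² and
  -- therefore cancels in each coordinate.
  positive-real-part-cancel : ∀ {y z c} → 0ℚ ℚ.< c → Eventually (λ n → c ℚ.≤ seq (re z) n) → z * y ≈ 0ᶜ → y ≈ 0ᶜ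
  positive-real-part-cancel {y} {z} {c} 0<c c≤z zy≈0 =
    real-bounded-below-cancel {re y} {norm² z} {c ℚ.* c} (*-pos 0<c 0<c) c²≤ (proj₁ product≈0) ,
    real-bounded-below-cancel {im y} {norm² z} {c ℚ.* c} (*-pos 0<c 0<c) c²≤ (proj₂ product≈0)
    where
    c²≤ : Eventually (λ n → c ℚ.* c ℚ.≤ seq (norm² z) n)
    c²≤ = map-eventually (λ n c≤a → ℚ.≤-trans (ℚ.≤-trans (*-mono-nonNeg (ℚ.≤-trans (ℚ.<⇒≤ 0<c) c≤a) (ℚ.<⇒≤ 0<c) c≤a c≤a)
      (ℚ.≤-reflexive (≡.sym (ℚ.+-identityʳ _)))) (ℚ.+-monoʳ-≤ (seq (re z) n ℚ.* seq (re z) n) (0≤p*p (seq (im z) n)))) c≤z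
    product≈0 : ((norm² z *ʳ re y) +i (norm² z *ʳ im y)) ≈ 0ᶜ
    product≈0 = ≈-trans {(norm² z *ʳ re y) +i (norm² z *ʳ im y)} {real (norm² z) * y} {0ᶜ}
      (≈-sym {real (norm² z) * y} {(norm² z *ʳ re y) +i (norm² z *ʳ im y)} (real-* (norm² z) y))
      (multiple≈0 ℂ-algebra {real (norm² z)} {z} {conj z} {y} (*-conj z) zy≈0)

  -- The first term exceeds ½ and later ones differ from it by less than ½, so they are positive; a
  -- positive number with square above ¼ exceeds ½.
  stays-positive : ∀ (s : ℕ → ℚ) K → (∀ n → K ℕ.≤ n → ½ ℚ.* ½ ℚ.< s n ℚ.* s n) →
                   (∀ n → K ℕ.≤ n → ∣ s K ℚ.- s n ∣ ℚ.< ½) → 0ℚ ℚ.≤ s K → ∀ n → K ℕ.≤ n → ½ ℚ.< s n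
  stays-positive s K large close 0≤sK n K≤n = ½<√ (ℚ.<⇒≤ 0<sn) (large n K≤n)
    where
    0<sn : 0ℚ ℚ.< s n
    0<sn = 0<-⇒< (subst (0ℚ ℚ.<_) (Q.solve 3 (λ h a b → (a Q.:- h) Q.:+ (h Q.:- (a Q.:- b)) Q.:= b Q.:- Q.con 0ℚ) ≡.refl ½ (s K) (s n))
      (ℚ.+-mono-< {0ℚ} {_} {0ℚ} (<⇒0<- (½<√ 0≤sK (large K ℕ.≤-refl))) (<⇒0<- (proj₂ (∣p∣<⇒ (close n K≤n))))))
      where module Q = +-*-Solver

  -- Once a² - b² is within ¼ of 1, the real part satisfies a² > ¼ and cannot cross zero. The sign
  -- of a single rational term then decides between the two roots, although equality of reals is
  -- undecidable.
  square-root-sign : ∀ {f} → f * f ≈ 1ᶜ →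
    Eventually (λ n → ½ ℚ.≤ seq (re f) n) ⊎ Eventually (λ n → ½ ℚ.≤ ℚ.- seq (re f) n)
  square-root-sign {f} f²≈1 = sign (proj₁ f²≈1 (½ ℚ.* ½) (half>0 (ℚ.positive⁻¹ ½))) (cauchy (re f) ½ (ℚ.positive⁻¹ ½))
    where
    module Q = +-*-Solver
    a b : ℕ → ℚ
    a = seq (re f)
    b = seq (im f)
    large : ∀ n → ∣ (a n ℚ.* a n ℚ.+ ℚ.- (b n ℚ.* b n)) ℚ.- 1ℚ ∣ ℚ.< ½ ℚ.* ½ → ½ ℚ.* ½ ℚ.< a n ℚ.* a n
    large n h = ℚ.<-trans (ℚ.<-≤-trans (½*½<¾) (ℚ.≤-trans (ℚ.≤-reflexive (≡.sym (ℚ.+-identityˡ _))) (ℚ.+-monoˡ-≤ (1ℚ ℚ.- ½ ℚ.* ½) (0≤p*p (b n)))))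
      (0<-⇒< (subst (0ℚ ℚ.<_) (Q.solve 3 (λ h a b → (a Q.:- b Q.:- Q.con 1ℚ) Q.:- (Q.:- h) Q.:= a Q.:- (b Q.:+ (Q.con 1ℚ Q.:- h))) ≡.refl (½ ℚ.* ½) (a n ℚ.* a n) (b n ℚ.* b n))
        (<⇒0<- (proj₁ (∣p∣<⇒ h)))))
      where
      ½*½<¾ : ½ ℚ.* ½ ℚ.< 1ℚ ℚ.- ½ ℚ.* ½
      ½*½<¾ = ℚ.*<* (ℤ.+<+ (ℕ.s≤s (ℕ.s≤s (ℕ.s≤s (ℕ.s≤s (ℕ.s≤s ℕ.z≤n))))))
    sign : Eventually _ → (∃ λ M → ∀ m n → M ℕ.≤ m → M ℕ.≤ n → ∣ a m ℚ.- a n ∣ ℚ.< ½) → _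
    sign (N , h) (M , close) = cases (ℚ.≤-total 0ℚ (a K))
      where
      K = N ℕ.⊔ M
      N≤ : ∀ {n} → K ℕ.≤ n → N ℕ.≤ n
      N≤ = ℕ.m⊔n≤o⇒m≤o N M
      M≤ : ∀ {n} → K ℕ.≤ n → M ℕ.≤ n
      M≤ = ℕ.m⊔n≤o⇒n≤o N M
      cases : _ → Eventually (λ n → ½ ℚ.≤ a n) ⊎ Eventually (λ n → ½ ℚ.≤ ℚ.- a n)
      cases (inj₁ 0≤a) = inj₁ (K , λ n K≤n → ℚ.<⇒≤ (stays-positive a K (λ n K≤n → large n (h n (N≤ K≤n)))
        (λ n K≤n → close K n (M≤ ℕ.≤-refl) (M≤ K≤n)) 0≤a n K≤n))
      cases (inj₂ a≤0) = inj₂ (K , λ n K≤n → ℚ.<⇒≤ (stays-positive (λ n → ℚ.- a n) K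
        (λ n K≤n → subst (½ ℚ.* ½ ℚ.<_) (Q.solve 1 (λ a → a Q.:* a Q.:= (Q.:- a) Q.:* (Q.:- a)) ≡.refl (a n)) (large n (h n (N≤ K≤n))))
        (λ n K≤n → subst (ℚ._< ½) (≡.trans (≡.sym (ℚ.∣-p∣≡∣p∣ (a K ℚ.- a n))) (≡.cong ∣_∣ (Q.solve 2 (λ a b → Q.:- (a Q.:- b) Q.:= (Q.:- a) Q.:- (Q.:- b)) ≡.refl (a K) (a n))))
          (close K n (M≤ ℕ.≤-refl) (M≤ K≤n))) (ℚ.neg-antimono-≤ a≤0) n K≤n))

  -- With the sign known, one of f + 1 and -f + 1 has real part at least 1 eventually, so it cancels
  -- from the factorisation of f² - 1.
  square-root-of-unity : ∀ {f} → f * f ≈ 1ᶜ → f ≈ 1ᶜ ⊎ f ≈ - 1ᶜ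
  square-root-of-unity {f} f²≈1 = cases (square-root-sign {f} f²≈1)
    where
    add-one : ∀ {a} → ½ ℚ.≤ a → 1ℚ ℚ.≤ a ℚ.+ 1ℚ
    add-one {a} h = ℚ.≤-trans (ℚ.≤-reflexive (≡.sym (ℚ.+-identityˡ 1ℚ))) (ℚ.+-monoˡ-≤ 1ℚ (ℚ.≤-trans (ℚ.<⇒≤ (ℚ.positive⁻¹ ½)) h))
    cases : _ → f ≈ 1ᶜ ⊎ f ≈ - 1ᶜ
    cases (inj₁ ½≤a)  = inj₁ (f-1≈0⇒f≈1 ℂ-algebra {f}
      (positive-real-part-cancel {f + - 1ᶜ} {f + 1ᶜ} (ℚ.positive⁻¹ 1ℚ) (map-eventually (λ n → add-one) ½≤a) (f-1-factor ℂ-algebra {f} f²≈1)))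
    cases (inj₂ ½≤-a) = inj₂ (f+1≈0⇒f≈-1 ℂ-algebra {f}
      (positive-real-part-cancel {f + 1ᶜ} { - f + 1ᶜ} (ℚ.positive⁻¹ 1ℚ) (map-eventually (λ n → add-one) ½≤-a) (f+1-factor ℂ-algebra {f} f²≈1)))

  inverse : ∀ n → n ≢ ℤ.+ 0 → ∃ λ r → r * ι n ≈ 1ᶜ
  inverse n n≢0 = real (fromℚ (ℚ.1/ fromℤ n)) , ≈-pointwise {real (fromℚ (ℚ.1/ fromℤ n)) * ι n} {1ᶜ}
    (λ _ → ≡.trans (Q.solve 2 (λ a b → a Q.:* b Q.:+ Q.:- (Q.con 0ℚ Q.:* Q.con 0ℚ) Q.:= a Q.:* b) ≡.refl (ℚ.1/ fromℤ n) (fromℤ n)) (ℚ.*-inverseˡ (fromℤ n)))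
    (λ _ → Q.solve 2 (λ a b → a Q.:* Q.con 0ℚ Q.:+ Q.con 0ℚ Q.:* b Q.:= Q.con 0ℚ) ≡.refl (ℚ.1/ fromℤ n) (fromℤ n))
    where
    module Q = +-*-Solver
    instance _ = ℤ.≢-nonZero n≢0

  1≉0 : ¬ 1ᶜ ≈ 0ᶜ
  1≉0 (h , _) with h 1ℚ (ℚ.positive⁻¹ 1ℚ)
  ... | N , close = ℚ.<-irrefl ≡.refl (close N ℕ.≤-refl)

  ℂ-characteristicZero : CharacteristicZero ℂ-algebra
  ℂ-characteristicZero = characteristicZero ℂ-algebra 1≉0 inverse (λ {f} → square-root-of-unity {f})

-- Cauchy products and the coefficients of exponential series.

module ExponentialSequences where
  open RootsOfUnity using (CharacteristicZero)

  module Sequences (A : ℤ-Algebra) where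
    open ℤ-Algebra A
    open FiniteSums A using (ι-suc)
    open import Algebra.Properties.Semiring.Sum semiring using (sum; sum-cong-≋; ∑-distrib-+; *-distribˡ-sum)
    open import Algebra.Properties.Ring ring using (x∙y⁻¹≈ε⇒x≈y)
    open import Relation.Binary.Reasoning.Setoid setoid
    open Solver using (solve; _:+_; _:*_; _:-_; :-_; _:=_)

    S : ℕ → (ℕ → Carrier) → Carrier
    S n a = sum {n} (λ k → a (toℕ k))

    S-cong : ∀ n {a b} → (∀ k → a k ≈ b k) → S n a ≈ S n b
    S-cong n h = sum-cong-≋ {n} (λ k → h (toℕ k))

    conv : (ℕ → Carrier) → (ℕ → Carrier) → ℕ → Carrier
    conv a b zero    = a 0 * b 0
    conv a b (suc n) = a 0 * b (suc n) + conv (a ∘ ℕ.suc) b n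

    -- The products a i · b k with i < n, k < n + j and i + k ≥ n: what the product of two partial
    -- sums contains beyond the Cauchy product. Shifting `a` lowers n and raises j, so the range of
    -- k stays fixed.
    excess : (ℕ → Carrier) → (ℕ → Carrier) → ℕ → ℕ → Carrier
    excess a b zero    j = 0#
    excess a b (suc n) j = a 0 * S j (λ i → b (suc n ℕ.+ i)) + excess (a ∘ ℕ.suc) b n (suc j)

    S-+ : ∀ n j b → S (n ℕ.+ j) b ≈ S n b + S j (λ i → b (n ℕ.+ i))
    S-+ zero    j b = sym (+-identityˡ _)
    S-+ (suc n) j b = trans (+-congˡ (S-+ n j (b ∘ ℕ.suc))) (sym (+-assoc _ _ _))

    S-conv : ∀ n a b → S (suc n) (conv a b) ≈ a 0 * S (suc n) b + S n (conv (a ∘ ℕ.suc) b)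
    S-conv n a b = begin
      a 0 * b 0 + S n (λ k → a 0 * b (suc k) + conv (a ∘ ℕ.suc) b k)
        ≈⟨ +-congˡ (∑-distrib-+ {n} _ _) ⟩
      a 0 * b 0 + (S n (λ k → a 0 * b (suc k)) + S n (conv (a ∘ ℕ.suc) b))
        ≈⟨ +-congˡ (+-congʳ (sym (*-distribˡ-sum {n} (a 0) (λ k → b (suc (toℕ k)))))) ⟩
      a 0 * b 0 + (a 0 * S n (b ∘ ℕ.suc) + S n (conv (a ∘ ℕ.suc) b))
        ≈⟨ solve 4 (λ a b s t → a :* b :+ (a :* s :+ t) := a :* (b :+ s) :+ t) refl _ _ _ _ ⟩
      a 0 * S (suc n) b + S n (conv (a ∘ ℕ.suc) b) ∎

    S-product : ∀ n j a b → S n a * S (n ℕ.+ j) b ≈ S n (conv a b) + excess a b n j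
    S-product zero    j a b = trans (zeroˡ _) (sym (+-identityˡ _))
    S-product (suc n) j a b = begin
      (a 0 + S n (a ∘ ℕ.suc)) * S (suc n ℕ.+ j) b
        ≈⟨ distribʳ _ _ _ ⟩
      a 0 * S (suc n ℕ.+ j) b + S n (a ∘ ℕ.suc) * S (suc n ℕ.+ j) b
        ≈⟨ +-cong (*-congˡ (S-+ (suc n) j b)) (trans (*-congˡ (reflexive (≡.cong (λ k → S k b) (≡.sym (ℕ.+-suc n j))))) (S-product n (suc j) (a ∘ ℕ.suc) b)) ⟩
      a 0 * (S (suc n) b + S j (λ i → b (suc n ℕ.+ i))) + (S n (conv (a ∘ ℕ.suc) b) + excess (a ∘ ℕ.suc) b n (suc j))
        ≈⟨ solve 5 (λ a s t u v → a :* (s :+ t) :+ (u :+ v) := (a :* s :+ u) :+ (a :* t :+ v)) refl _ _ _ _ _ ⟩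
      (a 0 * S (suc n) b + S n (conv (a ∘ ℕ.suc) b)) + excess a b (suc n) j
        ≈⟨ +-congʳ (S-conv n a b) ⟨
      S (suc n) (conv a b) + excess a b (suc n) j ∎

    derivative : (ℕ → Carrier) → ℕ → Carrier
    derivative a k = ι (ℤ.+ suc k) * a (suc k)

    conv-congˡ : ∀ {a a′} b n → (∀ k → a k ≈ a′ k) → conv a b n ≈ conv a′ b n
    conv-congˡ b zero    h = *-congʳ (h 0)
    conv-congˡ b (suc n) h = +-cong (*-congʳ (h 0)) (conv-congˡ b n (h ∘ ℕ.suc))

    conv-congʳ : ∀ a {b b′} n → (∀ k → b k ≈ b′ k) → conv a b n ≈ conv a b′ n
    conv-congʳ a zero    h = *-congˡ (h 0)
    conv-congʳ a (suc n) h = +-cong (*-congˡ (h (suc n))) (conv-congʳ (a ∘ ℕ.suc) n h)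

    conv-+ˡ : ∀ a a′ b n → conv (λ k → a k + a′ k) b n ≈ conv a b n + conv a′ b n
    conv-+ˡ a a′ b zero    = distribʳ _ _ _
    conv-+ˡ a a′ b (suc n) = trans (+-cong (distribʳ _ _ _) (conv-+ˡ (a ∘ ℕ.suc) (a′ ∘ ℕ.suc) b n))
      (solve 4 (λ s t u v → (s :+ t) :+ (u :+ v) := (s :+ u) :+ (t :+ v)) refl _ _ _ _)

    conv-*ˡ : ∀ x a b n → conv (λ k → x * a k) b n ≈ x * conv a b n
    conv-*ˡ x a b zero    = *-assoc _ _ _
    conv-*ˡ x a b (suc n) = trans (+-cong (*-assoc _ _ _) (conv-*ˡ x (a ∘ ℕ.suc) b n)) (sym (distribˡ _ _ _))

    conv-*ʳ : ∀ x a b n → conv a (λ k → x * b k) n ≈ x * conv a b n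
    conv-*ʳ x a b zero    = solve 3 (λ a x b → a :* (x :* b) := x :* (a :* b)) refl _ _ _
    conv-*ʳ x a b (suc n) = trans (+-congˡ (conv-*ʳ x (a ∘ ℕ.suc) b n))
      (solve 4 (λ a x b t → a :* (x :* b) :+ x :* t := x :* (a :* b :+ t)) refl _ _ _ _)

    leibniz : ∀ a b n → derivative (conv a b) n ≈ conv (derivative a) b n + conv a (derivative b) n
    leibniz a b zero    = solve 5 (λ o a b c d → o :* (a :* d :+ c :* b) := (o :* c) :* b :+ a :* (o :* d)) refl (ι (ℤ.+ 1)) (a 0) (b 0) (a 1) (b 1)
    leibniz a b (suc n) = begin
      ι (ℤ.+ suc (suc n)) * (a 0 * b (suc (suc n)) + conv (a ∘ ℕ.suc) b (suc n))
        ≈⟨ trans (distribˡ _ _ _) (+-congˡ (trans (*-congʳ (+-homo (ℤ.+ 1) (ℤ.+ suc n))) (distribʳ _ _ _))) ⟩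
      ι (ℤ.+ suc (suc n)) * (a 0 * b (suc (suc n))) + (ι (ℤ.+ 1) * conv (a ∘ ℕ.suc) b (suc n) + derivative (conv (a ∘ ℕ.suc) b) n)
        ≈⟨ +-congˡ (+-congˡ (leibniz (a ∘ ℕ.suc) b n)) ⟩
      ι (ℤ.+ suc (suc n)) * (a 0 * b (suc (suc n))) + (ι (ℤ.+ 1) * (a 1 * b (suc n) + conv (a ∘ ℕ.suc ∘ ℕ.suc) b n)
        + (conv (derivative (a ∘ ℕ.suc)) b n + conv (a ∘ ℕ.suc) (derivative b) n))
        ≈⟨ solve 9 (λ i a b o c d s u v → i :* (a :* b) :+ (o :* (c :* d :+ s) :+ (u :+ v)) := ((o :* c) :* d :+ (o :* s :+ u)) :+ (a :* (i :* b) :+ v))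
             refl (ι (ℤ.+ suc (suc n))) (a 0) (b (suc (suc n))) (ι (ℤ.+ 1)) (a 1) (b (suc n)) (conv (a ∘ ℕ.suc ∘ ℕ.suc) b n)
             (conv (derivative (a ∘ ℕ.suc)) b n) (conv (a ∘ ℕ.suc) (derivative b) n) ⟩
      (derivative a 0 * b (suc n) + (ι (ℤ.+ 1) * conv (a ∘ ℕ.suc ∘ ℕ.suc) b n + conv (derivative (a ∘ ℕ.suc)) b n)) + conv a (derivative b) (suc n)
        ≈⟨ +-congʳ (+-congˡ (trans (conv-congˡ b n (λ k → trans (*-congʳ (+-homo (ℤ.+ 1) (ℤ.+ suc k))) (distribʳ _ _ _)))
             (trans (conv-+ˡ (λ k → ι (ℤ.+ 1) * a (suc (suc k))) (derivative (a ∘ ℕ.suc)) b n) (+-congʳ (conv-*ˡ (ι (ℤ.+ 1)) (a ∘ ℕ.suc ∘ ℕ.suc) b n))))) ⟨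
      conv (derivative a) b (suc n) + conv a (derivative b) (suc n) ∎

    -- The coefficients of e^(xT), characterised by the differential equation y′ = x y with y(0) =
    -- 1. The product rule and uniqueness then give e^x e^y = e^(x+y) without manipulating
    -- factorials.
    IsExponential : Carrier → (ℕ → Carrier) → Set
    IsExponential x a = a 0 ≈ 1# × ∀ k → derivative a k ≈ x * a k

    conv-exponential : ∀ {x y a b} → IsExponential x a → IsExponential y b → IsExponential (x + y) (conv a b)
    conv-exponential {x} {y} {a} {b} (a₀ , a′) (b₀ , b′) = trans (*-cong a₀ b₀) (*-identityˡ 1#) , λ n → begin
      derivative (conv a b) n                                  ≈⟨ leibniz a b n ⟩
      conv (derivative a) b n + conv a (derivative b) n        ≈⟨ +-cong (conv-congˡ b n a′) (conv-congʳ a n b′) ⟩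
      conv (λ k → x * a k) b n + conv a (λ k → y * b k) n      ≈⟨ +-cong (conv-*ˡ x a b n) (conv-*ʳ y a b n) ⟩
      x * conv a b n + y * conv a b n                          ≈⟨ distribʳ _ x y ⟨
      (x + y) * conv a b n                                     ∎

    exponential-unique : CharacteristicZero A → ∀ {x a b} → IsExponential x a → IsExponential x b → ∀ k → a k ≈ b k
    exponential-unique char0 (a₀ , _) (b₀ , _) zero = trans a₀ (sym b₀)
    exponential-unique char0 {x} {a} {b} ea@(_ , a′) eb@(_ , b′) (suc k) =
      x∙y⁻¹≈ε⇒x≈y _ _ (CharacteristicZero.torsion-free char0 (ℤ.+ suc k) (a (suc k) - b (suc k)) (λ ()) (begin
        ι (ℤ.+ suc k) * (a (suc k) - b (suc k))     ≈⟨ solve 3 (λ i a b → i :* (a :- b) := i :* a :- i :* b) refl _ _ _ ⟩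
        derivative a k - derivative b k             ≈⟨ +-cong (trans (a′ k) (*-congˡ (exponential-unique char0 ea eb k))) (-‿cong (b′ k)) ⟩
        x * b k - x * b k                           ≈⟨ -‿inverseʳ _ ⟩
        0#                                          ∎))

    exponential-step : ∀ {i c′ c z t} → i * c′ ≈ c → i * (c′ * (z * t)) ≈ z * (c * t)
    exponential-step {i} {c′} {c} {z} {t} h = trans (solve 4 (λ i c z t → i :* (c :* (z :* t)) := z :* ((i :* c) :* t)) refl i c′ z t) (*-congˡ (*-congʳ h))

    multiple-suc : ∀ z n → z + ι (ℤ.+ n) * z ≈ ι (ℤ.+ suc n) * z
    multiple-suc z n = trans (+-congʳ (sym (*-identityˡ z))) (trans (sym (distribʳ z _ _)) (*-congʳ (sym (ι-suc n))))

-- Norm estimates for partial sums and Cauchy products.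

module ComplexNorm where
  open import Defs
  open import Data.Rational.Base using (∣_∣)
  open import Data.Rational.Solver using (module +-*-Solver)
  open RationalLemmas
  open RationalBounds
  open EventualProperties
  open ComplexRing using (ℂ-algebra)
  open ExponentialSequences.Sequences ℂ-algebra using (S; excess)
  open +-*-Solver

  -- The sum norm of the m-th rational approximation. It is rational and submultiplicative, so
  -- estimates avoid square roots and inequalities between reals.
  ‖_‖ : ℂ → ℕ → ℚ
  ‖ z ‖ m = ∣ seq (re z) m ∣ ℚ.+ ∣ seq (im z) m ∣

  0≤‖‖ : ∀ z m → 0ℚ ℚ.≤ ‖ z ‖ m
  0≤‖‖ z m = ℚ.+-mono-≤ (ℚ.0≤∣p∣ (seq (re z) m)) (ℚ.0≤∣p∣ (seq (im z) m))

  ‖‖-+ : ∀ x y m → ‖ x + y ‖ m ℚ.≤ ‖ x ‖ m ℚ.+ ‖ y ‖ m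
  ‖‖-+ x y m = ℚ.≤-trans
    (ℚ.+-mono-≤ (ℚ.∣p+q∣≤∣p∣+∣q∣ (seq (re x) m) (seq (re y) m)) (ℚ.∣p+q∣≤∣p∣+∣q∣ (seq (im x) m) (seq (im y) m)))
    (ℚ.≤-reflexive (solve 4 (λ a b c d → (a :+ c) :+ (b :+ d) := (a :+ b) :+ (c :+ d)) ≡.refl
      (∣ seq (re x) m ∣) (∣ seq (im x) m ∣) (∣ seq (re y) m ∣) (∣ seq (im y) m ∣)))

  ‖‖-neg : ∀ x m → ‖ - x ‖ m ≡ ‖ x ‖ m
  ‖‖-neg x m = ≡.cong₂ ℚ._+_ (ℚ.∣-p∣≡∣p∣ (seq (re x) m)) (ℚ.∣-p∣≡∣p∣ (seq (im x) m))

  ‖‖-* : ∀ x y m → ‖ x * y ‖ m ℚ.≤ ‖ x ‖ m ℚ.* ‖ y ‖ m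
  ‖‖-* x y m = ℚ.≤-trans
    (ℚ.+-mono-≤ (ℚ.∣p-q∣≤∣p∣+∣q∣ (a ℚ.* c) (b ℚ.* d)) (ℚ.∣p+q∣≤∣p∣+∣q∣ (a ℚ.* d) (b ℚ.* c)))
    (ℚ.≤-reflexive (≡.trans
      (≡.cong₂ ℚ._+_ (≡.cong₂ ℚ._+_ (ℚ.∣p*q∣≡∣p∣*∣q∣ a c) (ℚ.∣p*q∣≡∣p∣*∣q∣ b d)) (≡.cong₂ ℚ._+_ (ℚ.∣p*q∣≡∣p∣*∣q∣ a d) (ℚ.∣p*q∣≡∣p∣*∣q∣ b c)))
      (solve 4 (λ a b c d → (a :* c :+ b :* d) :+ (a :* d :+ b :* c) := (a :+ b) :* (c :+ d)) ≡.refl (∣ a ∣) (∣ b ∣) (∣ c ∣) (∣ d ∣))))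
    where
    a = seq (re x) m
    b = seq (im x) m
    c = seq (re y) m
    d = seq (im y) m

  power : ℚ → ℕ → ℚ
  power c zero    = 1ℚ
  power c (suc k) = c ℚ.* power c k

  double-cancel : ∀ {x y} → x ℚ.+ x ℚ.≤ y ℚ.+ y → x ℚ.≤ y
  double-cancel {x} {y} h = subst₂ ℚ._≤_ (halve x) (halve y) (ℚ.*-monoʳ-≤-nonNeg ½ h)
    where
    halve : ∀ x → (x ℚ.+ x) ℚ.* ½ ≡ x
    halve x = ≡.trans (ℚ.*-distribʳ-+ ½ x x) (half+half x)

  -- A geometric series: the hypothesis for the tail holds with the constant c doubled.
  S-bound : ∀ m {K c} → 0ℚ ℚ.≤ c → ∀ j (b : ℕ → ℂ) → (∀ i → c ℚ.* (power (fromℕ 2) i ℚ.* ‖ b i ‖ m) ℚ.≤ K) →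
            c ℚ.* ‖ S j b ‖ m ℚ.≤ K ℚ.+ K
  S-bound m {K} {c} 0≤c zero    b h = ℚ.≤-trans (ℚ.≤-reflexive (ℚ.*-zeroʳ c)) (ℚ.+-mono-≤ 0≤K 0≤K)
    where
    0≤K : 0ℚ ℚ.≤ K
    0≤K = ℚ.≤-trans (subst (ℚ._≤ c ℚ.* (1ℚ ℚ.* ‖ b 0 ‖ m)) (ℚ.*-zeroʳ c)
      (ℚ.*-monoˡ-≤-nonNeg c {{ℚ.nonNegative 0≤c}} (ℚ.≤-trans (0≤‖‖ (b 0) m) (ℚ.≤-reflexive (≡.sym (ℚ.*-identityˡ (‖ b 0 ‖ m))))))) (h 0)
  S-bound m {K} {c} 0≤c (suc j) b h = begin
    c ℚ.* ‖ b 0 + S j (b ∘ ℕ.suc) ‖ m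
      ≤⟨ ℚ.*-monoˡ-≤-nonNeg c {{ℚ.nonNegative 0≤c}} (‖‖-+ (b 0) (S j (b ∘ ℕ.suc)) m) ⟩
    c ℚ.* (‖ b 0 ‖ m ℚ.+ ‖ S j (b ∘ ℕ.suc) ‖ m)
      ≡⟨ ℚ.*-distribˡ-+ c _ _ ⟩
    c ℚ.* ‖ b 0 ‖ m ℚ.+ c ℚ.* ‖ S j (b ∘ ℕ.suc) ‖ m
      ≤⟨ ℚ.+-mono-≤ (ℚ.≤-trans (ℚ.≤-reflexive (≡.cong (c ℚ.*_) (≡.sym (ℚ.*-identityˡ _)))) (h 0))
           (double-cancel (ℚ.≤-trans (ℚ.≤-reflexive (≡.sym (ℚ.*-distribʳ-+ (‖ S j (b ∘ ℕ.suc) ‖ m) c c))) (S-bound m (ℚ.+-mono-≤ 0≤c 0≤c) j (b ∘ ℕ.suc) tail))) ⟩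
    K ℚ.+ K ∎
    where
    open ℚ.≤-Reasoning
    tail : ∀ i → (c ℚ.+ c) ℚ.* (power (fromℕ 2) i ℚ.* ‖ b (suc i) ‖ m) ℚ.≤ K
    tail i = ℚ.≤-trans (ℚ.≤-reflexive (solve 3 (λ c p n → (c :+ c) :* (p :* n) := c :* ((con (fromℕ 2) :* p) :* n)) ≡.refl c (power (fromℕ 2) i) (‖ b (suc i) ‖ m))) (h (suc i))

  -- If a decays like 4^(-i) and the tails of b like 2^(-n), the excess is of the order of Σ 4^(-i)
  -- 2^(-(n-i)), hence of 2^(-n). In the induction `c` is quadrupled for the shifted `a`, while 2^n
  -- loses only a factor 2; the spare factor 2 sums the geometric series.
  excess-bound : ∀ m {Ka U} (b : ℕ → ℂ) → 0ℚ ℚ.≤ U → (∀ n j → power (fromℕ 2) n ℚ.* ‖ S j (λ i → b (n ℕ.+ i)) ‖ m ℚ.≤ U) →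
    ∀ {c} → 0ℚ ℚ.≤ c → ∀ n j (a : ℕ → ℂ) → (∀ i → c ℚ.* (power (fromℕ 4) i ℚ.* ‖ a i ‖ m) ℚ.≤ Ka) →
    c ℚ.* (power (fromℕ 2) n ℚ.* ‖ excess a b n j ‖ m) ℚ.≤ Ka ℚ.* U ℚ.+ Ka ℚ.* U
  excess-bound m {Ka} {U} b 0≤U tails = bound
    where
    open ℚ.≤-Reasoning
    head : ∀ {c} (a : ℕ → ℂ) → (∀ i → c ℚ.* (power (fromℕ 4) i ℚ.* ‖ a i ‖ m) ℚ.≤ Ka) → c ℚ.* ‖ a 0 ‖ m ℚ.≤ Ka
    head {c} a h = ℚ.≤-trans (ℚ.≤-reflexive (≡.cong (c ℚ.*_) (≡.sym (ℚ.*-identityˡ _)))) (h 0)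

    0≤c* : ∀ {c x} → 0ℚ ℚ.≤ c → 0ℚ ℚ.≤ x → 0ℚ ℚ.≤ c ℚ.* x
    0≤c* {c} {x} 0≤c 0≤x = subst (ℚ._≤ c ℚ.* x) (ℚ.*-zeroʳ c) (ℚ.*-monoˡ-≤-nonNeg c {{ℚ.nonNegative 0≤c}} 0≤x)

    bound : ∀ {c} → 0ℚ ℚ.≤ c → ∀ n j (a : ℕ → ℂ) → (∀ i → c ℚ.* (power (fromℕ 4) i ℚ.* ‖ a i ‖ m) ℚ.≤ Ka) →
      c ℚ.* (power (fromℕ 2) n ℚ.* ‖ excess a b n j ‖ m) ℚ.≤ Ka ℚ.* U ℚ.+ Ka ℚ.* U
    bound {c} 0≤c zero    j a h = ℚ.≤-trans (ℚ.≤-reflexive (≡.trans (≡.cong (c ℚ.*_) (ℚ.*-zeroʳ 1ℚ)) (ℚ.*-zeroʳ c))) (ℚ.+-mono-≤ 0≤KU 0≤KU)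
      where
      0≤KU : 0ℚ ℚ.≤ Ka ℚ.* U
      0≤KU = 0≤c* (ℚ.≤-trans (0≤c* 0≤c (0≤‖‖ (a 0) m)) (head {c} a h)) 0≤U
    bound {c} 0≤c (suc n) j a h = begin
      c ℚ.* (p ℚ.* ‖ a 0 * t + e ‖ m)
        ≤⟨ ℚ.*-monoˡ-≤-nonNeg c {{ℚ.nonNegative 0≤c}} (ℚ.*-monoˡ-≤-nonNeg p {{ℚ.nonNegative (0≤power (suc n))}}
             (ℚ.≤-trans (‖‖-+ (a 0 * t) e m) (ℚ.+-monoˡ-≤ (‖ e ‖ m) (‖‖-* (a 0) t m)))) ⟩
      c ℚ.* (p ℚ.* (‖ a 0 ‖ m ℚ.* ‖ t ‖ m ℚ.+ ‖ e ‖ m))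
        ≡⟨ solve 5 (λ c p a t e → c :* ((con (fromℕ 2) :* p) :* (a :* t :+ e)) := (c :* a) :* ((con (fromℕ 2) :* p) :* t) :+ (c :+ c) :* (p :* e)) ≡.refl
             c (power (fromℕ 2) n) (‖ a 0 ‖ m) (‖ t ‖ m) (‖ e ‖ m) ⟩
      (c ℚ.* ‖ a 0 ‖ m) ℚ.* (p ℚ.* ‖ t ‖ m) ℚ.+ (c ℚ.+ c) ℚ.* (power (fromℕ 2) n ℚ.* ‖ e ‖ m)
        ≤⟨ ℚ.+-mono-≤ (*-mono-nonNeg {c ℚ.* ‖ a 0 ‖ m} {Ka} {p ℚ.* ‖ t ‖ m} {U} (ℚ.≤-trans (0≤c* 0≤c (0≤‖‖ (a 0) m)) (head {c} a h)) (0≤c* (0≤power (suc n)) (0≤‖‖ t m)) (head {c} a h) (tails (suc n) j))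
             (double-cancel {(c ℚ.+ c) ℚ.* (power (fromℕ 2) n ℚ.* ‖ e ‖ m)} (ℚ.≤-trans (ℚ.≤-reflexive (solve 2 (λ c x → (c :+ c) :* x :+ (c :+ c) :* x := ((c :+ c) :+ (c :+ c)) :* x) ≡.refl c (power (fromℕ 2) n ℚ.* ‖ e ‖ m)))
               (bound (ℚ.+-mono-≤ (ℚ.+-mono-≤ 0≤c 0≤c) (ℚ.+-mono-≤ 0≤c 0≤c)) n (suc j) (a ∘ ℕ.suc) tail))) ⟩
      Ka ℚ.* U ℚ.+ Ka ℚ.* U ∎
      where
      p = power (fromℕ 2) (suc n)
      t = S j (λ i → b (suc n ℕ.+ i))
      e = excess (a ∘ ℕ.suc) b n (suc j)
      0≤power : ∀ k → 0ℚ ℚ.≤ power (fromℕ 2) k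
      0≤power zero    = ℚ.<⇒≤ (ℚ.positive⁻¹ 1ℚ)
      0≤power (suc k) = 0≤c* (ℚ.<⇒≤ (ℚ.positive⁻¹ (fromℕ 2))) (0≤power k)
      tail : ∀ i → ((c ℚ.+ c) ℚ.+ (c ℚ.+ c)) ℚ.* (power (fromℕ 4) i ℚ.* ‖ a (suc i) ‖ m) ℚ.≤ Ka
      tail i = ℚ.≤-trans (ℚ.≤-reflexive (solve 3 (λ c p n → ((c :+ c) :+ (c :+ c)) :* (p :* n) := c :* ((con (fromℕ 4) :* p) :* n)) ≡.refl c (power (fromℕ 4) i) (‖ a (suc i) ‖ m))) (h (suc i))

-- Limits of complex sequences.

module Limits where
  open import Defs
  open import Data.Rational.Base using (∣_∣)
  open import Data.Rational.Solver using (module +-*-Solver)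
  open RationalBounds
  open EventualProperties
  open ComplexNorm
  open +-*-Solver

  -- The threshold for the approximation index m may depend on n, since each s n is a Cauchy
  -- sequence of its own.
  Limit : (ℕ → ℂ) → ℂ → Set
  Limit s l = ∀ ε → 0ℚ ℚ.< ε → Eventually λ n → Eventually λ m → ‖ s n + - l ‖ m ℚ.< ε

  re<‖‖ : ∀ z m {ε} → ‖ z ‖ m ℚ.< ε → ∣ seq (re z) m ∣ ℚ.< ε
  re<‖‖ z m = ℚ.≤-<-trans (ℚ.≤-trans (ℚ.≤-reflexive (≡.sym (ℚ.+-identityʳ _))) (ℚ.+-monoʳ-≤ ∣ seq (re z) m ∣ (ℚ.0≤∣p∣ (seq (im z) m))))

  im<‖‖ : ∀ z m {ε} → ‖ z ‖ m ℚ.< ε → ∣ seq (im z) m ∣ ℚ.< ε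
  im<‖‖ z m = ℚ.≤-<-trans (ℚ.≤-trans (ℚ.≤-reflexive (≡.sym (ℚ.+-identityˡ _))) (ℚ.+-monoˡ-≤ ∣ seq (im z) m ∣ (ℚ.0≤∣p∣ (seq (re z) m))))

  halves : ∀ {p q ε} → p ℚ.< ε ℚ.* ½ → q ℚ.< ε ℚ.* ½ → p ℚ.+ q ℚ.< ε
  halves {p} {q} {ε} hp hq = subst (p ℚ.+ q ℚ.<_) (half+half ε) (ℚ.+-mono-< hp hq)

  ‖‖-≡ : ∀ {x y} m → seq (re x) m ≡ seq (re y) m → seq (im x) m ≡ seq (im y) m → ‖ x ‖ m ≡ ‖ y ‖ m
  ‖‖-≡ m h g = ≡.cong₂ (λ p q → ∣ p ∣ ℚ.+ ∣ q ∣) h g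

  distance-sym : ∀ x y m → ‖ x + - y ‖ m ≡ ‖ y + - x ‖ m
  distance-sym x y m = ≡.trans (≡.sym (‖‖-neg (x + - y) m)) (‖‖-≡ { - (x + - y)} {y + - x} m
    (solve 2 (λ a b → :- (a :+ :- b) := b :+ :- a) ≡.refl (seq (re x) m) (seq (re y) m))
    (solve 2 (λ a b → :- (a :+ :- b) := b :+ :- a) ≡.refl (seq (im x) m) (seq (im y) m)))

  triangle : ∀ x y z m → ‖ x + - z ‖ m ℚ.≤ ‖ x + - y ‖ m ℚ.+ ‖ y + - z ‖ m
  triangle x y z m = ℚ.≤-trans (ℚ.≤-reflexive (‖‖-≡ {x + - z} {(x + - y) + (y + - z)} m
    (solve 3 (λ a b c → a :+ :- c := (a :+ :- b) :+ (b :+ :- c)) ≡.refl (seq (re x) m) (seq (re y) m) (seq (re z) m))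
    (solve 3 (λ a b c → a :+ :- c := (a :+ :- b) :+ (b :+ :- c)) ≡.refl (seq (im x) m) (seq (im y) m) (seq (im z) m))))
    (‖‖-+ (x + - y) (y + - z) m)

  ≈⇒close : ∀ {x y} → x ≈ y → ∀ ε → 0ℚ ℚ.< ε → Eventually λ m → ‖ x + - y ‖ m ℚ.< ε
  ≈⇒close (h , g) ε ε>0 = map-eventually (λ { m (a , b) → halves a b }) (both (h _ (half>0 ε>0)) (g _ (half>0 ε>0)))

  close⇒≈ : ∀ {x y} → (∀ ε → 0ℚ ℚ.< ε → Eventually λ m → ‖ x + - y ‖ m ℚ.< ε) → x ≈ y
  close⇒≈ {x} {y} h = (λ ε ε>0 → map-eventually (λ m → re<‖‖ (x + - y) m) (h ε ε>0)) ,
                      (λ ε ε>0 → map-eventually (λ m → im<‖‖ (x + - y) m) (h ε ε>0))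

  ⟶ʳ⇒close : ∀ {s l} → s ⟶ʳ l → ∀ ε → 0ℚ ℚ.< ε → Eventually λ n → Eventually λ m → ∣ seq (s n) m ℚ.- seq l m ∣ ℚ.< ε
  ⟶ʳ⇒close {s} {l} h ε ε>0 = map-eventually
    (λ { n ((δ , δ>0 , lower) , (δ′ , δ′>0 , upper)) → map-eventually
      (λ { m (lo , up) → ⇒∣p∣<
        (0<-⇒< (subst (0ℚ ℚ.<_) (solve 3 (λ s l e → s :- (l :+ :- e) := (s :- l) :- (:- e)) ≡.refl (seq (s n) m) (seq l m) ε) (ℚ.<-trans δ>0 lo)))
        (0<-⇒< (subst (0ℚ ℚ.<_) (solve 3 (λ s l e → (l :+ e) :- s := e :- (s :- l)) ≡.refl (seq (s n) m) (seq l m) ε) (ℚ.<-trans δ′>0 up))) })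
      (both lower upper) })
    (h ε ε>0)

  close⇒⟶ʳ : ∀ {s l} → (∀ ε → 0ℚ ℚ.< ε → Eventually λ n → Eventually λ m → ∣ seq (s n) m ℚ.- seq l m ∣ ℚ.< ε) → s ⟶ʳ l
  close⇒⟶ʳ {s} {l} h ε ε>0 = map-eventually
    (λ n close → (ε ℚ.* ½ , half>0 ε>0 , map-eventually (λ m c → 0<-⇒< (subst (0ℚ ℚ.<_)
        (≡.trans (solve 4 (λ s l e d → (s :- l) :- (:- d) := (s :- (l :+ :- (d :+ d))) :- d) ≡.refl (seq (s n) m) (seq l m) ε (ε ℚ.* ½))
          (≡.cong (λ e → (seq (s n) m ℚ.- (seq l m ℚ.- e)) ℚ.- ε ℚ.* ½) (half+half ε)))
        (<⇒0<- (proj₁ (∣p∣<⇒ c))))) close) ,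
      (ε ℚ.* ½ , half>0 ε>0 , map-eventually (λ m c → 0<-⇒< (subst (0ℚ ℚ.<_)
        (≡.trans (solve 4 (λ s l e d → d :- (s :- l) := ((l :+ (d :+ d)) :- s) :- d) ≡.refl (seq (s n) m) (seq l m) ε (ε ℚ.* ½))
          (≡.cong (λ e → ((seq l m ℚ.+ e) ℚ.- seq (s n) m) ℚ.- ε ℚ.* ½) (half+half ε)))
        (<⇒0<- (proj₂ (∣p∣<⇒ c))))) close))
    (h (ε ℚ.* ½) (half>0 ε>0))

  ⟶⇒Limit : ∀ {s l} → s ⟶ l → Limit s l
  ⟶⇒Limit {s} {l} (h , g) ε ε>0 = map-eventually (λ { n (a , b) → map-eventually (λ { m (p , q) → halves p q }) (both a b) })
    (both (⟶ʳ⇒close {λ n → re (s n)} {re l} h _ (half>0 ε>0)) (⟶ʳ⇒close {λ n → im (s n)} {im l} g _ (half>0 ε>0)))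

  Limit⇒⟶ : ∀ {s l} → Limit s l → s ⟶ l
  Limit⇒⟶ {s} {l} h =
    close⇒⟶ʳ {λ n → re (s n)} {re l} (λ ε ε>0 → map-eventually (λ n → map-eventually (λ m → re<‖‖ (s n + - l) m)) (h ε ε>0)) ,
    close⇒⟶ʳ {λ n → im (s n)} {im l} (λ ε ε>0 → map-eventually (λ n → map-eventually (λ m → im<‖‖ (s n + - l) m)) (h ε ε>0))

  Limit-unique : ∀ {s l l′} → Limit s l → Limit s l′ → l ≈ l′
  Limit-unique {s} {l} {l′} h g = close⇒≈ {l} {l′} λ ε ε>0 → at ε (both (h _ (half>0 ε>0)) (g _ (half>0 ε>0)))
    where
    at : ∀ ε → Eventually _ → Eventually λ m → ‖ l + - l′ ‖ m ℚ.< ε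
    at ε (N , close) = map-eventually (λ { m (a , b) → ℚ.≤-<-trans (triangle l (s N) l′ m)
      (halves (subst (ℚ._< ε ℚ.* ½) (distance-sym (s N) l m) a) b) }) (both (proj₁ (close N ℕ.≤-refl)) (proj₂ (close N ℕ.≤-refl)))

  Null : (ℕ → ℂ) → Set
  Null d = ∀ ε → 0ℚ ℚ.< ε → Eventually λ n → Eventually λ m → ‖ d n ‖ m ℚ.< ε

  Limit-perturb : ∀ {s s′ d l l′} → Limit s l → Null d → Eventually (λ n → s n ≈ s′ n + d n) → l ≈ l′ → Limit s′ l′
  Limit-perturb {s} {s′} {d} {l} {l′} h null s≈s′+d l≈l′ ε ε>0 = map-eventually
    (λ { n (a , b , c) → map-eventually
      (λ { m (a , b , c , e) → ℚ.≤-<-trans (bound n m)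
             (halves (halves (subst (ℚ._< _) (distance-sym (s n) (s′ n + d n) m) c) b) (halves a e)) })
      (both a (both b (both (≈⇒close {s n} {s′ n + d n} c _ δ>0) (≈⇒close {l} {l′} l≈l′ _ δ>0)))) })
    (both (h _ δ>0) (both (null _ δ>0) s≈s′+d))
    where
    δ>0 = half>0 (half>0 ε>0)
    bound : ∀ n m → ‖ s′ n + - l′ ‖ m ℚ.≤ (‖ (s′ n + d n) + - s n ‖ m ℚ.+ ‖ d n ‖ m) ℚ.+ (‖ s n + - l ‖ m ℚ.+ ‖ l + - l′ ‖ m)
    bound n m = ℚ.≤-trans (triangle (s′ n) (s n) l′ m) (ℚ.+-mono-≤
      (ℚ.≤-trans (triangle (s′ n) (s′ n + d n) (s n) m) (ℚ.≤-trans (ℚ.≤-reflexive (ℚ.+-comm (‖ s′ n + - (s′ n + d n) ‖ m) (‖ (s′ n + d n) + - s n ‖ m))) (ℚ.+-monoʳ-≤ (‖ (s′ n + d n) + - s n ‖ m) (ℚ.≤-reflexive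
        (≡.trans (‖‖-≡ {s′ n + - (s′ n + d n)} { - d n} m
          (solve 2 (λ a b → a :+ :- (a :+ b) := :- b) ≡.refl (seq (re (s′ n)) m) (seq (re (d n)) m))
          (solve 2 (λ a b → a :+ :- (a :+ b) := :- b) ≡.refl (seq (im (s′ n)) m) (seq (im (d n)) m))) (‖‖-neg (d n) m))))))
      (triangle (s n) l l′ m))

  bounded-‖‖ : ∀ z → ∃ λ B → 0ℚ ℚ.< B × Eventually λ m → ‖ z ‖ m ℚ.≤ B
  bounded-‖‖ z =
    let A , A>0 , a = bounded {seq (re z)} (cauchy (re z))
        B , B>0 , b = bounded {seq (im z)} (cauchy (im z))
    in A ℚ.+ B , ℚ.+-mono-< A>0 B>0 , map-eventually (λ { m (p , q) → ℚ.+-mono-≤ p q }) (both a b)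

  Limit-* : ∀ {s t a b} → Limit s a → Limit t b → Limit (λ n → s n * t n) (a * b)
  Limit-* {s} {t} {a} {b} h g ε ε>0 =
    let A , A>0 , a≤A = bounded-‖‖ a
        B , B>0 , b≤B = bounded-‖‖ b
        -- Write s t - a b = s (t - b) + b (s - a); once s is within 1 of a, its norm is at most 1 +
        -- A.
        δ , δ>0 , Cδ≡ε = divide ((1ℚ ℚ.+ A) ℚ.+ B) ε (ℚ.+-mono-< (ℚ.+-mono-< (ℚ.positive⁻¹ 1ℚ) A>0) B>0) ε>0
    in map-eventually (λ { n (u , v , w) → map-eventually
         (λ { m (u , v , w , a≤A , b≤B) → subst (‖ s n * t n + - (a * b) ‖ m ℚ.<_) Cδ≡ε (bound n m A>0 B>0 u v w a≤A b≤B) })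
         (both u (both v (both w (both a≤A b≤B)))) })
       (both (h 1ℚ (ℚ.positive⁻¹ 1ℚ)) (both (h δ δ>0) (g δ δ>0)))
    where
    open ℚ.≤-Reasoning
    bound : ∀ n m {A B δ} → 0ℚ ℚ.< A → 0ℚ ℚ.< B → ‖ s n + - a ‖ m ℚ.< 1ℚ → ‖ s n + - a ‖ m ℚ.< δ → ‖ t n + - b ‖ m ℚ.< δ →
            ‖ a ‖ m ℚ.≤ A → ‖ b ‖ m ℚ.≤ B → ‖ s n * t n + - (a * b) ‖ m ℚ.< ((1ℚ ℚ.+ A) ℚ.+ B) ℚ.* δ
    bound n m {A} {B} {δ} A>0 B>0 u v w a≤A b≤B = begin-strict
      ‖ s n * t n + - (a * b) ‖ m
        ≡⟨ ‖‖-≡ {s n * t n + - (a * b)} {s n * (t n + - b) + b * (s n + - a)} m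
             (solve 8 (λ s s′ t t′ a a′ b b′ →
                (s :* t :+ :- (s′ :* t′)) :+ :- (a :* b :+ :- (a′ :* b′)) :=
                (s :* (t :+ :- b) :+ :- (s′ :* (t′ :+ :- b′))) :+ (b :* (s :+ :- a) :+ :- (b′ :* (s′ :+ :- a′)))) ≡.refl
               (seq (re (s n)) m) (seq (im (s n)) m) (seq (re (t n)) m) (seq (im (t n)) m) (seq (re a) m) (seq (im a) m) (seq (re b) m) (seq (im b) m))
             (solve 8 (λ s s′ t t′ a a′ b b′ →
                (s :* t′ :+ s′ :* t) :+ :- (a :* b′ :+ a′ :* b) :=
                (s :* (t′ :+ :- b′) :+ s′ :* (t :+ :- b)) :+ (b :* (s′ :+ :- a′) :+ b′ :* (s :+ :- a))) ≡.refl
               (seq (re (s n)) m) (seq (im (s n)) m) (seq (re (t n)) m) (seq (im (t n)) m) (seq (re a) m) (seq (im a) m) (seq (re b) m) (seq (im b) m)) ⟩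
      ‖ s n * (t n + - b) + b * (s n + - a) ‖ m
        ≤⟨ ℚ.≤-trans (‖‖-+ (s n * (t n + - b)) (b * (s n + - a)) m) (ℚ.+-mono-≤ (‖‖-* (s n) (t n + - b) m) (‖‖-* b (s n + - a) m)) ⟩
      ‖ s n ‖ m ℚ.* ‖ t n + - b ‖ m ℚ.+ ‖ b ‖ m ℚ.* ‖ s n + - a ‖ m
        ≤⟨ ℚ.+-mono-≤ (ℚ.*-monoʳ-≤-nonNeg (‖ t n + - b ‖ m) {{ℚ.nonNegative (0≤‖‖ (t n + - b) m)}} s≤)
             (ℚ.*-monoʳ-≤-nonNeg (‖ s n + - a ‖ m) {{ℚ.nonNegative (0≤‖‖ (s n + - a) m)}} b≤B) ⟩
      (1ℚ ℚ.+ A) ℚ.* ‖ t n + - b ‖ m ℚ.+ B ℚ.* ‖ s n + - a ‖ m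
        <⟨ ℚ.+-mono-< (ℚ.*-monoʳ-<-pos (1ℚ ℚ.+ A) {{ℚ.positive (ℚ.+-mono-< (ℚ.positive⁻¹ 1ℚ) A>0)}} w) (ℚ.*-monoʳ-<-pos B {{ℚ.positive B>0}} v) ⟩
      (1ℚ ℚ.+ A) ℚ.* δ ℚ.+ B ℚ.* δ
        ≡⟨ ℚ.*-distribʳ-+ δ (1ℚ ℚ.+ A) B ⟨
      ((1ℚ ℚ.+ A) ℚ.+ B) ℚ.* δ ∎
      where
      s≤ : ‖ s n ‖ m ℚ.≤ 1ℚ ℚ.+ A
      s≤ = ℚ.≤-trans (ℚ.≤-reflexive (‖‖-≡ {s n} {(s n + - a) + a} m
             (solve 2 (λ s a → s := (s :+ :- a) :+ a) ≡.refl (seq (re (s n)) m) (seq (re a) m))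
             (solve 2 (λ s a → s := (s :+ :- a) :+ a) ≡.refl (seq (im (s n)) m) (seq (im a) m))))
           (ℚ.≤-trans (‖‖-+ (s n + - a) a m) (ℚ.+-mono-≤ (ℚ.<⇒≤ u) a≤A))

-- The addition formula for the exponential series.

module ComplexExponential where
  open import Defs
  open import Data.Rational.Base using (∣_∣; _/_)
  open import Data.Rational.Solver using (module +-*-Solver)
  open RationalLemmas
  open RationalBounds
  open EventualProperties
  open ComplexRing using (ℂ-algebra; ≈-pointwise; ≈-refl; ≈-sym; ≈-trans)
  open ComplexCharacteristic using (ℂ-characteristicZero)
  open ComplexNorm
  open Limits
  open ExponentialSequences.Sequences ℂ-algebra

  inverseFactorial : ℕ → ℚ
  inverseFactorial k = (ℤ.+ 1) / (k !)
    where instance _ = k ℕ.!≢0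

  inverseFactorial-* : ∀ k → inverseFactorial k ℚ.* fromℕ (k !) ≡ 1ℚ
  inverseFactorial-* k = /-*-fromℤ (ℤ.+ 1) (k !)
    where instance _ = k ℕ.!≢0

  inverseFactorial-suc : ∀ k → fromℕ (suc k) ℚ.* inverseFactorial (suc k) ≡ inverseFactorial k
  inverseFactorial-suc k = begin
    N ℚ.* r                       ≡⟨ ℚ.*-identityʳ (N ℚ.* r) ⟨
    (N ℚ.* r) ℚ.* 1ℚ              ≡⟨ ≡.cong ((N ℚ.* r) ℚ.*_) (inverseFactorial-* k) ⟨
    (N ℚ.* r) ℚ.* (s ℚ.* F)       ≡⟨ solve 4 (λ N r s F → (N :* r) :* (s :* F) := s :* (r :* (N :* F))) ≡.refl N r s F ⟩
    s ℚ.* (r ℚ.* (N ℚ.* F))       ≡⟨ ≡.cong (λ x → s ℚ.* (r ℚ.* x)) (≡.trans (≡.sym (fromℤ-* (ℤ.+ suc k) (ℤ.+ (k !)))) (≡.cong fromℤ (≡.sym (ℤ.pos-* (suc k) (k !))))) ⟩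
    s ℚ.* (r ℚ.* fromℕ (suc k !)) ≡⟨ ≡.cong (s ℚ.*_) (inverseFactorial-* (suc k)) ⟩
    s ℚ.* 1ℚ                      ≡⟨ ℚ.*-identityʳ s ⟩
    s                             ∎
    where
    open ≡.≡-Reasoning
    open +-*-Solver
    N = fromℕ (suc k)
    r = inverseFactorial (suc k)
    s = inverseFactorial k
    F = fromℕ (k !)

  0≤inverseFactorial : ∀ k → 0ℚ ℚ.≤ inverseFactorial k
  0≤inverseFactorial k = ℚ.nonNegative⁻¹ (inverseFactorial k) {{ℚ.normalize-nonNeg 1 (k !)}}
    where instance _ = k ℕ.!≢0

  expTerm-exponential : ∀ z → IsExponential z (expTerm z)
  expTerm-exponential z = ≈-pointwise {expTerm z 0} {1ᶜ} (λ _ → ≡.refl) (λ _ → ≡.refl) , λ k →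
    exponential-step {ℤ-Algebra.ι ℂ-algebra (ℤ.+ suc k)} {fromℚ (inverseFactorial (suc k)) +i 0ʳ} {fromℚ (inverseFactorial k) +i 0ʳ} {z} {z ^ k}
      (≈-pointwise {ℤ-Algebra.ι ℂ-algebra (ℤ.+ suc k) * (fromℚ (inverseFactorial (suc k)) +i 0ʳ)} {fromℚ (inverseFactorial k) +i 0ʳ}
        (λ _ → ≡.trans (solve 2 (λ a b → a :* b :+ :- (con 0ℚ :* con 0ℚ) := a :* b) ≡.refl (fromℕ (suc k)) (inverseFactorial (suc k))) (inverseFactorial-suc k))
        (λ _ → solve 2 (λ a b → a :* con 0ℚ :+ con 0ℚ :* b := con 0ℚ) ≡.refl (fromℕ (suc k)) (inverseFactorial (suc k))))
    where
    open +-*-Solver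

  -- Up to k = C the power is at most C^C; from then on each step multiplies the left side by C and
  -- the right side by at least C.
  factorial-bound : ∀ C k → 1 ℕ.≤ C → C ℕ.^ k ℕ.≤ C ℕ.^ C ℕ.* k !
  factorial-bound C zero    1≤C = ℕ.≤-trans (ℕ.^-monoʳ-≤ C {{ℕ.>-nonZero 1≤C}} {0} {C} ℕ.z≤n) (ℕ.≤-reflexive (≡.sym (ℕ.*-identityʳ (C ℕ.^ C))))
  factorial-bound C (suc k) 1≤C with ℕ.≤-total (suc k) C
  ... | inj₁ k<C = ℕ.≤-trans (ℕ.^-monoʳ-≤ C {{ℕ.>-nonZero 1≤C}} k<C) (ℕ.m≤m*n (C ℕ.^ C) (suc k !) {{suc k ℕ.!≢0}})
  ... | inj₂ C≤k = ℕ.≤-trans (ℕ.*-mono-≤ C≤k (factorial-bound C k 1≤C))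
    (ℕ.≤-reflexive (≡.trans (≡.sym (ℕ.*-assoc (suc k) (C ℕ.^ C) (k !))) (≡.trans (≡.cong (ℕ._* k !) (ℕ.*-comm (suc k) (C ℕ.^ C))) (ℕ.*-assoc (C ℕ.^ C) (suc k) (k !)))))

  power-fromℤ : ∀ c k → power (fromℕ c) k ≡ fromℕ (c ℕ.^ k)
  power-fromℤ c zero    = ≡.refl
  power-fromℤ c (suc k) = ≡.trans (≡.cong (fromℕ c ℚ.*_) (power-fromℤ c k))
    (≡.trans (≡.sym (fromℤ-* (ℤ.+ c) (ℤ.+ (c ℕ.^ k)))) (≡.cong fromℤ (≡.sym (ℤ.pos-* c (c ℕ.^ k)))))

  power-* : ∀ a b k → power a k ℚ.* power b k ≡ power (a ℚ.* b) k
  power-* a b zero    = ≡.refl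
  power-* a b (suc k) = ≡.trans (solve 4 (λ a p b q → (a :* p) :* (b :* q) := (a :* b) :* (p :* q)) ≡.refl a (power a k) b (power b k))
    (≡.cong (a ℚ.* b ℚ.*_) (power-* a b k))
    where open +-*-Solver

  power-+ : ∀ a m n → power a m ℚ.* power a n ≡ power a (m ℕ.+ n)
  power-+ a zero    n = ℚ.*-identityˡ (power a n)
  power-+ a (suc m) n = ≡.trans (ℚ.*-assoc a (power a m) (power a n)) (≡.cong (a ℚ.*_) (power-+ a m n))

  0≤power : ∀ c k → 0ℚ ℚ.≤ power (fromℕ c) k
  0≤power c k = subst (0ℚ ℚ.≤_) (≡.sym (power-fromℤ c k)) (fromℕ-mono-≤ ℕ.z≤n)

  power-2≤4 : ∀ k → power (fromℕ 2) k ℚ.≤ power (fromℕ 4) k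
  power-2≤4 k = subst₂ ℚ._≤_ (≡.sym (power-fromℤ 2 k)) (≡.sym (power-fromℤ 4 k))
    (fromℕ-mono-≤ (ℕ.^-monoˡ-≤ k (ℕ.s≤s (ℕ.s≤s ℕ.z≤n))))

  n≤2^n : ∀ n → n ℕ.≤ 2 ℕ.^ n
  n≤2^n zero    = ℕ.z≤n
  n≤2^n (suc n) = ℕ.≤-trans (ℕ.+-mono-≤ (ℕ.^-monoʳ-≤ 2 {0} {n} ℕ.z≤n) (n≤2^n n)) (ℕ.≤-reflexive (≡.cong (2 ℕ.^ n ℕ.+_) (≡.sym (ℕ.+-identityʳ (2 ℕ.^ n)))))

  module _ (B : ℕ) (1≤B : 1 ℕ.≤ B) (m : ℕ) where
    -- `B` bounds ‖z‖, so 4^k ‖z^k / k!‖ ≤ C^k / k! ≤ C^C. The 4 is the decay that `excess-bound`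
    -- asks of its first sequence.
    C = 4 ℕ.* B
    K = fromℕ (C ℕ.^ C)

    ‖^‖ : ∀ z → ‖ z ‖ m ℚ.≤ fromℕ B → ∀ k → ‖ z ^ k ‖ m ℚ.≤ power (fromℕ B) k
    ‖^‖ z h zero    = ℚ.≤-refl
    ‖^‖ z h (suc k) = ℚ.≤-trans (‖‖-* z (z ^ k) m) (*-mono-nonNeg (fromℕ-mono-≤ ℕ.z≤n) (0≤‖‖ (z ^ k) m) h (‖^‖ z h k))

    expTerm-bound : ∀ z → ‖ z ‖ m ℚ.≤ fromℕ B → ∀ k → power (fromℕ 4) k ℚ.* ‖ expTerm z k ‖ m ℚ.≤ K
    expTerm-bound z h k = begin
      power (fromℕ 4) k ℚ.* ‖ expTerm z k ‖ m
        ≤⟨ ℚ.*-monoˡ-≤-nonNeg (power (fromℕ 4) k) {{ℚ.nonNegative (0≤power 4 k)}}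
             (ℚ.≤-trans (‖‖-* (fromℚ r +i 0ʳ) (z ^ k) m) (ℚ.≤-trans
               (ℚ.≤-reflexive (≡.cong (ℚ._* ‖ z ^ k ‖ m) (≡.trans (ℚ.+-identityʳ ∣ r ∣) (ℚ.0≤p⇒∣p∣≡p (0≤inverseFactorial k)))))
               (ℚ.*-monoˡ-≤-nonNeg r {{ℚ.nonNegative (0≤inverseFactorial k)}} (‖^‖ z h k)))) ⟩
      power (fromℕ 4) k ℚ.* (r ℚ.* power (fromℕ B) k)
        ≡⟨ solve 3 (λ p r s → p :* (r :* s) := r :* (p :* s)) ≡.refl (power (fromℕ 4) k) r (power (fromℕ B) k) ⟩
      r ℚ.* (power (fromℕ 4) k ℚ.* power (fromℕ B) k)
        ≡⟨ ≡.cong (r ℚ.*_) (≡.trans (power-* (fromℕ 4) (fromℕ B) k) (≡.trans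
             (≡.cong (λ c → power c k) (≡.trans (≡.sym (fromℤ-* (ℤ.+ 4) (ℤ.+ B))) (≡.cong fromℤ (≡.sym (ℤ.pos-* 4 B))))) (power-fromℤ C k))) ⟩
      r ℚ.* fromℕ (C ℕ.^ k)
        ≤⟨ ℚ.*-monoˡ-≤-nonNeg r {{ℚ.nonNegative (0≤inverseFactorial k)}} (fromℕ-mono-≤ (factorial-bound C k (ℕ.≤-trans 1≤B (ℕ.m≤n*m B 4)))) ⟩
      r ℚ.* fromℕ (C ℕ.^ C ℕ.* k !)
        ≡⟨ ≡.cong (r ℚ.*_) (≡.trans (≡.cong fromℤ (ℤ.pos-* (C ℕ.^ C) (k !))) (fromℤ-* (ℤ.+ (C ℕ.^ C)) (ℤ.+ (k !)))) ⟩
      r ℚ.* (K ℚ.* F)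
        ≡⟨ solve 3 (λ r K F → r :* (K :* F) := K :* (r :* F)) ≡.refl r K F ⟩
      K ℚ.* (r ℚ.* F)
        ≡⟨ ≡.cong (K ℚ.*_) (inverseFactorial-* k) ⟩
      K ℚ.* 1ℚ
        ≡⟨ ℚ.*-identityʳ K ⟩
      K ∎
      where
      open ℚ.≤-Reasoning
      open +-*-Solver
      r = inverseFactorial k
      F = fromℕ (k !)

    -- The decay 2^(-n) is weakened to 1/n, to which the Archimedean property applies directly.
    excess-expTerm-bound : ∀ x y → ‖ x ‖ m ℚ.≤ fromℕ B → ‖ y ‖ m ℚ.≤ fromℕ B → ∀ n →
      fromℕ n ℚ.* ‖ excess (expTerm x) (expTerm y) n 0 ‖ m ℚ.≤ K ℚ.* (K ℚ.+ K) ℚ.+ K ℚ.* (K ℚ.+ K)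
    excess-expTerm-bound x y hx hy n = ℚ.≤-trans
      (ℚ.*-monoʳ-≤-nonNeg (‖ e ‖ m) {{ℚ.nonNegative (0≤‖‖ e m)}}
        (subst (fromℕ n ℚ.≤_) (≡.sym (power-fromℤ 2 n)) (fromℕ-mono-≤ (n≤2^n n))))
      (ℚ.≤-trans (ℚ.≤-reflexive (≡.sym (ℚ.*-identityˡ _)))
        (excess-bound m (expTerm y) (ℚ.+-mono-≤ 0≤K 0≤K) tails (ℚ.<⇒≤ (ℚ.positive⁻¹ 1ℚ)) n 0 (expTerm x)
          (λ i → ℚ.≤-trans (ℚ.≤-reflexive (ℚ.*-identityˡ _)) (expTerm-bound x hx i))))
      where
      e = excess (expTerm x) (expTerm y) n 0
      0≤K : 0ℚ ℚ.≤ K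
      0≤K = fromℕ-mono-≤ ℕ.z≤n
      tails : ∀ n j → power (fromℕ 2) n ℚ.* ‖ S j (λ i → expTerm y (n ℕ.+ i)) ‖ m ℚ.≤ K ℚ.+ K
      tails n j = S-bound m (0≤power 2 n) j (λ i → expTerm y (n ℕ.+ i)) (λ i → ℚ.≤-trans
        (ℚ.≤-reflexive (≡.trans (≡.sym (ℚ.*-assoc (power (fromℕ 2) n) (power (fromℕ 2) i) _)) (≡.cong (ℚ._* ‖ expTerm y (n ℕ.+ i) ‖ m) (power-+ (fromℕ 2) n i))))
        (ℚ.≤-trans (ℚ.*-monoʳ-≤-nonNeg (‖ expTerm y (n ℕ.+ i) ‖ m) {{ℚ.nonNegative (0≤‖‖ (expTerm y (n ℕ.+ i)) m)}} (power-2≤4 (n ℕ.+ i)))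
          (expTerm-bound y hy (n ℕ.+ i))))

  natural-bound : ∀ z → ∃ λ B → 1 ℕ.≤ B × Eventually λ m → ‖ z ‖ m ℚ.≤ fromℕ B
  natural-bound z =
    let R , _ , h = bounded-‖‖ z
        n , R<n   = archimedean R 1ℚ (ℚ.positive⁻¹ 1ℚ)
    in suc n , ℕ.s≤s ℕ.z≤n , map-eventually (λ m z≤R → ℚ.≤-trans z≤R (ℚ.≤-trans (ℚ.<⇒≤ R<n)
         (ℚ.≤-trans (ℚ.≤-reflexive (ℚ.*-identityʳ (fromℕ n))) (fromℕ-mono-≤ (ℕ.n≤1+n n))))) h

  excess-null : ∀ x y → Null (λ n → excess (expTerm x) (expTerm y) n 0)
  excess-null x y ε ε>0 =
    let Bx , 1≤Bx , hx = natural-bound x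
        By , 1≤By , hy = natural-bound y
        B = Bx ℕ.⊔ By
        K = fromℕ ((4 ℕ.* B) ℕ.^ (4 ℕ.* B))
        N , large = archimedean-≥ (K ℚ.* (K ℚ.+ K) ℚ.+ K ℚ.* (K ℚ.+ K)) ε ε>0
    in N , λ n N≤n → map-eventually
      (λ { m (x≤ , y≤) → ℚ.*-cancelˡ-<-nonNeg (fromℕ n) {{ℚ.nonNegative (fromℕ-mono-≤ ℕ.z≤n)}} (ℚ.≤-<-trans
        (excess-expTerm-bound B (ℕ.≤-trans 1≤Bx (ℕ.m≤m⊔n Bx By)) m x y
          (ℚ.≤-trans x≤ (fromℕ-mono-≤ (ℕ.m≤m⊔n Bx By))) (ℚ.≤-trans y≤ (fromℕ-mono-≤ (ℕ.m≤n⊔m Bx By))) n) (large n N≤n)) })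
      (both hx hy)

  partialSum : ℂ → ℕ → ℂ
  partialSum z n = sum {n} (λ k → expTerm z (toℕ k))

  IsExp-Limit : ∀ {z w} → IsExp z w → Limit (partialSum z) w
  IsExp-Limit {z} {w} = ⟶⇒Limit {partialSum z} {w}

  Limit-IsExp : ∀ {z w} → Limit (partialSum z) w → IsExp z w
  Limit-IsExp {z} {w} = Limit⇒⟶ {partialSum z} {w}

  -- The product of the partial sums is the partial sum for x + y plus the excess, a null sequence;
  -- the Cauchy product of the two series is the series for x + y by `exponential-unique`.
  IsExp-+ : ∀ {x y a b} → IsExp x a → IsExp y b → IsExp (x + y) (a * b)
  IsExp-+ {x} {y} {a} {b} ha hb = Limit-IsExp {x + y} {a * b}
    (Limit-perturb {λ n → partialSum x n * partialSum y n} {partialSum (x + y)} {λ n → excess (expTerm x) (expTerm y) n 0} {a * b} {a * b}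
      (Limit-* {partialSum x} {partialSum y} {a} {b} (IsExp-Limit {x} {a} ha) (IsExp-Limit {y} {b} hb))
      (excess-null x y)
      (always product)
      (≈-refl {a * b}))
    where
    open ℤ-Algebra ℂ-algebra using (+-congʳ)
    e : ℕ → ℂ
    e n = excess (expTerm x) (expTerm y) n 0
    product : ∀ n → partialSum x n * partialSum y n ≈ partialSum (x + y) n + e n
    product n = ≈-trans {partialSum x n * partialSum y n} {S n (conv (expTerm x) (expTerm y)) + e n} {partialSum (x + y) n + e n}
      (subst (λ k → partialSum x n * partialSum y k ≈ S n (conv (expTerm x) (expTerm y)) + e n) (ℕ.+-identityʳ n) (S-product n 0 (expTerm x) (expTerm y)))
      (+-congʳ {e n} {S n (conv (expTerm x) (expTerm y))} {partialSum (x + y) n} (S-cong n {conv (expTerm x) (expTerm y)} {expTerm (x + y)}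
        (exponential-unique ℂ-characteristicZero {x + y} {conv (expTerm x) (expTerm y)} {expTerm (x + y)}
          (conv-exponential {x} {y} {expTerm x} {expTerm y} (expTerm-exponential x) (expTerm-exponential y)) (expTerm-exponential (x + y)))))

  null-zero : Null (λ _ → 0ᶜ)
  null-zero ε ε>0 = always λ n → always λ m → ε>0

  IsExp-resp : ∀ {x y a b} → x ≈ y → a ≈ b → IsExp x a → IsExp y b
  IsExp-resp {x} {y} {a} {b} x≈y a≈b ha = Limit-IsExp {y} {b}
    (Limit-perturb {partialSum x} {partialSum y} {λ _ → 0ᶜ} {a} {b} (IsExp-Limit {x} {a} ha) null-zero
      (always λ n → ≈-trans {partialSum x n} {partialSum y n} {partialSum y n + 0ᶜ}
        (S-cong n {expTerm x} {expTerm y} (exponential-unique ℂ-characteristicZero {y} {expTerm x} {expTerm y}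
          (proj₁ (expTerm-exponential x) , λ k → ≈-trans {derivative (expTerm x) k} {x * expTerm x k} {y * expTerm x k} (proj₂ (expTerm-exponential x) k) (*-congʳ {expTerm x k} {x} {y} x≈y))
          (expTerm-exponential y)))
        (≈-sym {partialSum y n + 0ᶜ} {partialSum y n} (+-identityʳ (partialSum y n)))) a≈b)
    where open ℤ-Algebra ℂ-algebra using (*-congʳ; +-identityʳ)

  IsExp-unique : ∀ {z a b} → IsExp z a → IsExp z b → a ≈ b
  IsExp-unique {z} {a} {b} ha hb = Limit-unique {partialSum z} {a} {b} (IsExp-Limit {z} {a} ha) (IsExp-Limit {z} {b} hb)

-- Conjugation and integer multiples of exponents.

module ImaginaryExponential where
  open import Defs
  open import Data.Rational.Base using (∣_∣)
  open import Data.Rational.Solver using (module +-*-Solver)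
  open EventualProperties
  open RealEquality using (-ʳ-cong)
  open ComplexRing using (ℂ-algebra; ≈-pointwise; ≈-refl; ≈-sym; ≈-trans)
  open ComplexCharacteristic using (ℂ-characteristicZero)
  open ComplexNorm
  open Limits
  open ComplexExponential
  open ExponentialSequences.Sequences ℂ-algebra
  open ℤ-Algebra ℂ-algebra using (ι; *-congʳ; *-congˡ; +-cong; zeroˡ; zeroʳ; +-identityʳ)

  conj-cong : ∀ {x y} → x ≈ y → conj x ≈ conj y
  conj-cong {x} {y} (h , g) = h , -ʳ-cong {im x} {im y} g

  conj-* : ∀ x y → conj (x * y) ≈ conj x * conj y
  conj-* x y = ≈-pointwise {conj (x * y)} {conj x * conj y}
    (λ n → solve 4 (λ a b c d → a :* c :+ :- (b :* d) := a :* c :+ :- (:- b :* :- d)) ≡.refl (seq (re x) n) (seq (im x) n) (seq (re y) n) (seq (im y) n))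
    (λ n → solve 4 (λ a b c d → :- (a :* d :+ b :* c) := a :* :- d :+ :- b :* c) ≡.refl (seq (re x) n) (seq (im x) n) (seq (re y) n) (seq (im y) n))
    where open +-*-Solver

  conj-ι : ∀ n → conj (ι n) ≈ ι n
  conj-ι n = ≈-pointwise {conj (ι n)} {ι n} (λ _ → ≡.refl) (λ _ → ≡.refl)

  conj-^ : ∀ z n → conj (z ^ n) ≈ conj z ^ n
  conj-^ z zero    = conj-ι (ℤ.+ 1)
  conj-^ z (suc n) = ≈-trans {conj (z * z ^ n)} {conj z * conj (z ^ n)} {conj z * conj z ^ n} (conj-* z (z ^ n))
    (*-congˡ {conj z} {conj (z ^ n)} {conj z ^ n} (conj-^ z n))

  conj-S : ∀ n a → conj (S n a) ≈ S n (conj ∘ a)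
  conj-S zero    a = conj-ι (ℤ.+ 0)
  conj-S (suc n) a = ≈-trans {conj (a 0 + S n (a ∘ ℕ.suc))} {conj (a 0) + conj (S n (a ∘ ℕ.suc))} {S (suc n) (conj ∘ a)}
    (≈-pointwise {conj (a 0 + S n (a ∘ ℕ.suc))} {conj (a 0) + conj (S n (a ∘ ℕ.suc))} (λ _ → ≡.refl)
      (λ m → ℚ.neg-distrib-+ (seq (im (a 0)) m) (seq (im (S n (a ∘ ℕ.suc))) m)))
    (+-cong {conj (a 0)} {conj (a 0)} {conj (S n (a ∘ ℕ.suc))} {S n (conj ∘ a ∘ ℕ.suc)} (≈-refl {conj (a 0)}) (conj-S n (a ∘ ℕ.suc)))

  conj-exponential : ∀ {z a} → IsExponential z a → IsExponential (conj z) (conj ∘ a)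
  conj-exponential {z} {a} (a₀ , a′) = ≈-trans {conj (a 0)} {conj 1ᶜ} {1ᶜ} (conj-cong {a 0} {1ᶜ} a₀) (conj-ι (ℤ.+ 1)) , λ k →
    ≈-trans {ι (ℤ.+ suc k) * conj (a (suc k))} {conj (ι (ℤ.+ suc k)) * conj (a (suc k))} {conj z * conj (a k)}
      (*-congʳ {conj (a (suc k))} {ι (ℤ.+ suc k)} {conj (ι (ℤ.+ suc k))} (≈-sym {conj (ι (ℤ.+ suc k))} {ι (ℤ.+ suc k)} (conj-ι (ℤ.+ suc k))))
      (≈-trans {conj (ι (ℤ.+ suc k)) * conj (a (suc k))} {conj (ι (ℤ.+ suc k) * a (suc k))} {conj z * conj (a k)}
        (≈-sym {conj (ι (ℤ.+ suc k) * a (suc k))} {conj (ι (ℤ.+ suc k)) * conj (a (suc k))} (conj-* (ι (ℤ.+ suc k)) (a (suc k))))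
        (≈-trans {conj (ι (ℤ.+ suc k) * a (suc k))} {conj (z * a k)} {conj z * conj (a k)} (conj-cong {ι (ℤ.+ suc k) * a (suc k)} {z * a k} (a′ k)) (conj-* z (a k))))

  IsExp-conj : ∀ {z w} → IsExp z w → IsExp (conj z) (conj w)
  IsExp-conj {z} {w} h = Limit-IsExp {conj z} {conj w}
    (Limit-perturb {conj ∘ partialSum z} {partialSum (conj z)} {λ _ → 0ᶜ} {conj w} {conj w} conj-limit null-zero
      (always λ n → ≈-trans {conj (partialSum z n)} {partialSum (conj z) n} {partialSum (conj z) n + 0ᶜ}
        (≈-trans {conj (partialSum z n)} {S n (conj ∘ expTerm z)} {partialSum (conj z) n} (conj-S n (expTerm z))
          (S-cong n {conj ∘ expTerm z} {expTerm (conj z)} (exponential-unique ℂ-characteristicZero {conj z} {conj ∘ expTerm z} {expTerm (conj z)}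
            (conj-exponential {z} {expTerm z} (expTerm-exponential z)) (expTerm-exponential (conj z)))))
        (≈-sym {partialSum (conj z) n + 0ᶜ} {partialSum (conj z) n} (+-identityʳ (partialSum (conj z) n))))
      (≈-refl {conj w}))
    where
    conj-limit : Limit (conj ∘ partialSum z) (conj w)
    conj-limit ε ε>0 = map-eventually (λ n → map-eventually (λ m → subst (ℚ._< ε)
      (≡.cong (∣ seq (re (partialSum z n + - w)) m ∣ ℚ.+_) (≡.trans (≡.sym (ℚ.∣-p∣≡∣p∣ (seq (im (partialSum z n + - w)) m)))
        (≡.cong ∣_∣ (ℚ.neg-distrib-+ (seq (im (partialSum z n)) m) (ℚ.- seq (im w) m)))))))
      (IsExp-Limit {z} {w} h ε ε>0)

  IsExp-0 : IsExp 0ᶜ 1ᶜ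
  IsExp-0 = Limit-IsExp {0ᶜ} {1ᶜ} (Limit-perturb {λ _ → 1ᶜ} {partialSum 0ᶜ} {λ _ → 0ᶜ} {1ᶜ} {1ᶜ} constant null-zero
    (1 , λ { (suc n) _ → ≈-sym {partialSum 0ᶜ (suc n) + 0ᶜ} {1ᶜ} (≈-trans {partialSum 0ᶜ (suc n) + 0ᶜ} {partialSum 0ᶜ (suc n)} {1ᶜ} (+-identityʳ (partialSum 0ᶜ (suc n)))
      (≈-trans {partialSum 0ᶜ (suc n)} {S (suc n) unit} {1ᶜ} (S-cong (suc n) {expTerm 0ᶜ} {unit} (exponential-unique ℂ-characteristicZero {0ᶜ} {expTerm 0ᶜ} {unit} (expTerm-exponential 0ᶜ) unit-exponential)) (S-unit n))) })
    (≈-refl {1ᶜ}))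
    where
    unit : ℕ → ℂ
    unit zero    = 1ᶜ
    unit (suc k) = 0ᶜ
    unit-exponential : IsExponential 0ᶜ unit
    unit-exponential = ≈-refl {1ᶜ} , λ k → ≈-trans {ι (ℤ.+ suc k) * 0ᶜ} {0ᶜ} {0ᶜ * unit k} (zeroʳ (ι (ℤ.+ suc k))) (≈-sym {0ᶜ * unit k} {0ᶜ} (zeroˡ (unit k)))
    S-zero : ∀ n → S n (λ _ → 0ᶜ) ≈ 0ᶜ
    S-zero zero    = ≈-refl {0ᶜ}
    S-zero (suc n) = ≈-trans {0ᶜ + S n (λ _ → 0ᶜ)} {0ᶜ + 0ᶜ} {0ᶜ} (+-cong {0ᶜ} {0ᶜ} {S n (λ _ → 0ᶜ)} {0ᶜ} (≈-refl {0ᶜ}) (S-zero n)) (+-identityʳ 0ᶜ)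
    S-unit : ∀ n → S (suc n) unit ≈ 1ᶜ
    S-unit n = ≈-trans {1ᶜ + S n (λ _ → 0ᶜ)} {1ᶜ + 0ᶜ} {1ᶜ} (+-cong {1ᶜ} {1ᶜ} {S n (λ _ → 0ᶜ)} {0ᶜ} (≈-refl {1ᶜ}) (S-zero n)) (+-identityʳ 1ᶜ)
    constant : Limit (λ _ → 1ᶜ) 1ᶜ
    constant ε ε>0 = always λ n → always λ m → ε>0

  IsExp-multiple : ∀ {z a} → IsExp z a → ∀ n → IsExp (ι (ℤ.+ n) * z) (a ^ n)
  IsExp-multiple {z} {a} h zero    = IsExp-resp {0ᶜ} {ι (ℤ.+ 0) * z} {1ᶜ} {1ᶜ} (≈-sym {ι (ℤ.+ 0) * z} {0ᶜ} (zeroˡ z)) (≈-refl {1ᶜ}) IsExp-0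
  IsExp-multiple {z} {a} h (suc n) = IsExp-resp {z + ι (ℤ.+ n) * z} {ι (ℤ.+ suc n) * z} {a * a ^ n} {a * a ^ n}
    (multiple-suc z n) (≈-refl {a * a ^ n}) (IsExp-+ {z} {ι (ℤ.+ n) * z} {a} {a ^ n} h (IsExp-multiple {z} {a} h n))

  imaginary : ℝ → ℂ
  imaginary θ = 0ʳ +i θ

  conj-imaginary : ∀ θ → conj (imaginary θ) ≈ - imaginary θ
  conj-imaginary θ = ≈-pointwise {conj (imaginary θ)} { - imaginary θ} (λ _ → ≡.refl) (λ _ → ≡.refl)

  IsExp-neg : ∀ {θ a} → IsExp (imaginary θ) a → IsExp (- imaginary θ) (conj a)
  IsExp-neg {θ} {a} h = IsExp-resp {conj (imaginary θ)} { - imaginary θ} {conj a} {conj a} (conj-imaginary θ) (≈-refl {conj a}) (IsExp-conj {imaginary θ} {a} h)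

  -- The series has real coefficients, so the conjugate of a is the exponential of -iθ, and the
  -- product is the exponential of 0.
  exp-imaginary-unit : ∀ {θ a} → IsExp (imaginary θ) a → a * conj a ≈ 1ᶜ
  exp-imaginary-unit {θ} {a} h = IsExp-unique {0ᶜ} {a * conj a} {1ᶜ}
    (IsExp-resp {imaginary θ + - imaginary θ} {0ᶜ} {a * conj a} {a * conj a} (-‿inverseʳ (imaginary θ)) (≈-refl {a * conj a})
      (IsExp-+ {imaginary θ} { - imaginary θ} {a} {conj a} h (IsExp-neg {θ} {a} h)))
    IsExp-0
    where open ℤ-Algebra ℂ-algebra using (-‿inverseʳ)

-- Primes modulo four.

module PrimesModuloFour where
  open import Data.Nat.Divisibility using (divides)
  open import Data.Nat.DivMod using (m≡m%n+[m/n]*n; m%n<n)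
  open import Data.Nat.Primality using (prime⇒irreducible)
  open import Data.Nat.Tactic.RingSolver using (solve-∀)

  prime-mod-4 : ∀ {p} → Prime p → p ≡ 2 ⊎ (∃ λ b → p ≡ 1 ℕ.+ b ℕ.* 4) ⊎ (∃ λ b → p ≡ 3 ℕ.+ b ℕ.* 4)
  prime-mod-4 {p} p-prime = cases (p ℕ.% 4) (p ℕ./ 4) (m≡m%n+[m/n]*n p 4) (m%n<n p 4)
    where
    even : ∀ c → p ≡ c ℕ.* 2 → p ≡ 2
    even c p≡2c with prime⇒irreducible p-prime (divides c p≡2c)
    ... | inj₁ ()
    ... | inj₂ 2≡p = ≡.sym 2≡p
    cases : ∀ r b → p ≡ r ℕ.+ b ℕ.* 4 → r ℕ.< 4 → p ≡ 2 ⊎ (∃ λ b → p ≡ 1 ℕ.+ b ℕ.* 4) ⊎ (∃ λ b → p ≡ 3 ℕ.+ b ℕ.* 4)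
    cases 0 b p≡ _ = inj₁ (even (b ℕ.* 2) (≡.trans p≡ (lemma b)))
      where
      lemma : ∀ b → b ℕ.* 4 ≡ b ℕ.* 2 ℕ.* 2
      lemma = solve-∀
    cases 1 b p≡ _ = inj₂ (inj₁ (b , p≡))
    cases 2 b p≡ _ = inj₁ (even (1 ℕ.+ b ℕ.* 2) (≡.trans p≡ (lemma b)))
      where
      lemma : ∀ b → 2 ℕ.+ b ℕ.* 4 ≡ (1 ℕ.+ b ℕ.* 2) ℕ.* 2
      lemma = solve-∀
    cases 3 b p≡ _ = inj₂ (inj₂ (b , p≡))
    cases (suc (suc (suc (suc r)))) b p≡ (ℕ.s≤s (ℕ.s≤s (ℕ.s≤s (ℕ.s≤s ()))))

-- Algebra of the quarter turn.

module QuarterTurns where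
  open RootsOfUnity using (CharacteristicZero)

  module Turns (A : ℤ-Algebra) where
    open ℤ-Algebra A
    open import Algebra.Properties.Semiring.Exp semiring using (_^_; ^-homo-*)
    open import Relation.Binary.Reasoning.Setoid setoid
    open Solver using (solve; con; _:+_; _:*_; _:-_; :-_; _:=_)

    quarter-square : ∀ {u ū} → u * ū ≈ 1# → ū ≈ - u → u ^ 2 ≈ - 1#
    quarter-square {u} {ū} uū≈1 ū≈-u = begin
      u * (u * 1#)      ≈⟨ *-congˡ (*-identityʳ u) ⟩
      u * u             ≈⟨ solve 1 (λ u → u :* u := :- (u :* (:- u))) refl u ⟩
      - (u * - u)       ≈⟨ -‿cong (*-congˡ ū≈-u) ⟨
      - (u * ū)         ≈⟨ -‿cong uū≈1 ⟩
      - 1#              ∎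

    quarter-fourth : ∀ {u} → u ^ 2 ≈ - 1# → u ^ 4 ≈ 1#
    quarter-fourth {u} u²≈-1 = begin
      u ^ 4                 ≈⟨ ^-homo-* u 2 2 ⟩
      u ^ 2 * u ^ 2         ≈⟨ *-cong u²≈-1 u²≈-1 ⟩
      - 1# * - 1#           ≈⟨ solve 1 (λ o → (:- o) :* (:- o) := o :* o) refl 1# ⟩
      1# * 1#               ≈⟨ *-identityˡ 1# ⟩
      1#                    ∎

    1≉-1 : CharacteristicZero A → ¬ 1# ≈ - 1#
    1≉-1 char0 h = CharacteristicZero.1≉0 char0 (CharacteristicZero.torsion-free char0 (ℤ.+ 2) 1# (λ ()) (begin
      ι (ℤ.+ 2) * 1#     ≈⟨ solve 1 (λ o → con (ℤ.+ 2) :* o := o :+ o) refl 1# ⟩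
      1# + 1#            ≈⟨ +-congˡ h ⟩
      1# + - 1#          ≈⟨ -‿inverseʳ 1# ⟩
      0#                 ∎))

    scale-swap : ∀ {m n z x y} → y ≈ ι m * z → ι n * z ≈ x → ι n * y ≈ ι m * x
    scale-swap {m} {n} {z} {x} {y} y≈mz nz≈x = begin
      ι n * y             ≈⟨ *-congˡ y≈mz ⟩
      ι n * (ι m * z)     ≈⟨ solve 3 (λ n m z → n :* (m :* z) := m :* (n :* z)) refl _ _ _ ⟩
      ι m * (ι n * z)     ≈⟨ *-congˡ nz≈x ⟩
      ι m * x             ∎

    halve : ∀ {z x y} → y ≈ ι (ℤ.+ 4) * z → ι (ℤ.+ 2) * z ≈ x → y ≈ ι (ℤ.+ 2) * x
    halve {z} {x} {y} y≈4z 2z≈x = begin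
      y                                     ≈⟨ y≈4z ⟩
      ι (ℤ.+ 4) * z                         ≈⟨ solve 1 (λ z → con (ℤ.+ 4) :* z := con (ℤ.+ 2) :* (con (ℤ.+ 2) :* z)) refl z ⟩
      ι (ℤ.+ 2) * (ι (ℤ.+ 2) * z)           ≈⟨ *-congˡ 2z≈x ⟩
      ι (ℤ.+ 2) * x                         ∎

    ι-linear : ∀ r b → ι (ℤ.+ (r ℕ.+ b ℕ.* 4)) ≈ ι (ℤ.+ r) + ι (ℤ.+ b) * ι (ℤ.+ 4)
    ι-linear r b = trans (+-homo (ℤ.+ r) (ℤ.+ (b ℕ.* 4))) (+-congˡ (trans (reflexive (≡.cong ι (ℤ.pos-* b 4))) (*-homo (ℤ.+ b) (ℤ.+ 4))))

    -- In the application x = iπ/2 and y = 2πi/p, which are p and 4 times the same number. If exp y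
    -- = 1, adding multiples of y to x leaves the exponential unchanged.
    remainder-1 : ∀ b {z x y} → y ≈ ι (ℤ.+ 4) * z → ι (ℤ.+ (1 ℕ.+ b ℕ.* 4)) * z ≈ x → x + ι (ℤ.+ b) * - y ≈ z
    remainder-1 b {z} {x} {y} y≈4z pz≈x = begin
      x + ι (ℤ.+ b) * - y
        ≈⟨ +-cong (trans (sym pz≈x) (*-congʳ (ι-linear 1 b))) (*-congˡ (-‿cong y≈4z)) ⟩
      (ι (ℤ.+ 1) + ι (ℤ.+ b) * ι (ℤ.+ 4)) * z + ι (ℤ.+ b) * - (ι (ℤ.+ 4) * z)
        ≈⟨ solve 3 (λ b f z → (con (ℤ.+ 1) :+ b :* f) :* z :+ b :* (:- (f :* z)) := z) refl (ι (ℤ.+ b)) (ι (ℤ.+ 4)) z ⟩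
      z ∎

    remainder-3 : ∀ b {z x y} → y ≈ ι (ℤ.+ 4) * z → ι (ℤ.+ (3 ℕ.+ b ℕ.* 4)) * z ≈ x → - x + ι (ℤ.+ suc b) * y ≈ z
    remainder-3 b {z} {x} {y} y≈4z pz≈x = begin
      - x + ι (ℤ.+ suc b) * y
        ≈⟨ +-cong (-‿cong (trans (sym pz≈x) (*-congʳ (ι-linear 3 b)))) (*-cong (+-homo (ℤ.+ 1) (ℤ.+ b)) y≈4z) ⟩
      - ((ι (ℤ.+ 3) + ι (ℤ.+ b) * ι (ℤ.+ 4)) * z) + (ι (ℤ.+ 1) + ι (ℤ.+ b)) * (ι (ℤ.+ 4) * z)
        ≈⟨ solve 2 (λ b z → :- ((con (ℤ.+ 3) :+ b :* con (ℤ.+ 4)) :* z) :+ (con (ℤ.+ 1) :+ b) :* (con (ℤ.+ 4) :* z) := z) refl (ι (ℤ.+ b)) z ⟩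
      z ∎

    one-power : ∀ n → 1# ^ n ≈ 1#
    one-power zero    = refl
    one-power (suc n) = trans (*-identityˡ _) (one-power n)

-- exp(2πi/p) is a nontrivial p-th root of unity.

module PrincipalRootOfUnity where
  open import Defs
  open import Data.Empty using (⊥)
  open import Data.Rational.Base using (_/_)
  open import Data.Rational.Solver using (module +-*-Solver)
  open PrimesModuloFour
  open RationalLemmas
  open RationalBounds
  open EventualProperties
  open ComplexRing using (ℂ-algebra; ≈-pointwise; ≈-refl; ≈-sym; ≈-trans)
  open ComplexCharacteristic using (ℂ-characteristicZero)
  open ComplexExponential
  open ImaginaryExponential
  open ℤ-Algebra ℂ-algebra using (ι)

  open QuarterTurns.Turns ℂ-algebra

  <ʳ-multiple : ∀ {r a b} → 0ʳ <ʳ r → ∀ c → 0ℚ ℚ.< c → (∀ n → c ℚ.* (seq r n ℚ.- 0ℚ) ≡ seq b n ℚ.- seq a n) → a <ʳ b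
  <ʳ-multiple (ε , 0<ε , large) c 0<c h = c ℚ.* ε , *-pos 0<c 0<ε , map-eventually
    (λ n ε<r → subst (c ℚ.* ε ℚ.<_) (h n) (ℚ.*-monoʳ-<-pos c {{ℚ.positive 0<c}} ε<r)) large

  module _ {q : ℕ} (p-prime : Prime (suc q)) {π : ℝ} (isPi : IsPi π) {w : ℂ} (isExp : IsExp ((2πi/ suc q) π) w) where
    open IsPi isPi

    1/p : ℚ
    1/p = (ℤ.+ 1) / suc q

    half-π t : ℝ
    half-π = fromℚ ½ *ʳ π
    t      = fromℚ 1/p *ʳ half-π

    -- `ζ` is iπ/(2p), a common measure of x = iπ/2 = p ζ and y = 2πi/p = 4 ζ; relations between u =
    -- e^x and w = e^y come from integer combinations of the two.
    x ζ y u : ℂ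
    x = imaginary half-π
    ζ = imaginary t
    y = (2πi/ suc q) π
    u = 0ʳ +i proj₁ cos-π/2

    exp-x : IsExp x u
    exp-x = proj₂ cos-π/2

    1/p*p : 1/p ℚ.* fromℕ (suc q) ≡ 1ℚ
    1/p*p = /-*-fromℤ (ℤ.+ 1) (suc q)

    2/p : (ℤ.+ 2) / suc q ≡ fromℕ 2 ℚ.* 1/p
    2/p = begin
      r                                                       ≡⟨ ℚ.*-identityʳ r ⟨
      r ℚ.* 1ℚ                                                ≡⟨ ≡.cong (r ℚ.*_) 1/p*p ⟨
      r ℚ.* (1/p ℚ.* fromℕ (suc q))                       ≡⟨ solve 3 (λ r s p → r :* (s :* p) := (r :* p) :* s) ≡.refl r 1/p (fromℕ (suc q)) ⟩
      (r ℚ.* fromℕ (suc q)) ℚ.* 1/p                       ≡⟨ ≡.cong (ℚ._* 1/p) (/-*-fromℤ (ℤ.+ 2) (suc q)) ⟩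
      fromℕ 2 ℚ.* 1/p                                   ∎
      where
      open ≡.≡-Reasoning
      open +-*-Solver
      r = (ℤ.+ 2) / suc q

    y≈4ζ : y ≈ ι (ℤ.+ 4) * ζ
    y≈4ζ = ≈-pointwise {y} {ι (ℤ.+ 4) * ζ}
      (λ n → solve 1 (λ t → con 0ℚ := con (fromℕ 4) :* con 0ℚ :+ :- (con 0ℚ :* t)) ≡.refl (seq t n))
      (λ n → ≡.trans (≡.cong (ℚ._* seq π n) 2/p) (solve 2 (λ s x → (con (fromℕ 2) :* s) :* x := con (fromℕ 4) :* (s :* (con ½ :* x)) :+ con 0ℚ :* con 0ℚ) ≡.refl 1/p (seq π n)))
      where open +-*-Solver

    pζ≈x : ι (ℤ.+ suc q) * ζ ≈ x
    pζ≈x = ≈-pointwise {ι (ℤ.+ suc q) * ζ} {x}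
      (λ n → solve 2 (λ p t → p :* con 0ℚ :+ :- (con 0ℚ :* t) := con 0ℚ) ≡.refl (fromℕ (suc q)) (seq t n))
      (λ n → ≡.trans (solve 3 (λ p s h → p :* (s :* h) :+ con 0ℚ :* con 0ℚ := (s :* p) :* h) ≡.refl (fromℕ (suc q)) 1/p (seq half-π n))
        (≡.trans (≡.cong (ℚ._* seq half-π n) 1/p*p) (ℚ.*-identityˡ (seq half-π n))))
      where open +-*-Solver

    u-unit : u * conj u ≈ 1ᶜ
    u-unit = exp-imaginary-unit {half-π} {u} exp-x

    u²≈-1 : u ^ 2 ≈ - 1ᶜ
    u²≈-1 = quarter-square {u} {conj u} u-unit (conj-imaginary (proj₁ cos-π/2))

    -- p y = 4 x gives w^p = u⁴, and u² = -1 because u is purely imaginary with u times its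
    -- conjugate equal to 1. So exp(2πi) = 1 comes out of cos(π/2) = 0.
    root-of-unity : w ^ suc q ≈ 1ᶜ
    root-of-unity = ≈-trans {w ^ suc q} {u ^ 4} {1ᶜ}
      (IsExp-unique {ι (ℤ.+ 4) * x} {w ^ suc q} {u ^ 4}
        (IsExp-resp {ι (ℤ.+ suc q) * y} {ι (ℤ.+ 4) * x} {w ^ suc q} {w ^ suc q}
          (scale-swap {ℤ.+ 4} {ℤ.+ suc q} {ζ} {x} {y} y≈4ζ pζ≈x) (≈-refl {w ^ suc q}) (IsExp-multiple {y} {w} isExp (suc q)))
        (IsExp-multiple {x} {u} exp-x 4))
      (quarter-fourth {u} u²≈-1)

    0<1/p : 0ℚ ℚ.< 1/p
    0<1/p = ℚ.positive⁻¹ 1/p {{ℚ.normalize-pos 1 (suc q)}}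

    0<t : 0ʳ <ʳ t
    0<t = <ʳ-multiple {π} {0ʳ} {t} π-positive (1/p ℚ.* ½) (*-pos 0<1/p (ℚ.positive⁻¹ ½))
      (λ n → solve 2 (λ s x → (s :* con ½) :* (x :- con 0ℚ) := s :* (con ½ :* x) :- con 0ℚ) ≡.refl 1/p (seq π n))
      where open +-*-Solver

    t<half-π : 1 ℕ.≤ q → t <ʳ half-π
    t<half-π 1≤q = <ʳ-multiple {π} {t} {half-π} π-positive ((fromℕ q ℚ.* 1/p) ℚ.* ½)
      (*-pos (*-pos (ℚ.<-≤-trans (ℚ.positive⁻¹ 1ℚ) (fromℕ-mono-≤ 1≤q)) 0<1/p) (ℚ.positive⁻¹ ½))
      (λ n → begin
        ((fromℕ q ℚ.* 1/p) ℚ.* ½) ℚ.* (seq π n ℚ.- 0ℚ)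
          ≡⟨ solve 3 (λ q s x → ((q :* s) :* con ½) :* (x :- con 0ℚ) := (s :* (con 1ℚ :+ q)) :* (con ½ :* x) :- s :* (con ½ :* x)) ≡.refl (fromℕ q) 1/p (seq π n) ⟩
        (1/p ℚ.* (1ℚ ℚ.+ fromℕ q)) ℚ.* (½ ℚ.* seq π n) ℚ.- seq t n
          ≡⟨ ≡.cong (λ c → c ℚ.* (½ ℚ.* seq π n) ℚ.- seq t n) (≡.trans (≡.cong (1/p ℚ.*_) (≡.sym (fromℤ-+ (ℤ.+ 1) (ℤ.+ q)))) 1/p*p) ⟩
        1ℚ ℚ.* (½ ℚ.* seq π n) ℚ.- seq t n
          ≡⟨ ≡.cong (ℚ._- seq t n) (ℚ.*-identityˡ (½ ℚ.* seq π n)) ⟩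
        seq half-π n ℚ.- seq t n ∎)
      where
      open ≡.≡-Reasoning
      open +-*-Solver

    1≤q : 1 ℕ.≤ q
    1≤q = positive q p-prime
      where
      positive : ∀ n → Prime (suc n) → 1 ℕ.≤ n
      positive zero    prime₁ = contradiction prime₁ ¬prime[1]
      positive (suc n) _      = ℕ.s≤s ℕ.z≤n

    -- Write p = 4b ± 1: if w = 1 then exp ζ = exp (± x), so the cosine vanishes at t = π/(2p).
    w≉1 : ¬ w ≈ 1ᶜ
    w≉1 w≈1 = cases (prime-mod-4 p-prime)
      where
      exp-y : IsExp y 1ᶜ
      exp-y = IsExp-resp {y} {y} {w} {1ᶜ} (≈-refl {y}) w≈1 isExp

      exp-multiple : ∀ {z} → IsExp z 1ᶜ → ∀ n → IsExp (ι (ℤ.+ n) * z) 1ᶜ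
      exp-multiple {z} h n = IsExp-resp {ι (ℤ.+ n) * z} {ι (ℤ.+ n) * z} {1ᶜ ^ n} {1ᶜ} (≈-refl {ι (ℤ.+ n) * z}) (one-power n) (IsExp-multiple {z} {1ᶜ} h n)

      exp-+ : ∀ {a b c} → IsExp a c → IsExp b 1ᶜ → a + b ≈ ζ → IsExp ζ c
      exp-+ {a} {b} {c} ha hb a+b≈ζ = IsExp-resp {a + b} {ζ} {c * 1ᶜ} {c} a+b≈ζ (*-identityʳ c) (IsExp-+ {a} {b} {c} {1ᶜ} ha hb)
        where open ℤ-Algebra ℂ-algebra using (*-identityʳ)

      impossible : ∀ {s} → ¬ IsExp ζ (0ʳ +i s)
      impossible {s} h = least t 0<t (t<half-π 1≤q) (s , h)

      cases : suc q ≡ 2 ⊎ (∃ λ b → suc q ≡ 1 ℕ.+ b ℕ.* 4) ⊎ (∃ λ b → suc q ≡ 3 ℕ.+ b ℕ.* 4) → ⊥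
      -- For p = 2 one has y = 2x, so w = u² = -1.
      cases (inj₁ p≡2) = 1≉-1 ℂ-characteristicZero (≈-trans {1ᶜ} {u ^ 2} { - 1ᶜ}
        (IsExp-unique {y} {1ᶜ} {u ^ 2} exp-y (IsExp-resp {ι (ℤ.+ 2) * x} {y} {u ^ 2} {u ^ 2}
          (≈-sym {y} {ι (ℤ.+ 2) * x} (halve {ζ} {x} {y} y≈4ζ (subst (λ p → ι (ℤ.+ p) * ζ ≈ x) p≡2 pζ≈x))) (≈-refl {u ^ 2}) (IsExp-multiple {x} {u} exp-x 2)))
        u²≈-1)
      cases (inj₂ (inj₁ (b , p≡))) = impossible {proj₁ cos-π/2} (exp-+ {x} {ι (ℤ.+ b) * - y} {u} exp-x
        (exp-multiple { - y} (IsExp-resp { - y} { - y} {conj 1ᶜ} {1ᶜ} (≈-refl { - y}) (conj-ι (ℤ.+ 1)) (IsExp-neg {im y} {1ᶜ} exp-y)) b)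
        (remainder-1 b {ζ} {x} {y} y≈4ζ (subst (λ p → ι (ℤ.+ p) * ζ ≈ x) p≡ pζ≈x)))
      cases (inj₂ (inj₂ (b , p≡))) = impossible { -ʳ proj₁ cos-π/2} (exp-+ { - x} {ι (ℤ.+ suc b) * y} {conj u} (IsExp-neg {half-π} {u} exp-x)
        (exp-multiple {y} exp-y (suc b))
        (remainder-3 b {ζ} {x} {y} y≈4ζ (subst (λ p → ι (ℤ.+ p) * ζ ≈ x) p≡ pζ≈x)))

-- Row indices as residues, and their permutation by units.

module FinResidues where
  open import Data.Fin.Permutation using (Permutation′; permutation)
  open import Data.Integer.Divisibility.Signed using (∣⇒∣ᵤ)
  open import Data.Integer.DivMod using (n%ℕd<d)
  import Data.Nat.Divisibility as ℕ
  open IntegersModulo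

  module _ (q : ℕ) where
    private
      infix 4 _≡ₘ_
      _≡ₘ_ : ℤ → ℤ → Set
      _≡ₘ_ = _≡ₚ_ (suc q)

    small-≡ : ∀ {m n} → m ℕ.≤ n → n ℕ.< suc q → ℤ.+ m ≡ₘ ℤ.+ n → m ≡ n
    small-≡ {m} {n} m≤n n<p m≡n with n ℕ.∸ m in eq
    ... | zero  = ℕ.≤-antisym m≤n (ℕ.m∸n≡0⇒m≤n eq)
    ... | suc d = contradiction (ℕ.∣⇒≤ (≡.subst (suc q ℕ.∣_) (≡.trans distance eq) (∣⇒∣ᵤ m≡n)))
                    (ℕ.<⇒≱ (ℕ.≤-<-trans (≡.subst (ℕ._≤ n) eq (ℕ.m∸n≤m n m)) n<p))
      where
      distance : ℤ.∣ ℤ.+ m ℤ.- ℤ.+ n ∣ ≡ n ℕ.∸ m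
      distance = ≡.trans (≡.cong ℤ.∣_∣ (ℤ.m-n≡m⊖n m n)) (ℤ.∣⊖∣-≤ m≤n)

    residue-unique : ∀ {m n} → m ℕ.< suc q → n ℕ.< suc q → ℤ.+ m ≡ₘ ℤ.+ n → m ≡ n
    residue-unique {m} {n} m<p n<p m≡n with ℕ.≤-total m n
    ... | inj₁ m≤n = small-≡ m≤n n<p m≡n
    ... | inj₂ n≤m = ≡.sym (small-≡ n≤m m<p (≡ₚ-sym (suc q) {ℤ.+ m} {ℤ.+ n} m≡n))

    index : ℤ → Fin (suc q)
    index z = fromℕ< (n%ℕd<d z (suc q))

    index-residue : ∀ z → z ≡ₘ ℤ.+ toℕ (index z)
    index-residue z = ≡.subst (λ n → z ≡ₘ ℤ.+ n) (≡.sym (Fin.toℕ-fromℕ< (n%ℕd<d z (suc q)))) (residue (suc q) z)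

    index-unique : ∀ {z k} → z ≡ₘ ℤ.+ toℕ k → index z ≡ k
    index-unique {z} {k} z≡k = Fin.toℕ-injective (residue-unique (Fin.toℕ<n (index z)) (Fin.toℕ<n k)
      (≡ₚ-trans (suc q) {ℤ.+ toℕ (index z)} {z} {ℤ.+ toℕ k} (≡ₚ-sym (suc q) {z} {ℤ.+ toℕ (index z)} (index-residue z)) z≡k))

    index-cong : ∀ {y z} → y ≡ₘ z → index y ≡ index z
    index-cong {y} {z} y≡z = index-unique {y} {index z} (≡ₚ-trans (suc q) {y} {z} {ℤ.+ toℕ (index z)} y≡z (index-residue z))

    scale : ℤ → Fin (suc q) → Fin (suc q)
    scale t i = index (t ℤ.* ℤ.+ toℕ i)

    scale-inverse : ∀ s t → s ℤ.* t ≡ₘ ℤ.+ 1 → ∀ i → scale s (scale t i) ≡ i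
    scale-inverse s t st≡1 i = index-unique {s ℤ.* ℤ.+ toℕ (scale t i)} {i} (begin
      s ℤ.* ℤ.+ toℕ (scale t i)    ≈⟨ ≡ₚ-* (suc q) {s} {s} {ℤ.+ toℕ (scale t i)} {t ℤ.* ℤ.+ toℕ i} (≡⇒≡ₚ (suc q) {s} ≡.refl)
                                        (≡ₚ-sym (suc q) {t ℤ.* ℤ.+ toℕ i} {ℤ.+ toℕ (scale t i)} (index-residue (t ℤ.* ℤ.+ toℕ i))) ⟩
      s ℤ.* (t ℤ.* ℤ.+ toℕ i)      ≡⟨ ℤ.*-assoc s t (ℤ.+ toℕ i) ⟨
      (s ℤ.* t) ℤ.* ℤ.+ toℕ i      ≈⟨ ≡ₚ-* (suc q) {s ℤ.* t} {ℤ.+ 1} {ℤ.+ toℕ i} {ℤ.+ toℕ i} st≡1 (≡⇒≡ₚ (suc q) {ℤ.+ toℕ i} ≡.refl) ⟩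
      ℤ.+ 1 ℤ.* ℤ.+ toℕ i          ≡⟨ ℤ.*-identityˡ (ℤ.+ toℕ i) ⟩
      ℤ.+ toℕ i                    ∎)
      where
      open import Relation.Binary.Reasoning.Setoid (ℤ-Algebra.setoid (algebra (suc q)))

    scale-permutation : ∀ s t → s ℤ.* t ≡ₘ ℤ.+ 1 → Permutation′ (suc q)
    scale-permutation s t st≡1 = permutation (scale t) (scale s)
      (scale-inverse t s (≡.subst (_≡ₘ ℤ.+ 1) (ℤ.*-comm s t) st≡1)) (scale-inverse s t st≡1)

-- Splitting a quadratic exponent into row, column and cross terms.

module GaussFactorization where
  open import Data.Integer.Tactic.RingSolver using (solve-∀)
  open IntegersModulo
  open FiniteFieldPolynomials

  -- Completing the exponent a(j − s)² + b(j − s) + c to a product of s and j.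
  row-exponent column-exponent : ℤ → ℤ → ℤ → ℤ → ℤ
  row-exponent a b c s    = ℤ.- (a ℤ.* (s ℤ.* s) ℤ.- b ℤ.* s ℤ.+ c)
  column-exponent a b c j = ℤ.- (a ℤ.* (j ℤ.* j) ℤ.+ b ℤ.* j)

  quadratic-exponent : ℤ → ℤ → ℤ → ℤ → ℤ
  quadratic-exponent a b c x = a ℤ.* (x ℤ.* x) ℤ.+ b ℤ.* x ℤ.+ c

  cross-term : ∀ a b c s j →
    (row-exponent a b c s ℤ.+ quadratic-exponent a b c (j ℤ.- s)) ℤ.+ column-exponent a b c j ≡ (ℤ.- (a ℤ.+ a) ℤ.* s) ℤ.* j
  cross-term = expanded
    where
    expanded : ∀ a b c s j →
      (ℤ.- (a ℤ.* (s ℤ.* s) ℤ.- b ℤ.* s ℤ.+ c) ℤ.+ (a ℤ.* ((j ℤ.- s) ℤ.* (j ℤ.- s)) ℤ.+ b ℤ.* (j ℤ.- s) ℤ.+ c))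
        ℤ.+ ℤ.- (a ℤ.* (j ℤ.* j) ℤ.+ b ℤ.* j) ≡ (ℤ.- (a ℤ.+ a) ℤ.* s) ℤ.* j
    expanded = solve-∀

  module _ (q : ℕ) (p-prime : Prime (suc q)) where
    private
      module F where
        open PrimeField (primeField q p-prime) public hiding (q; p-prime)
        open PolynomialFunctions (primeField q p-prime) public
        open import Algebra.Properties.Semiring.Exp (PrimeField.semiring (primeField q p-prime)) public using () renaming (_^_ to _↑_)
      infix 4 _≡ₘ_
      _≡ₘ_ : ℤ → ℤ → Set
      _≡ₘ_ = _≡ₚ_ (suc q)

    -- By Fermat the inverse is y^(q-1).
    unit-inverse : ∀ y → ¬ y ≡ₘ ℤ.+ 0 → ∃ λ t → y ℤ.* t ≡ₘ ℤ.+ 1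
    unit-inverse y y≢0 = from-fermat q F.1≤q (F.fermat-unit {y} y≢0)
      where
      from-fermat : ∀ n → 1 ℕ.≤ n → y F.↑ n ≡ₘ ℤ.+ 1 → ∃ λ t → y ℤ.* t ≡ₘ ℤ.+ 1
      from-fermat (suc n) _ h = y F.↑ n , h

    double-unit : ∀ a → ¬ (a ℤ.+ a) ≡ₘ ℤ.+ 0 → ¬ ℤ.- (a ℤ.+ a) ≡ₘ ℤ.+ 0
    double-unit a 2a≢0 h = 2a≢0 (≡.subst (_≡ₘ ℤ.+ 0) (ℤ.neg-involutive (a ℤ.+ a)) (≡ₚ-neg (suc q) {ℤ.- (a ℤ.+ a)} {ℤ.+ 0} h))

    -- `t` inverts -2a, so s = t i turns the cross term -2a s j into i j.
    exponent-identity : ∀ a b c t s (i j : ℕ) → ℤ.- (a ℤ.+ a) ℤ.* t ≡ₘ ℤ.+ 1 → t ℤ.* ℤ.+ i ≡ₘ s →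
      ℤ.+ (i ℕ.* j) ≡ₘ (row-exponent a b c s ℤ.+ quadratic-exponent a b c (ℤ.+ j ℤ.- s)) ℤ.+ column-exponent a b c (ℤ.+ j)
    exponent-identity a b c t s i j yt≡1 ti≡s = begin
      ℤ.+ (i ℕ.* j)                            ≡⟨ ≡.trans (ℤ.pos-* i j) (≡.sym (ℤ.*-identityˡ (ℤ.+ i ℤ.* ℤ.+ j))) ⟩
      ℤ.+ 1 ℤ.* (ℤ.+ i ℤ.* ℤ.+ j)              ≈⟨ ≡ₚ-* (suc q) {y ℤ.* t} {ℤ.+ 1} {ℤ.+ i ℤ.* ℤ.+ j} {ℤ.+ i ℤ.* ℤ.+ j} yt≡1 (F.refl {ℤ.+ i ℤ.* ℤ.+ j}) ⟨
      (y ℤ.* t) ℤ.* (ℤ.+ i ℤ.* ℤ.+ j)          ≡⟨ reassociate y t (ℤ.+ i) (ℤ.+ j) ⟩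
      (y ℤ.* (t ℤ.* ℤ.+ i)) ℤ.* ℤ.+ j          ≈⟨ ≡ₚ-* (suc q) {y ℤ.* (t ℤ.* ℤ.+ i)} {y ℤ.* s} {ℤ.+ j} {ℤ.+ j} (≡ₚ-* (suc q) {y} {y} {t ℤ.* ℤ.+ i} {s} (F.refl {y}) ti≡s) (F.refl {ℤ.+ j}) ⟩
      (y ℤ.* s) ℤ.* ℤ.+ j                      ≡⟨ cross-term a b c s (ℤ.+ j) ⟨
      (row-exponent a b c s ℤ.+ quadratic-exponent a b c (ℤ.+ j ℤ.- s)) ℤ.+ column-exponent a b c (ℤ.+ j) ∎
      where
      open import Relation.Binary.Reasoning.Setoid F.setoid
      y = ℤ.- (a ℤ.+ a)
      reassociate : ∀ y t i j → (y ℤ.* t) ℤ.* (i ℤ.* j) ≡ (y ℤ.* (t ℤ.* i)) ℤ.* j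
      reassociate = solve-∀

-- Inverses and products of powers of w.

module RootPowers where
  open IntegersModulo using (_≡ₚ_)
  open RootsOfUnity

  module Powers (A : ℤ-Algebra) (char0 : CharacteristicZero A) (q : ℕ) (p-prime : Prime (suc q)) where
    open ℤ-Algebra A
    open UnityDichotomy A char0 q p-prime using (one-^; module NontrivialRoot)
    open import Algebra.Properties.Semiring.Exp semiring using (_^_; ^-congˡ; ^-assocʳ)
    open import Algebra.Properties.CommutativeSemiring.Exp commutativeSemiring using (^-distrib-*)
    open import Relation.Binary.Reasoning.Setoid setoid

    module _ (w : Carrier) (w^p≈1 : w ^ suc q ≈ 1#) (w≉1 : ¬ w ≈ 1#) where
      open NontrivialRoot w w^p≈1 w≉1 using (w^ℤ_; w^ℤ-+; w^ℤ-+ℕ; w^ℤ-cong)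

      inverse-power : ∀ {w̄} → w * w̄ ≈ 1# → ∀ n → w̄ ^ n ≈ w ^ (q ℕ.* n)
      inverse-power {w̄} ww̄≈1 n = begin
        w̄ ^ n                          ≈⟨ ^-congˡ n (begin
          w̄                            ≈⟨ *-identityʳ w̄ ⟨
          w̄ * 1#                       ≈⟨ *-congˡ w^p≈1 ⟨
          w̄ * (w * w ^ q)              ≈⟨ *-assoc w̄ w (w ^ q) ⟨
          (w̄ * w) * w ^ q              ≈⟨ *-congʳ (trans (*-comm w̄ w) ww̄≈1) ⟩
          1# * w ^ q                   ≈⟨ *-identityˡ (w ^ q) ⟩
          w ^ q                        ∎) ⟩
        (w ^ q) ^ n                    ≈⟨ ^-assocʳ w q n ⟩
        w ^ (q ℕ.* n)                  ∎

      power-unit : ∀ {w̄} → w * w̄ ≈ 1# → ∀ n → w ^ n * w̄ ^ n ≈ 1#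
      power-unit {w̄} ww̄≈1 n = trans (sym (^-distrib-* w w̄ n)) (one-^ n ww̄≈1)

      three-factors : ∀ {n h} α β γ → _≡ₚ_ (suc q) (ℤ.+ n) ((α ℤ.+ β) ℤ.+ γ) → h ≈ w^ℤ β → w ^ n ≈ (w^ℤ α * h) * w^ℤ γ
      three-factors {n} {h} α β γ n≡ h≈ = begin
        w ^ n                          ≈⟨ w^ℤ-+ℕ n ⟨
        w^ℤ (ℤ.+ n)                    ≈⟨ w^ℤ-cong {ℤ.+ n} {(α ℤ.+ β) ℤ.+ γ} n≡ ⟩
        w^ℤ ((α ℤ.+ β) ℤ.+ γ)          ≈⟨ w^ℤ-+ (α ℤ.+ β) γ ⟩
        w^ℤ (α ℤ.+ β) * w^ℤ γ          ≈⟨ *-congʳ (trans (w^ℤ-+ α β) (*-congˡ (sym h≈))) ⟩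
        (w^ℤ α * h) * w^ℤ γ            ∎

-- Circulant Hadamard matrices of prime order.

module CirculantHadamardMatrices where
  open import Defs
  open import Data.Integer.Divisibility.Signed using (_∣_; ∣⇒∣ᵤ)
  import Data.Fin.Permutation as Permutation
  import Data.Integer.Divisibility as Unsigned
  open import Data.Integer.DivMod using (_%ℕ_)
  open IntegersModulo
  open ComplexRing using (ℂ-algebra; ≈-refl; ≈-sym; ≈-trans)
  open RealEquality using (≈ʳ-sym; ≈ʳ-trans; ≈ʳ-pointwise)
  open ComplexCharacteristic using (ℂ-characteristicZero; *-conj; norm²; real)
  open ImaginaryExponential using (conj-^; conj-cong; exp-imaginary-unit)
  open PrincipalRootOfUnity using (root-of-unity; w≉1)
  open RootsOfUnity.UnityDichotomy ℂ-algebra ℂ-characteristicZero using (module NontrivialRoot)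
  open QuadraticExponents using (quadratic-exponents)
  open FinResidues
  open GaussFactorization
  open RootPowers.Powers ℂ-algebra ℂ-characteristicZero
  open ℤ-Algebra ℂ-algebra using (*-cong; semiring)
  open import Algebra.Properties.Semiring.Sum semiring using (sum-cong-≋)
  open import Algebra.Properties.Semiring.Exp semiring using (^-homo-*)

  unimodular-from-conj : ∀ {z} → z * conj z ≈ 1ᶜ → Unimodular z
  unimodular-from-conj {z} zz̄≈1 = nonnegative ,
    ≈ʳ-trans {1ʳ *ʳ 1ʳ} {1ʳ} {norm² z} (≈ʳ-pointwise {1ʳ *ʳ 1ʳ} {1ʳ} (λ _ → ≡.refl))
      (≈ʳ-sym {norm² z} {1ʳ} (proj₁ (≈-trans {real (norm² z)} {z * conj z} {1ᶜ} (≈-sym {z * conj z} {real (norm² z)} (*-conj z)) zz̄≈1)))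
    where
    nonnegative : 0ʳ ≤ʳ 1ʳ
    nonnegative (ε , 0<ε , N , h) = ℚ.<-asym (ℚ.<-trans 0<ε (h N ℕ.≤-refl)) (ℚ.negative⁻¹ (0ℚ ℚ.- 1ℚ))

  module _ {q : ℕ} (p-prime : Prime (ℕ.suc q)) {w : ℂ} (w-root : w ^ ℕ.suc q ≈ 1ᶜ) (w-nontrivial : ¬ w ≈ 1ᶜ) (w-unit : w * conj w ≈ 1ᶜ)
           {H : Matrix (ℕ.suc q)} (orthogonal : ∀ i j → i ≢ j → sum (λ k → H i k * conj (H j k)) ≈ 0ᶜ) (circulant : IsCirculant H)
           (e : Fin (ℕ.suc q) → ℕ) (H≈w^e : ∀ k → H zero k ≈ w ^ e k) where
    open NontrivialRoot q p-prime w w-root w-nontrivial using (w^ℤ_; w^ℤ-cong; w^ℤ-+ℕ)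

    p : ℕ
    p = ℕ.suc q

    infix 4 _≡ₘ_
    _≡ₘ_ : ℤ → ℤ → Set
    _≡ₘ_ = _≡ₚ_ p

    -- The exponents of row 0, extended to ℤ through residues; by circulance they determine all
    -- entries.
    E : ℤ → ℕ
    E z = e (index q z)

    E-cong : ∀ {x y} → x ≡ₘ y → E x ≡ E y
    E-cong {x} {y} h = ≡.cong e (index-cong q {x} {y} h)

    entry : ∀ i j → H i j ≈ w ^ E (ℤ.+ toℕ j ℤ.- ℤ.+ toℕ i)
    entry i j = ≈-trans {H i j} {H zero k} {w ^ e k} (circulant i j zero k divisible) (H≈w^e k)
      where
      d = ℤ.+ toℕ j ℤ.- ℤ.+ toℕ i
      k = index q d
      divisible : (ℤ.+ p) Unsigned.∣ (d ℤ.- (ℤ.+ toℕ k ℤ.- ℤ.+ 0))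
      divisible = ∣⇒∣ᵤ {ℤ.+ p} {d ℤ.- (ℤ.+ toℕ k ℤ.- ℤ.+ 0)}
        (subst (λ r → ℤ.+ p ∣ d ℤ.- r) (≡.sym (ℤ.+-identityʳ (ℤ.+ toℕ k))) (index-residue q d))

    -- Row -d against row 0: entry x of the former depends on x + d, and conjugation turns w^n into
    -- w^(q n), because w^q is the inverse of w.
    exponents-orthogonal : ∀ d → ¬ d ≡ₘ ℤ.+ 0 →
      sum {p} (λ x → w ^ (E (ℤ.+ toℕ x ℤ.+ d) ℕ.+ q ℕ.* E (ℤ.+ toℕ x))) ≈ 0ᶜ
    exponents-orthogonal d d≢0 = ≈-trans
      {sum {p} (λ x → w ^ (E (ℤ.+ toℕ x ℤ.+ d) ℕ.+ q ℕ.* E (ℤ.+ toℕ x)))} {sum {p} (λ k → H i k * conj (H zero k))} {0ᶜ}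
      (sum-cong-≋ {p} {λ x → w ^ (E (ℤ.+ toℕ x ℤ.+ d) ℕ.+ q ℕ.* E (ℤ.+ toℕ x))} {λ k → H i k * conj (H zero k)}
        (λ x → ≈-sym {H i x * conj (H zero x)} {w ^ (E (ℤ.+ toℕ x ℤ.+ d) ℕ.+ q ℕ.* E (ℤ.+ toℕ x))} (term x)))
      (orthogonal i zero i≢0)
      where
      i = index q (ℤ.- d)
      -d≡i : ℤ.- d ≡ₘ ℤ.+ toℕ i
      -d≡i = index-residue q (ℤ.- d)
      i≢0 : i ≢ zero
      i≢0 i≡0 = d≢0 (subst (_≡ₘ ℤ.+ 0) (ℤ.neg-involutive d)
        (≡ₚ-neg p {ℤ.- d} {ℤ.+ 0} (subst (λ k → ℤ.- d ≡ₘ ℤ.+ toℕ k) i≡0 -d≡i)))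
      shift : ∀ x → ℤ.+ toℕ x ℤ.- ℤ.+ toℕ i ≡ₘ ℤ.+ toℕ x ℤ.+ d
      shift x = ≡ₚ-+ p {ℤ.+ toℕ x} {ℤ.+ toℕ x} {ℤ.- ℤ.+ toℕ i} {d} (≡⇒≡ₚ p {ℤ.+ toℕ x} ≡.refl)
        (subst (ℤ.- ℤ.+ toℕ i ≡ₘ_) (ℤ.neg-involutive d) (≡ₚ-neg p {ℤ.+ toℕ i} {ℤ.- d} (≡ₚ-sym p {ℤ.- d} {ℤ.+ toℕ i} -d≡i)))
      term : ∀ x → H i x * conj (H zero x) ≈ w ^ (E (ℤ.+ toℕ x ℤ.+ d) ℕ.+ q ℕ.* E (ℤ.+ toℕ x))
      term x = ≈-trans {H i x * conj (H zero x)} {w ^ m * w ^ (q ℕ.* n)} {w ^ (m ℕ.+ q ℕ.* n)}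
        (*-cong {H i x} {w ^ m} {conj (H zero x)} {w ^ (q ℕ.* n)}
          (subst (λ k → H i x ≈ w ^ k) (E-cong {ℤ.+ toℕ x ℤ.- ℤ.+ toℕ i} {ℤ.+ toℕ x ℤ.+ d} (shift x)) (entry i x))
          (≈-trans {conj (H zero x)} {conj w ^ n} {w ^ (q ℕ.* n)}
            (≈-trans {conj (H zero x)} {conj (w ^ n)} {conj w ^ n}
              (conj-cong {H zero x} {w ^ n} (subst (λ k → H zero x ≈ w ^ E k) (ℤ.+-identityʳ (ℤ.+ toℕ x)) (entry zero x)))
              (conj-^ w n))
            (inverse-power q p-prime w w-root w-nontrivial {conj w} w-unit n)))
        (≈-sym {w ^ (m ℕ.+ q ℕ.* n)} {w ^ m * w ^ (q ℕ.* n)} (^-homo-* w m (q ℕ.* n)))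
        where
        m = E (ℤ.+ toℕ x ℤ.+ d)
        n = E (ℤ.+ toℕ x)

    w^ℤ-unimodular : ∀ z → Unimodular (w^ℤ z)
    w^ℤ-unimodular z = unimodular-from-conj {w ^ k} (≈-trans {w ^ k * conj (w ^ k)} {w ^ k * conj w ^ k} {1ᶜ}
      (*-cong {w ^ k} {w ^ k} {conj (w ^ k)} {conj w ^ k} (≈-refl {w ^ k}) (conj-^ w k))
      (power-unit q p-prime w w-root w-nontrivial {conj w} w-unit k))
      where k = z %ℕ p

    equivalent : (∃ λ a → ∃ λ b → ∃ λ c → ¬ (a ℤ.+ a) ≡ₘ ℤ.+ 0 × (∀ x → ℤ.+ E x ≡ₘ quadratic-exponent a b c x)) →
                 Equivalent H (fourier p w)
    equivalent (a , b , c , 2a≢0 , E≡) = from-inverse (unit-inverse q p-prime (ℤ.- (a ℤ.+ a)) (double-unit q p-prime a 2a≢0))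
      where
      from-inverse : (∃ λ t → ℤ.- (a ℤ.+ a) ℤ.* t ≡ₘ ℤ.+ 1) → Equivalent H (fourier p w)
      from-inverse (t , yt≡1) = record
        -- Row i of the Fourier matrix comes from row t i of `H`, where t inverts -2a.
        { rowPerm       = scale-permutation q (ℤ.- (a ℤ.+ a)) t yt≡1
        ; colPerm       = Permutation.id
        ; rowScale      = λ i → w^ℤ row-exponent a b c (s i)
        ; colScale      = λ j → w^ℤ column-exponent a b c (ℤ.+ toℕ j)
        ; rowUnimodular = λ i → w^ℤ-unimodular (row-exponent a b c (s i))
        ; colUnimodular = λ j → w^ℤ-unimodular (column-exponent a b c (ℤ.+ toℕ j))
        ; equal         = λ i j → three-factors q p-prime w w-root w-nontrivial {toℕ i ℕ.* toℕ j} {H (scale q t i) j}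
            (row-exponent a b c (s i)) (quadratic-exponent a b c (ℤ.+ toℕ j ℤ.- s i)) (column-exponent a b c (ℤ.+ toℕ j))
            (exponent-identity q p-prime a b c t (s i) (toℕ i) (toℕ j) yt≡1 (index-residue q (t ℤ.* ℤ.+ toℕ i)))
            (value i j)
        }
        where
        s : Fin p → ℤ
        s i = ℤ.+ toℕ (scale q t i)
        value : ∀ i j → H (scale q t i) j ≈ w^ℤ quadratic-exponent a b c (ℤ.+ toℕ j ℤ.- s i)
        value i j = ≈-trans {H (scale q t i) j} {w ^ E d} {w^ℤ quadratic-exponent a b c d} (entry (scale q t i) j)
          (≈-trans {w ^ E d} {w^ℤ (ℤ.+ E d)} {w^ℤ quadratic-exponent a b c d}
            (≈-sym {w^ℤ (ℤ.+ E d)} {w ^ E d} (w^ℤ-+ℕ (E d))) (w^ℤ-cong {ℤ.+ E d} {quadratic-exponent a b c d} (E≡ d)))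
          where d = ℤ.+ toℕ j ℤ.- s i

    equivalent-to-fourier : Equivalent H (fourier p w)
    equivalent-to-fourier = equivalent (quadratic-exponents ℂ-algebra ℂ-characteristicZero q p-prime w w-root w-nontrivial
      E (λ {x} {y} → E-cong {x} {y}) exponents-orthogonal)

  circulant-hadamard-equivalent : ∀ {q} → Prime (ℕ.suc q) → ∀ H → IsCirculantHadamard (ℕ.suc q) (ℕ.suc q) H →
         ∀ {π} → IsPi π → ∀ {w} → IsExp ((2πi/ ℕ.suc q) π) w → Equivalent H (fourier (ℕ.suc q) w)
  circulant-hadamard-equivalent {q} p-prime H circulantHadamard {π} isPi {w} isExp =
    equivalent-to-fourier p-prime {w} w^p≈1 w≢1 (exp-imaginary-unit {im ((2πi/ ℕ.suc q) π)} {w} isExp)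
      {H} (IsComplexHadamard.orthogonal hadamard) circulant (λ k → proj₁ (log k)) (λ k → proj₂ (log k))
    where
    open IsCirculantHadamard circulantHadamard
    w^p≈1 = root-of-unity p-prime isPi {w} isExp
    w≢1   = w≉1 p-prime isPi {w} isExp
    log : ∀ k → ∃ λ n → H zero k ≈ w ^ n
    log k = NontrivialRoot.logarithm q p-prime w w^p≈1 w≢1 (H zero k) (root zero k)

open import Defs
open import Data.Nat.Base using (NonZero)

theorem1p2 :
    (p : ℕ) .{{_ : NonZero p}} → Prime p →
    (H : Matrix p) → IsCirculantHadamard p p H →
    (π : ℝ) → IsPi π →
    (w : ℂ) → IsExp ((2πi/ p) π) w →
    Equivalent H (fourier p w)
theorem1p2 (suc q) p-prime H circulantHadamard π isPi w isExp =
  CirculantHadamardMatrices.circulant-hadamard-equivalent p-prime H circulantHadamard isPi isExp
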